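{- Let $(\mathfrak{D},\mathfrak{I},\sigma)$ be a Dynkin triple with $\mathfrak{D}$ connected, $\sigma=1$ and $\mathfrak{I}^{\ge2}\ne\emptyset$. Then the condition "the actions of $\sigma$ and of $-w_{0,\mathfrak{I}}$ on $\mathfrak{I}$ coincide" holds precisely in the following cases: (1) $\mathfrak{D}$ is of type $B_n$ or $C_n$ ($n\ge2$) and $\mathfrak{I}^{\ge2}$ is of type $B_m$ or $C_m$ respectively for some $2\le m\le n$ (i.e. $\mathfrak{I}^{\ge2}$ is connected and contains the multi-laced vertices); (2) $\mathfrak{D}$ is of type $D_4$ or $G_2$ and $\mathfrak{D}=\mathfrak{I}^{\ge2}$; (3) $\mathfrak{D}$ is of type $D_n$ ($n\ge5$) and $\mathfrak{I}^{\ge2}$ is the unique sub-diagram of type $D_{2m}$ for some $2\le m\le n/2$ (connected, of even size, containing the two extremal vertices permuted by $\mathrm{Aut}(\mathfrak{D})$); (4) $\mathfrak{D}$ is of type $F_4$ and $\mathfrak{I}^{\ge2}$ is the unique sub-diagram of type $B_2\cong C_2$, $B_3$, $C_3$ or $F_4$; (5) $\mathfrak{D}$ is of type $E_6$ and $\mathfrak{I}^{\ge2}\cong D_4$; (6) $\mathfrak{D}$ is of type $E_7$ and $\mathfrak{I}^{\ge2}$ is of type $D_4$, $D_6$ or $E_7$; (7) $\mathfrak{D}$ is of type $E_8$ and $\mathfrak{I}^{\ge2}$ is of type $D_4$, $D_6$, $E_7$ or $E_8$.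
   Context: A Dynkin triple $(\mathfrak{D},\mathfrak{I},\sigma)$ consists of a Dynkin diagram $\mathfrak{D}$ (of a reduced root system, vertices = simple roots), a diagram automorphism $\sigma\in\mathrm{Aut}(\mathfrak{D})$ and a $\sigma$-stable sub-diagram $\mathfrak{I}\subset\mathfrak{D}$ (possibly $\mathfrak{I}=\mathfrak{D}$). $-w_{0,\mathfrak{I}}$ is the opposition involution of $\mathfrak{I}$ (the permutation $\alpha\mapsto-w_{0,\mathfrak{I}}\alpha$ of $\mathfrak{I}$, where $w_{0,\mathfrak{I}}$ is the longest element of the Weyl group generated by reflections in $\mathfrak{I}$). A vertex of $\mathfrak{I}$ is isolated if its connected component in $\mathfrak{I}$ is a single vertex; $\mathfrak{I}^{\ge2}$ is the union of the connected components of $\mathfrak{I}$ with at least two vertices. -}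

module Defs where

open import Data.Nat as ℕ using (ℕ; zero; suc; _≤_; _∸_; _*_; _≡ᵇ_; _<ᵇ_; _≤ᵇ_)
open import Data.Bool using (Bool; true; false; _∧_; _∨_; if_then_else_)
open import Data.Fin using (Fin; toℕ)
open import Data.Unit using (⊤)
open import Data.Fin.Subset using (Subset; _∈_)
open import Data.Integer as ℤ using (ℤ; +_; -_; _-_)
open import Data.List using (List; []; _∷_; length)
open import Data.List.Relation.Unary.All using (All)
open import Data.Product using (Σ; ∃; _×_)
open import Data.Sum using (_⊎_)
open import Function.Definitions using (Injective)
open import Relation.Binary.PropositionalEquality using (_≡_)

-- Connected Dynkin diagrams of reduced root systems (Bourbaki numbering,
-- vertices 0-based).  The parameter of A/B/C/D is the rank.

data CartanType : Set where
  A B C D : ℕ → CartanType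
  E₆ E₇ E₈ F₄ G₂ : CartanType

ValidType : CartanType → Set
ValidType (A n) = 1 ≤ n
ValidType (B n) = 2 ≤ n
ValidType (C n) = 2 ≤ n
ValidType (D n) = 4 ≤ n
ValidType _     = ⊤

rank : CartanType → ℕ
rank (A n) = n
rank (B n) = n
rank (C n) = n
rank (D n) = n
rank E₆ = 6
rank E₇ = 7
rank E₈ = 8
rank F₄ = 4
rank G₂ = 2

private
  consec : ℕ → ℕ → Bool
  consec i j = (suc i ≡ᵇ j) ∨ (suc j ≡ᵇ i)

  pair : ℕ → ℕ → ℕ → ℕ → Bool
  pair a b i j = ((i ≡ᵇ a) ∧ (j ≡ᵇ b)) ∨ ((i ≡ᵇ b) ∧ (j ≡ᵇ a))

adjℕ : CartanType → ℕ → ℕ → Bool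
adjℕ (D n) i j = (consec i j ∧ (i ≤ᵇ (n ∸ 2)) ∧ (j ≤ᵇ (n ∸ 2)))
                 ∨ pair (n ∸ 3) (n ∸ 1) i j
adjℕ E₆ i j = pair 0 2 i j ∨ pair 1 3 i j ∨ (consec i j ∧ (2 ≤ᵇ i) ∧ (2 ≤ᵇ j))
adjℕ E₇ i j = pair 0 2 i j ∨ pair 1 3 i j ∨ (consec i j ∧ (2 ≤ᵇ i) ∧ (2 ≤ᵇ j))
adjℕ E₈ i j = pair 0 2 i j ∨ pair 1 3 i j ∨ (consec i j ∧ (2 ≤ᵇ i) ∧ (2 ≤ᵇ j))
adjℕ _ i j = consec i j

-- squared root lengths (short roots have length 1)
lenℕ : CartanType → ℕ → ℕ
lenℕ (B n) i = if i ≡ᵇ (n ∸ 1) then 1 else 2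
lenℕ (C n) i = if i ≡ᵇ (n ∸ 1) then 2 else 1
lenℕ F₄ i = if i ≤ᵇ 1 then 2 else 1
lenℕ G₂ i = if i ≡ᵇ 1 then 3 else 1
lenℕ _ _ = 1

Adjacent : (t : CartanType) → Fin (rank t) → Fin (rank t) → Set
Adjacent t i j = adjℕ t (toℕ i) (toℕ j) ≡ true

-- Cartan integers  cartan t i j = ⟨α_j , α_i^∨⟩ = 2(α_j,α_i)/(α_i,α_i)
cartan : (t : CartanType) → Fin (rank t) → Fin (rank t) → ℤ
cartan t i j =
  if toℕ i ≡ᵇ toℕ j then + 2
  else if adjℕ t (toℕ i) (toℕ j)
    then (if lenℕ t (toℕ i) <ᵇ lenℕ t (toℕ j) then - (+ lenℕ t (toℕ j)) else - (+ 1))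
    else + 0

-- Root lattice ℤ^{rank} (coordinates w.r.t. the simple roots) and the
-- Weyl group action by simple reflections.

∑ : ∀ {n} → (Fin n → ℤ) → ℤ
∑ {zero}  f = + 0
∑ {suc n} f = f Fin.zero ℤ.+ ∑ (λ k → f (Fin.suc k))

Lattice : CartanType → Set
Lattice t = Fin (rank t) → ℤ

simpleRoot : (t : CartanType) → Fin (rank t) → Lattice t
simpleRoot t j k = if toℕ j ≡ᵇ toℕ k then + 1 else + 0

reflect : (t : CartanType) → Fin (rank t) → Lattice t → Lattice t
reflect t i v k =
  if toℕ k ≡ᵇ toℕ i then v k - ∑ (λ j → cartan t i j ℤ.* v j) else v k

act : (t : CartanType) → List (Fin (rank t)) → Lattice t → Lattice t
act t [] v = v
act t (i ∷ w) v = reflect t i (act t w v)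

Word : (t : CartanType) → Subset (rank t) → List (Fin (rank t)) → Set
Word t I w = All (_∈ I) w

SameElt : (t : CartanType) → List (Fin (rank t)) → List (Fin (rank t)) → Set
SameElt t w u = ∀ j k → act t w (simpleRoot t j) k ≡ act t u (simpleRoot t j) k

-- w represents a longest element of W_I:  ℓ(u) ≤ ℓ(w) for all u ∈ W_I,
-- where ℓ is the minimal length of a word over I representing the element.
Longest : (t : CartanType) → Subset (rank t) → List (Fin (rank t)) → Set
Longest t I w =
  Word t I w ×
  (∀ v → Word t I v → SameElt t v w →
     ∀ u → Word t I u →
       Σ (List (Fin (rank t))) (λ u′ → Word t I u′ × SameElt t u′ u × length u′ ≤ length v))

-- the actions of σ = 1 and of -w_{0,I} on I coincide:
-- -w_{0,I} α_i = α_i for every i ∈ I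
OppositionTrivial : (t : CartanType) → Subset (rank t) → Set
OppositionTrivial t I =
  ∀ w → Longest t I w → ∀ i → i ∈ I →
    ∀ k → act t w (simpleRoot t i) k ≡ - (simpleRoot t i k)

-- I^{≥2}: vertices of I whose connected component in I is not a single
-- vertex, i.e. which have a neighbour in I.
I≥2 : (t : CartanType) → Subset (rank t) → Fin (rank t) → Set
I≥2 t I v = v ∈ I × ∃ (λ u → u ∈ I × Adjacent t u v)

OfType : (t′ : CartanType) → (t : CartanType) → (Fin (rank t) → Set) → Set
OfType t′ t P =
  Σ (Fin (rank t′) → Fin (rank t)) λ f →
    Injective _≡_ _≡_ f ×
    (∀ v → (P v → ∃ λ i → f i ≡ v) × ((∃ λ i → f i ≡ v) → P v)) ×
    (∀ i j → cartan t′ i j ≡ cartan t (f i) (f j))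

data Classified : (t : CartanType) → Subset (rank t) → Set where
  case1B : ∀ {n I} m → 2 ≤ m → m ≤ n → OfType (B m) (B n) (I≥2 (B n) I) → Classified (B n) I
  case1C : ∀ {n I} m → 2 ≤ m → m ≤ n → OfType (C m) (C n) (I≥2 (C n) I) → Classified (C n) I
  case2D : ∀ {I} → (∀ v → I≥2 (D 4) I v) → Classified (D 4) I
  case2G : ∀ {I} → (∀ v → I≥2 G₂ I v) → Classified G₂ I
  case3  : ∀ {n I} → 5 ≤ n → ∀ m → 2 ≤ m → 2 * m ≤ n →
           OfType (D (2 * m)) (D n) (I≥2 (D n) I) → Classified (D n) I
  case4  : ∀ {I} →
           OfType (B 2) F₄ (I≥2 F₄ I) ⊎ OfType (B 3) F₄ (I≥2 F₄ I) ⊎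
           OfType (C 3) F₄ (I≥2 F₄ I) ⊎ OfType F₄ F₄ (I≥2 F₄ I) → Classified F₄ I
  case5  : ∀ {I} → OfType (D 4) E₆ (I≥2 E₆ I) → Classified E₆ I
  case6  : ∀ {I} →
           OfType (D 4) E₇ (I≥2 E₇ I) ⊎ OfType (D 6) E₇ (I≥2 E₇ I) ⊎
           OfType E₇ E₇ (I≥2 E₇ I) → Classified E₇ I
  case7  : ∀ {I} →
           OfType (D 4) E₈ (I≥2 E₈ I) ⊎ OfType (D 6) E₈ (I≥2 E₈ I) ⊎
           OfType E₇ E₈ (I≥2 E₈ I) ⊎ OfType E₈ E₈ (I≥2 E₈ I) → Classified E₈ I

-- The W-invariant form on the root lattice is positive definite: a strictly dominant vector with
-- positive coordinates gives a sum-of-squares bound.  Splitting a root into its positive and negative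
-- parts and comparing norms shows that every root has a sign; this yields the exchange property, and
-- the longest elements of W_I are those that send every simple root of I to a negative root.  Such an
-- element exists by a descent on the form, and it sends each α i to some - α (τ i), where τ is an
-- automorphism of the diagram of I which preserves components.
--
-- Every w in W_I fixes the weights of I modulo its root lattice.  If w = -1 on I, twice each weight is
-- therefore in the root lattice, which excludes components of type A_k (k ≥ 2), D_k (k odd) and E₆.
-- Conversely the diagrams B, C, E₇, E₈, F₄, G₂ have no automorphisms, and for D_k (k even) the
-- half-spin weights, whose doubles are in the root lattice, have to be fixed by τ; hence τ = 1.
-- It remains to list the I whose components with at least two vertices are of the latter types.

module Submission where

open import Defs
open import Data.Bool using (Bool; true; false; if_then_else_; T; _∧_; _∨_)
import Data.Bool.Properties as Bool
open import Data.Bool.Properties using (∧-zeroʳ; ∨-comm; ∧-comm; ∧-conicalˡ; ∧-conicalʳ)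
open import Data.Empty using (⊥; ⊥-elim)
open import Data.Fin using (Fin; zero; suc; toℕ; fromℕ<; #_; _≟_; _↑ʳ_)
open import Data.Fin.Properties using (toℕ-injective; toℕ<n; toℕ-fromℕ<; toℕ-↑ʳ; ↑ʳ-injective; any?; all?)
open import Data.Fin.Subset using (Subset; _∈_)
open import Data.Fin.Subset.Properties using (_∈?_)
open import Data.Integer as ℤ using (ℤ; +_; -_; _+_; _-_; _*_; _≤_)
import Data.Integer.Properties as ℤₚ
open import Data.Integer.Divisibility.Signed
  using (_∣_; _∣?_; divides; ∣⇒∣ᵤ; ∣m⇒∣-m; ∣m∣n⇒∣m+n; ∣m∣n⇒∣m-n; ∣m⇒∣m*n; ∣n⇒∣m*n)
open import Data.Integer.Tactic.RingSolver using (solve-∀)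
import Data.List as List
open import Data.List using (List; []; _∷_; _++_; _∷ʳ_; allFin; length; reverse)
open import Data.List.Properties using (++-identityʳ; ++-assoc; unfold-reverse; reverse-involutive; length-++)
import Data.List.Relation.Unary.All as Allₗ
open import Data.List.Relation.Unary.All using (All; []; _∷_)
import Data.List.Relation.Unary.All.Properties as Allₚ
import Data.List.Relation.Unary.Any as Anyₗ
open import Data.List.Relation.Unary.Any using (Any; here; there)
open import Data.Nat as ℕ using (ℕ; zero; suc)
open import Data.Nat.Divisibility using (∣⇒≤)
import Data.Nat.Properties as ℕₚ
open import Data.Product using (Σ; ∃; _×_; _,_; proj₁; proj₂)
open import Data.Sum using (_⊎_; inj₁; inj₂; [_,_]′)
open import Data.Vec using (Vec; []; _∷_; lookup)
open import Algebra.Properties.Semiring.Sum ℤₚ.+-*-semiring as Sum using (sum)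
open import Function using (_∘_; id)
open import Relation.Binary.Definitions using (Tri; tri<; tri≈; tri>)
open import Relation.Binary.PropositionalEquality
open import Relation.Nullary using (¬_; Dec; yes; no; contradiction)
open import Relation.Nullary.Decidable
  using (_×-dec_; _⊎-dec_; _→-dec_; ¬?; decidable-stable; from-yes; from-no; map′; True; toWitness)

-- All vectors are integral, in the basis of simple roots. A weight need not lie in the root
-- lattice, so d times the weight is used instead: a vector whose pairings with the coroots are
-- divisible by d. Only its residues modulo d matter, and small ones are chosen. `OppositionTrivial`
-- quantifies over longest words and would hold vacuously if there were none, so the forward
-- implication needs the existence of such a word and not only a characterisation. The certificate
-- `dom` does two jobs: it bounds the form from below, and its pairing with positive roots drives
-- the descent to a longest element. The ranks in types A to D are unbounded. There the certificates
-- grow by one vertex at a time from the special end, and bad components are found by following I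
-- along paths of the diagram. The exceptional diagrams are settled by evaluation over all subsets.

≡ᵇ-refl : ∀ n → (n ℕ.≡ᵇ n) ≡ true
≡ᵇ-refl zero    = refl
≡ᵇ-refl (suc n) = ≡ᵇ-refl n

≢⇒≡ᵇ-false : ∀ {m n} → m ≢ n → (m ℕ.≡ᵇ n) ≡ false
≢⇒≡ᵇ-false {zero}  {zero}  m≢n = contradiction refl m≢n
≢⇒≡ᵇ-false {zero}  {suc n} m≢n = refl
≢⇒≡ᵇ-false {suc m} {zero}  m≢n = refl
≢⇒≡ᵇ-false {suc m} {suc n} m≢n = ≢⇒≡ᵇ-false (λ m≡n → m≢n (cong suc m≡n))

≡ᵇ-true⇒≡ : ∀ m n → (m ℕ.≡ᵇ n) ≡ true → m ≡ n
≡ᵇ-true⇒≡ zero    zero    _ = refl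
≡ᵇ-true⇒≡ (suc m) (suc n) e = cong suc (≡ᵇ-true⇒≡ m n e)

-- Finite sums of integers and integer inequalities.

∑≡sum : ∀ {n} (f : Fin n → ℤ) → ∑ f ≡ sum f
∑≡sum {zero}  f = refl
∑≡sum {suc n} f = cong (λ z → f zero + z) (∑≡sum (λ k → f (suc k)))

∑-cong : ∀ {n} {f g : Fin n → ℤ} → (∀ k → f k ≡ g k) → ∑ f ≡ ∑ g
∑-cong {zero}  e = refl
∑-cong {suc n} e = cong₂ _+_ (e zero) (∑-cong (λ k → e (suc k)))

∑-+ : ∀ {n} (f g : Fin n → ℤ) → ∑ (λ k → f k + g k) ≡ ∑ f + ∑ g
∑-+ f g = begin
  ∑ (λ k → f k + g k)    ≡⟨ ∑≡sum (λ k → f k + g k) ⟩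
  sum (λ k → f k + g k)  ≡⟨ Sum.∑-distrib-+ f g ⟩
  sum f + sum g          ≡⟨ cong₂ _+_ (∑≡sum f) (∑≡sum g) ⟨
  ∑ f + ∑ g              ∎
  where open ≡-Reasoning

∑-* : ∀ {n} a (f : Fin n → ℤ) → ∑ (λ k → a * f k) ≡ a * ∑ f
∑-* a f = trans (∑≡sum (λ k → a * f k)) (trans (sym (Sum.*-distribˡ-sum a f)) (cong (a *_) (sym (∑≡sum f))))

∑-swap : ∀ {m n} (f : Fin m → Fin n → ℤ) → ∑ (λ i → ∑ (f i)) ≡ ∑ (λ j → ∑ (λ i → f i j))
∑-swap f = begin
  ∑ (λ i → ∑ (f i))            ≡⟨ ∑-cong (λ i → ∑≡sum (f i)) ⟩
  ∑ (λ i → sum (f i))          ≡⟨ ∑≡sum (λ i → sum (f i)) ⟩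
  sum (λ i → sum (f i))        ≡⟨ Sum.∑-comm f ⟩
  sum (λ j → sum (λ i → f i j)) ≡⟨ ∑≡sum (λ j → sum (λ i → f i j)) ⟨
  ∑ (λ j → sum (λ i → f i j))  ≡⟨ ∑-cong (λ j → sym (∑≡sum (λ i → f i j))) ⟩
  ∑ (λ j → ∑ (λ i → f i j))    ∎
  where open ≡-Reasoning

∑-zero : ∀ {n} {f : Fin n → ℤ} → (∀ k → f k ≡ + 0) → ∑ f ≡ + 0
∑-zero {zero}  e = refl
∑-zero {suc n} e = cong₂ _+_ (e zero) (∑-zero (λ k → e (suc k)))

∑-mono : ∀ {n} {f g : Fin n → ℤ} → (∀ k → f k ≤ g k) → ∑ f ≤ ∑ g
∑-mono {zero}  e = ℤₚ.≤-refl
∑-mono {suc n} e = ℤₚ.+-mono-≤ (e zero) (∑-mono (λ k → e (suc k)))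

∑-nonneg : ∀ {n} {f : Fin n → ℤ} → (∀ k → + 0 ≤ f k) → + 0 ≤ ∑ f
∑-nonneg {n} {f} e = subst (_≤ ∑ f) (∑-zero {n} {λ _ → + 0} (λ _ → refl)) (∑-mono e)

∑-nonpos : ∀ {n} {f : Fin n → ℤ} → (∀ k → f k ≤ + 0) → ∑ f ≤ + 0
∑-nonpos {n} {f} e = subst (∑ f ≤_) (∑-zero {n} {λ _ → + 0} (λ _ → refl)) (∑-mono e)

term≤∑ : ∀ {n} {f : Fin n → ℤ} → (∀ k → + 0 ≤ f k) → ∀ k → f k ≤ ∑ f
term≤∑ {suc n} {f} e zero =
  subst (_≤ ∑ f) (ℤₚ.+-identityʳ _) (ℤₚ.+-monoʳ-≤ (f zero) (∑-nonneg (λ k → e (suc k))))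
term≤∑ {suc n} {f} e (suc k) =
  subst (_≤ ∑ f) (ℤₚ.+-identityˡ _) (ℤₚ.+-mono-≤ (e zero) (term≤∑ (λ k → e (suc k)) k))

∑-∣ : ∀ {n} {d} {f : Fin n → ℤ} → (∀ k → d ∣ f k) → d ∣ ∑ f
∑-∣ {zero}  e = divides (+ 0) refl
∑-∣ {suc n} e = ∣m∣n⇒∣m+n (e zero) (∑-∣ (λ k → e (suc k)))

-- Unfolds to the same term as `simpleRoot`, for an arbitrary index set, so facts about it serve
-- simple roots and coordinates on a component alike.
δ : ∀ {n} → Fin n → Fin n → ℤ
δ i k = if toℕ i ℕ.≡ᵇ toℕ k then + 1 else + 0

δ-diag : ∀ {n} (i : Fin n) → δ i i ≡ + 1
δ-diag i = cong (if_then + 1 else + 0) (≡ᵇ-refl (toℕ i))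

δ-off : ∀ {n} {i k : Fin n} → i ≢ k → δ i k ≡ + 0
δ-off i≢k = cong (if_then + 1 else + 0) (≢⇒≡ᵇ-false (λ e → i≢k (toℕ-injective e)))

δ-sym : ∀ {n} (i k : Fin n) → δ i k ≡ δ k i
δ-sym i k with i ≟ k
... | yes refl = refl
... | no  i≢k  = trans (δ-off i≢k) (sym (δ-off (≢-sym i≢k)))

∑-δ : ∀ {n} (f : Fin n → ℤ) i → ∑ (λ k → f k * δ i k) ≡ f i
∑-δ {suc n} f zero = begin
  f zero * + 1 + ∑ (λ k → f (suc k) * + 0)
    ≡⟨ cong₂ _+_ (ℤₚ.*-identityʳ (f zero)) (∑-zero (λ k → ℤₚ.*-zeroʳ (f (suc k)))) ⟩
  f zero + + 0  ≡⟨ ℤₚ.+-identityʳ _ ⟩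
  f zero        ∎
  where open ≡-Reasoning
∑-δ {suc n} f (suc i) = begin
  f zero * + 0 + ∑ (λ k → f (suc k) * δ i k)
    ≡⟨ cong₂ _+_ (ℤₚ.*-zeroʳ (f zero)) (∑-δ (λ k → f (suc k)) i) ⟩
  + 0 + f (suc i)  ≡⟨ ℤₚ.+-identityˡ _ ⟩
  f (suc i)        ∎
  where open ≡-Reasoning

-- The off-diagonal terms of a symmetric double sum occur in pairs.
∑∑-even : ∀ {n} {d} (M : Fin n → Fin n → ℤ) → (∀ i j → M i j ≡ M j i) →
          (∀ i → + 2 * d ∣ M i i) → (∀ i j → d ∣ M i j) →
          + 2 * d ∣ ∑ (λ i → ∑ (M i))
∑∑-even {zero}  M M-sym diag off = divides (+ 0) refl
∑∑-even {suc n} {d} M M-sym diag off =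
  subst (+ 2 * d ∣_) (sym split) (∣m∣n⇒∣m+n (∣m∣n⇒∣m+n (diag zero) row∣) rest∣)
  where
  r = ∑ (λ j → M zero (suc j))
  R = ∑ (λ i → ∑ (λ j → M (suc i) (suc j)))
  arrange : ∀ a r R → (a + r) + (r + R) ≡ (a + + 2 * r) + R
  arrange = solve-∀
  split : ∑ (λ i → ∑ (M i)) ≡ (M zero zero + + 2 * r) + R
  split = trans
    (cong (λ z → (M zero zero + r) + z) (trans (∑-+ (λ i → M (suc i) zero) (λ i → ∑ (λ j → M (suc i) (suc j))))
                           (cong (λ z → z + R) (∑-cong (λ i → M-sym (suc i) zero)))))
    (arrange (M zero zero) r R)
  double : ∀ q d → + 2 * (q * d) ≡ q * (+ 2 * d)
  double = solve-∀
  row∣ : + 2 * d ∣ + 2 * r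
  row∣ with ∑-∣ (λ j → off zero (suc j))
  ... | divides q e = divides q (trans (cong (+ 2 *_) e) (double q d))
  rest∣ : + 2 * d ∣ R
  rest∣ = ∑∑-even (λ i j → M (suc i) (suc j)) (λ i j → M-sym (suc i) (suc j))
                  (λ i → diag (suc i)) (λ i j → off (suc i) (suc j))

-- Inequalities are certified by a visibly nonnegative expression for the difference; the identity
-- is left to the ring solver.
≤-by : ∀ {a b c} → + 0 ≤ c → b - a ≡ c → a ≤ b
≤-by 0≤c e = ℤₚ.0≤i-j⇒j≤i (subst (+ 0 ≤_) (sym e) 0≤c)

*-nonneg : ∀ {a b} → + 0 ≤ a → + 0 ≤ b → + 0 ≤ a * b
*-nonneg {+ a} {+ b} _ _ = subst (+ 0 ≤_) (ℤₚ.pos-* a b) (ℤ.+≤+ ℕ.z≤n)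

square-nonneg : ∀ a → + 0 ≤ a * a
square-nonneg (+ a)      = *-nonneg {+ a} {+ a} (ℤ.+≤+ ℕ.z≤n) (ℤ.+≤+ ℕ.z≤n)
square-nonneg ℤ.-[1+ a ] = ℤ.+≤+ ℕ.z≤n

square≤0⇒≡0 : ∀ a → a * a ≤ + 0 → a ≡ + 0
square≤0⇒≡0 (+ zero)   _ = refl
square≤0⇒≡0 (+ suc a)  (ℤ.+≤+ ())
square≤0⇒≡0 ℤ.-[1+ a ] (ℤ.+≤+ ())

*-nonpos : ∀ {a b} → a ≤ + 0 → + 0 ≤ b → a * b ≤ + 0
*-nonpos {a} {b} a≤0 0≤b =
  ≤-by (*-nonneg (ℤₚ.neg-mono-≤ a≤0) 0≤b) (eq a b)
  where
  eq : ∀ a b → + 0 - a * b ≡ (- a) * b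
  eq = solve-∀


-- Clears denominators: for `a` = `dom` the factors b k = L / dom k turn the quotients x k / dom k
-- into integers.
common-multiple : ∀ {n} (a : Fin n → ℤ) → (∀ k → + 1 ≤ a k) →
  Σ ℤ λ L → + 1 ≤ L × Σ (Fin n → ℤ) λ b → (∀ k → + 1 ≤ b k) × (∀ k → a k * b k ≡ L)
common-multiple {zero}  a 1≤a = + 1 , ℤₚ.≤-refl , (λ ()) , (λ ()) , (λ ())
common-multiple {suc n} a 1≤a with common-multiple (a ∘ suc) (1≤a ∘ suc)
... | L , 1≤L , b , 1≤b , ab≡L =
  a zero * L , *-pos (1≤a zero) 1≤L ,
  (λ { zero → L ; (suc k) → a zero * b k }) ,
  (λ { zero → 1≤L ; (suc k) → *-pos (1≤a zero) (1≤b k) }) ,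
  (λ { zero → refl
     ; (suc k) → trans (swap (a (suc k)) (a zero) (b k)) (cong (λ z → a zero * z) (ab≡L k)) })
  where
  *-pos : ∀ {x y} → + 1 ≤ x → + 1 ≤ y → + 1 ≤ x * y
  *-pos {x} {y} 1≤x 1≤y =
    ≤-by (ℤₚ.+-mono-≤ (*-nonneg (ℤₚ.i≤j⇒0≤j-i 1≤x) (ℤₚ.i≤j⇒0≤j-i 1≤y))
           (ℤₚ.+-mono-≤ (ℤₚ.i≤j⇒0≤j-i 1≤x) (ℤₚ.i≤j⇒0≤j-i 1≤y))) (eq x y)
    where
    eq : ∀ x y → x * y - + 1 ≡ (x - + 1) * (y - + 1) + ((x - + 1) + (y - + 1))
    eq = solve-∀
  swap : ∀ x y z → x * (y * z) ≡ y * (x * z)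
  swap = solve-∀

-- Cartan matrices and certificates of finite type.

cartan-diag : ∀ t i → cartan t i i ≡ + 2
cartan-diag t i rewrite ≡ᵇ-refl (toℕ i) = refl

cartan-off : ∀ t {i j} → i ≢ j → cartan t i j ≤ + 0
cartan-off t {i} {j} i≢j rewrite ≢⇒≡ᵇ-false {toℕ i} {toℕ j} (λ e → i≢j (toℕ-injective e))
  with adjℕ t (toℕ i) (toℕ j)
... | false = ℤₚ.≤-refl
... | true with lenℕ t (toℕ i) ℕ.<ᵇ lenℕ t (toℕ j)
...   | true  = ℤₚ.neg-≤-pos
...   | false = ℤ.-≤+

cartan≡2⇒≡ : ∀ t {i j} → cartan t i j ≡ + 2 → i ≡ j
cartan≡2⇒≡ t {i} {j} e with i ≟ j
... | yes i≡j = i≡j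
... | no  i≢j with subst (_≤ + 0) e (cartan-off t i≢j)
...   | ℤ.+≤+ ()

-- The vector dom, strictly dominant and positive in the root lattice, certifies that
-- the invariant form is positive definite.
record FiniteType (t : CartanType) : Set where
  field
    len-pos     : ∀ (i : Fin (rank t)) → 1 ℕ.≤ lenℕ t (toℕ i)
    len-cartan  : ∀ i j → + lenℕ t (toℕ i) * cartan t i j ≡ + lenℕ t (toℕ j) * cartan t j i
    dom         : Fin (rank t) → ℤ
    dom-pos     : ∀ i → + 1 ≤ dom i
    dom-row     : ∀ i → + 1 ≤ ∑ (λ j → cartan t i j * dom j)

posPart negPart : ℤ → ℤ
posPart (+ n)      = + n
posPart ℤ.-[1+ n ] = + 0
negPart (+ n)      = + 0
negPart ℤ.-[1+ n ] = + suc n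

posPart-negPart : ∀ a → a ≡ posPart a - negPart a
posPart-negPart (+ n)      = sym (ℤₚ.+-identityʳ (+ n))
posPart-negPart ℤ.-[1+ n ] = refl

posPart-nonneg : ∀ a → + 0 ≤ posPart a
posPart-nonneg (+ n)      = ℤ.+≤+ ℕ.z≤n
posPart-nonneg ℤ.-[1+ n ] = ℤ.+≤+ ℕ.z≤n

negPart-nonneg : ∀ a → + 0 ≤ negPart a
negPart-nonneg (+ n)      = ℤ.+≤+ ℕ.z≤n
negPart-nonneg ℤ.-[1+ n ] = ℤ.+≤+ ℕ.z≤n

posPart*negPart : ∀ a → posPart a * negPart a ≡ + 0
posPart*negPart (+ n)      = ℤₚ.*-zeroʳ (+ n)
posPart*negPart ℤ.-[1+ n ] = refl

posPart≡0⇒≤0 : ∀ a → posPart a ≡ + 0 → a ≤ + 0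
posPart≡0⇒≤0 (+ n)      e = ℤₚ.≤-reflexive e
posPart≡0⇒≤0 ℤ.-[1+ n ] e = ℤ.-≤+

negPart≡0⇒0≤ : ∀ a → negPart a ≡ + 0 → + 0 ≤ a
negPart≡0⇒0≤ (+ n) e = ℤ.+≤+ ℕ.z≤n

∣*posPart : ∀ {d} l a → d ∣ l * a → d ∣ l * posPart a
∣*posPart l (+ n)      d∣ = d∣
∣*posPart l ℤ.-[1+ n ] d∣ = divides (+ 0) (ℤₚ.*-zeroʳ l)

∣*negPart : ∀ {d} l a → d ∣ l * a → d ∣ l * negPart a
∣*negPart l (+ n)      d∣ = divides (+ 0) (ℤₚ.*-zeroʳ l)
∣*negPart l ℤ.-[1+ n ] (divides q eq) =
  divides (- q) (trans (sym (ℤₚ.neg-distribʳ-* l ℤ.-[1+ n ])) (trans (cong -_ eq) (ℤₚ.neg-distribˡ-* q _)))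

∣-nonneg : ∀ {d a} → + 0 ≤ d → d ∣ a → + 0 ≤ a → a ≤ + 0 ⊎ d ≤ a
∣-nonneg {d} {a} 0≤d (divides (+ zero) eq) 0≤a = inj₁ (ℤₚ.≤-reflexive (trans eq (ℤₚ.*-zeroˡ d)))
∣-nonneg {d} {a} 0≤d (divides (+ suc q) eq) 0≤a =
  inj₂ (≤-by (*-nonneg {+ q} {d} (ℤ.+≤+ ℕ.z≤n) 0≤d) (trans (cong (λ z → z - d) eq) (lemma (+ q) d)))
  where
  lemma : ∀ q d → (+ 1 + q) * d - d ≡ q * d
  lemma = solve-∀
∣-nonneg {d} {a} 0≤d (divides ℤ.-[1+ q ] eq) 0≤a =
  inj₁ (subst (_≤ + 0) (sym eq) (*-nonpos {ℤ.-[1+ q ]} {d} ℤ.-≤+ 0≤d))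

unit-∣∣ : ∀ a z → a * z ≡ + 1 → ℤ.∣ a ∣ ≡ 1
unit-∣∣ a z eq = ℕₚ.m*n≡1⇒m≡1 ℤ.∣ a ∣ ℤ.∣ z ∣ (trans (sym (ℤₚ.abs-* a z)) (cong ℤ.∣_∣ eq))

0≤∧unit⇒≡1 : ∀ {a} → + 0 ≤ a → ℤ.∣ a ∣ ≡ 1 → a ≡ + 1
0≤∧unit⇒≡1 (ℤ.+≤+ _) e = cong +_ e

-- Weyl group, invariant form and roots.

module Weyl (t : CartanType) (fin : FiniteType t) where
  open FiniteType fin

  r : ℕ
  r = rank t

  Vect : Set
  Vect = Fin r → ℤ

  -- `e` is the Gram matrix of the simple roots, normalised so that α i has norm 2 ℓ i; `len-cartan`
  -- is its symmetry.
  c e : Fin r → Fin r → ℤ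
  c = cartan t

  ℓ : Fin r → ℤ
  ℓ i = + lenℕ t (toℕ i)

  e i j = ℓ i * c i j

  ℓ-pos : ∀ i → + 1 ≤ ℓ i
  ℓ-pos i = ℤ.+≤+ (len-pos i)

  instance
    ℓ-nonZero : ∀ {i} → ℤ.NonZero (ℓ i)
    ℓ-nonZero {i} = ℕ.≢-nonZero (λ z → ℕₚ.<-irrefl (sym z) (len-pos i))

  α : Fin r → Vect
  α = δ

  -- The pairing of v with the coroot of α i.
  row : Fin r → Vect → ℤ
  row i v = ∑ (λ j → c i j * v j)

  infix 4 _≗ᵥ_
  _≗ᵥ_ : Vect → Vect → Set
  x ≗ᵥ y = ∀ k → x k ≡ y k

  -- The one linear operation in use: reflections have this shape, addition is the case a = -1, and
  -- negation is subtraction from the zero vector.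
  _-[_]_ : Vect → ℤ → Vect → Vect
  (x -[ a ] y) k = x k - a * y k

  NonNeg NonPos : Vect → Set
  NonNeg x = ∀ k → + 0 ≤ x k
  NonPos x = ∀ k → x k ≤ + 0

  row-cong : ∀ i {x y} → x ≗ᵥ y → row i x ≡ row i y
  row-cong i x≗y = ∑-cong (λ j → cong (λ z → c i j * z) (x≗y j))

  ∑-comb : ∀ (f g : Vect) a → ∑ (λ k → f k - a * g k) ≡ ∑ f - a * ∑ g
  ∑-comb f g a = begin
    ∑ (λ k → f k - a * g k)          ≡⟨ ∑-cong (λ k → eq (f k) a (g k)) ⟩
    ∑ (λ k → f k + (- a) * g k)      ≡⟨ ∑-+ f (λ k → (- a) * g k) ⟩
    ∑ f + ∑ (λ k → (- a) * g k)      ≡⟨ cong (λ z → ∑ f + z) (∑-* (- a) g) ⟩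
    ∑ f + (- a) * ∑ g                ≡⟨ sym (eq (∑ f) a (∑ g)) ⟩
    ∑ f - a * ∑ g                    ∎
    where
    open ≡-Reasoning
    eq : ∀ x a y → x - a * y ≡ x + (- a) * y
    eq = solve-∀

  row-comb : ∀ i x a y → row i (x -[ a ] y) ≡ row i x - a * row i y
  row-comb i x a y = trans (∑-cong (λ j → eq (c i j) (x j) a (y j))) (∑-comb _ _ a)
    where
    eq : ∀ c x a y → c * (x - a * y) ≡ c * x - a * (c * y)
    eq = solve-∀

  row-α : ∀ i j → row i (α j) ≡ c i j
  row-α i j = ∑-δ (c i) j

  reflect-comb : ∀ i v → reflect t i v ≗ᵥ (v -[ row i v ] α i)
  reflect-comb i v k with i ≟ k
  ... | yes refl = trans (cong (if_then v i - row i v else v i) (≡ᵇ-refl (toℕ i)))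
                     (trans (eq (v i) (row i v)) (cong (λ z → v i - row i v * z) (sym (δ-diag i))))
    where
    eq : ∀ x a → x - a ≡ x - a * + 1
    eq = solve-∀
  ... | no i≢k = trans (cong (if_then v k - row i v else v k)
                             (≢⇒≡ᵇ-false (λ z → i≢k (sym (toℕ-injective z)))))
                   (trans (eq (v k) (row i v)) (cong (λ z → v k - row i v * z) (sym (δ-off i≢k))))
    where
    eq : ∀ x a → x ≡ x - a * + 0
    eq = solve-∀

  reflect-cong : ∀ i {x y} → x ≗ᵥ y → reflect t i x ≗ᵥ reflect t i y
  reflect-cong i {x} {y} x≗y k = begin
    reflect t i x k            ≡⟨ reflect-comb i x k ⟩
    x k - row i x * δ i k      ≡⟨ cong₂ (λ a b → a - b * δ i k) (x≗y k) (row-cong i x≗y) ⟩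
    y k - row i y * δ i k      ≡⟨ reflect-comb i y k ⟨
    reflect t i y k            ∎
    where open ≡-Reasoning

  act-cong : ∀ w {x y} → x ≗ᵥ y → act t w x ≗ᵥ act t w y
  act-cong []      x≗y = x≗y
  act-cong (i ∷ w) x≗y = reflect-cong i (act-cong w x≗y)

  act-++ : ∀ w u v → act t (w ++ u) v ≡ act t w (act t u v)
  act-++ []      u v = refl
  act-++ (i ∷ w) u v = cong (reflect t i) (act-++ w u v)

  act-comb : ∀ w x a y → act t w (x -[ a ] y) ≗ᵥ (act t w x -[ a ] act t w y)
  act-comb []      x a y k = refl
  act-comb (i ∷ w) x a y k = begin
    reflect t i (act t w (x -[ a ] y)) k    ≡⟨ reflect-cong i (act-comb w x a y) k ⟩
    reflect t i (x′ -[ a ] y′) k            ≡⟨ reflect-comb i (x′ -[ a ] y′) k ⟩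
    (x′ k - a * y′ k) - row i (x′ -[ a ] y′) * δ i k
      ≡⟨ cong (λ z → (x′ k - a * y′ k) - z * δ i k) (row-comb i x′ a y′) ⟩
    (x′ k - a * y′ k) - (row i x′ - a * row i y′) * δ i k
      ≡⟨ eq (x′ k) a (y′ k) (row i x′) (row i y′) (δ i k) ⟩
    (x′ k - row i x′ * δ i k) - a * (y′ k - row i y′ * δ i k)
      ≡⟨ cong₂ (λ p q → p - a * q) (reflect-comb i x′ k) (reflect-comb i y′ k) ⟨
    reflect t i x′ k - a * reflect t i y′ k ∎
    where
    open ≡-Reasoning
    x′ = act t w x
    y′ = act t w y
    eq : ∀ x a y p q d → (x - a * y) - (p - a * q) * d ≡ (x - p * d) - a * (y - q * d)
    eq = solve-∀

  row-∑ : ∀ {s} i (a : Fin s → ℤ) (f : Fin s → Vect) →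
          row i (λ m → ∑ (λ j → a j * f j m)) ≡ ∑ (λ j → a j * row i (f j))
  row-∑ i a f = begin
    ∑ (λ m → c i m * ∑ (λ j → a j * f j m))
      ≡⟨ ∑-cong (λ m → sym (∑-* (c i m) (λ j → a j * f j m))) ⟩
    ∑ (λ m → ∑ (λ j → c i m * (a j * f j m)))
      ≡⟨ ∑-swap (λ m j → c i m * (a j * f j m)) ⟩
    ∑ (λ j → ∑ (λ m → c i m * (a j * f j m)))
      ≡⟨ ∑-cong (λ j → trans (∑-cong (λ m → eq (c i m) (a j) (f j m)))
                             (∑-* (a j) (λ m → c i m * f j m))) ⟩
    ∑ (λ j → a j * row i (f j)) ∎
    where
    open ≡-Reasoning
    eq : ∀ x y z → x * (y * z) ≡ y * (x * z)
    eq = solve-∀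

  -- Linearity in coordinates: w is determined by the images of the simple roots. This links
  -- `SameElt`, which tests simple roots only, with `_≈_`, which tests all vectors.
  act-expand : ∀ w v k → act t w v k ≡ ∑ (λ j → v j * act t w (α j) k)
  act-expand [] v k = trans (sym (∑-δ v k)) (∑-cong (λ j → cong (λ z → v j * z) (δ-sym k j)))
  act-expand (i ∷ w) v k = begin
    reflect t i (act t w v) k  ≡⟨ reflect-cong i (act-expand w v) k ⟩
    reflect t i s k            ≡⟨ reflect-comb i s k ⟩
    s k - row i s * δ i k      ≡⟨ cong (λ z → s k - z * δ i k) (row-∑ i v a) ⟩
    s k - ∑ (λ j → v j * row i (a j)) * δ i k
      ≡⟨ cong (λ z → s k - z) (ℤₚ.*-comm (∑ (λ j → v j * row i (a j))) (δ i k)) ⟩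
    s k - δ i k * ∑ (λ j → v j * row i (a j))
      ≡⟨ ∑-comb (λ j → v j * a j k) (λ j → v j * row i (a j)) (δ i k) ⟨
    ∑ (λ j → v j * a j k - δ i k * (v j * row i (a j)))
      ≡⟨ ∑-cong (λ j → trans (eq (v j) (a j k) (row i (a j)) (δ i k))
                             (cong (λ z → v j * z) (sym (reflect-comb i (a j) k)))) ⟩
    ∑ (λ j → v j * reflect t i (a j) k) ∎
    where
    open ≡-Reasoning
    a : Fin r → Vect
    a j = act t w (α j)
    s : Vect
    s m = ∑ (λ j → v j * a j m)
    eq : ∀ v a p d → v * a - d * (v * p) ≡ v * (a - p * d)
    eq = solve-∀

  act-zero : ∀ w {v} → (∀ k → v k ≡ + 0) → ∀ k → act t w v k ≡ + 0
  act-zero w {v} v≡0 k = trans (act-expand w v k)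
    (∑-zero (λ j → trans (cong (λ z → z * act t w (α j) k) (v≡0 j)) (ℤₚ.*-zeroˡ (act t w (α j) k))))

  reflect-involutive : ∀ i v → reflect t i (reflect t i v) ≗ᵥ v
  reflect-involutive i v k = begin
    reflect t i (reflect t i v) k        ≡⟨ reflect-cong i (reflect-comb i v) k ⟩
    reflect t i (v -[ a ] α i) k         ≡⟨ reflect-comb i (v -[ a ] α i) k ⟩
    (v k - a * δ i k) - row i (v -[ a ] α i) * δ i k
      ≡⟨ cong (λ z → (v k - a * δ i k) - z * δ i k)
           (trans (row-comb i v a (α i))
                  (cong (λ z → a - a * z) (trans (row-α i i) (cartan-diag t i)))) ⟩
    (v k - a * δ i k) - (a - a * + 2) * δ i k  ≡⟨ eq (v k) a (δ i k) ⟩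
    v k ∎
    where
    open ≡-Reasoning
    a = row i v
    eq : ∀ v a d → (v - a * d) - (a - a * + 2) * d ≡ v
    eq = solve-∀

  act-reverseˡ : ∀ w v → act t (reverse w) (act t w v) ≗ᵥ v
  act-reverseˡ []      v k = refl
  act-reverseˡ (i ∷ w) v k = begin
    act t (reverse (i ∷ w)) (reflect t i x) k
      ≡⟨ cong (λ u → act t u (reflect t i x) k) (unfold-reverse i w) ⟩
    act t (reverse w ∷ʳ i) (reflect t i x) k
      ≡⟨ cong (λ f → f k) (act-++ (reverse w) (i ∷ []) (reflect t i x)) ⟩
    act t (reverse w) (reflect t i (reflect t i x)) k
      ≡⟨ act-cong (reverse w) (reflect-involutive i x) k ⟩
    act t (reverse w) x k ≡⟨ act-reverseˡ w v k ⟩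
    v k ∎
    where
    open ≡-Reasoning
    x = act t w v

  act-reverseʳ : ∀ w v → act t w (act t (reverse w) v) ≗ᵥ v
  act-reverseʳ w v k = trans (cong (λ u → act t u (act t (reverse w) v) k) (sym (reverse-involutive w)))
                             (act-reverseˡ (reverse w) v k)

  -- The invariant form

  form : Vect → Vect → ℤ
  form x y = ∑ (λ i → ∑ (λ j → e i j * (x i * y j)))

  form-row : ∀ x y → form x y ≡ ∑ (λ i → ℓ i * x i * row i y)
  form-row x y = ∑-cong (λ i → trans (∑-cong (λ j → eq (ℓ i) (c i j) (x i) (y j)))
                                     (∑-* (ℓ i * x i) (λ j → c i j * y j)))
    where
    eq : ∀ l c x y → l * c * (x * y) ≡ l * x * (c * y)
    eq = solve-∀

  form-sym : ∀ x y → form x y ≡ form y x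
  form-sym x y = trans (∑-swap (λ i j → e i j * (x i * y j)))
    (∑-cong (λ j → ∑-cong (λ i → cong₂ _*_ (len-cartan i j) (ℤₚ.*-comm (x i) (y j)))))

  form-cong : ∀ {x x′ y y′} → x ≗ᵥ x′ → y ≗ᵥ y′ → form x y ≡ form x′ y′
  form-cong p q = ∑-cong (λ i → ∑-cong (λ j → cong₂ (λ a b → e i j * (a * b)) (p i) (q j)))

  form-combʳ : ∀ x y a z → form x (y -[ a ] z) ≡ form x y - a * form x z
  form-combʳ x y a z = begin
    form x (y -[ a ] z)  ≡⟨ form-row x (y -[ a ] z) ⟩
    ∑ (λ i → ℓ i * x i * row i (y -[ a ] z))
      ≡⟨ ∑-cong (λ i → trans (cong (λ p → ℓ i * x i * p) (row-comb i y a z))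
                             (eq (ℓ i * x i) (row i y) a (row i z))) ⟩
    ∑ (λ i → ℓ i * x i * row i y - a * (ℓ i * x i * row i z))
      ≡⟨ ∑-comb (λ i → ℓ i * x i * row i y) (λ i → ℓ i * x i * row i z) a ⟩
    ∑ (λ i → ℓ i * x i * row i y) - a * ∑ (λ i → ℓ i * x i * row i z)
      ≡⟨ cong₂ (λ p q → p - a * q) (form-row x y) (form-row x z) ⟨
    form x y - a * form x z ∎
    where
    open ≡-Reasoning
    eq : ∀ l y a z → l * (y - a * z) ≡ l * y - a * (l * z)
    eq = solve-∀

  form-combˡ : ∀ x a y z → form (x -[ a ] y) z ≡ form x z - a * form y z
  form-combˡ x a y z = trans (form-sym _ z) (trans (form-combʳ z x a y)
    (cong₂ (λ p q → p - a * q) (form-sym z x) (form-sym z y)))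

  form-α : ∀ i y → form (α i) y ≡ ℓ i * row i y
  form-α i y = trans (form-row (α i) y)
    (trans (∑-cong (λ k → eq (ℓ k) (δ i k) (row k y))) (∑-δ (λ k → ℓ k * row k y) i))
    where
    eq : ∀ l d p → l * d * p ≡ l * p * d
    eq = solve-∀

  form-αα : ∀ i → form (α i) (α i) ≡ + 2 * ℓ i
  form-αα i = trans (form-α i (α i)) (trans (cong (λ z → ℓ i * z) (trans (row-α i i) (cartan-diag t i)))
                                            (ℤₚ.*-comm (ℓ i) (+ 2)))

  reflect-form : ∀ i x y → form (reflect t i x) (reflect t i y) ≡ form x y
  reflect-form i x y = begin
    form (reflect t i x) (reflect t i y)     ≡⟨ form-cong (reflect-comb i x) (reflect-comb i y) ⟩
    form (x -[ a ] α i) (y -[ b ] α i)       ≡⟨ form-combˡ x a (α i) (y -[ b ] α i) ⟩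
    form x (y -[ b ] α i) - a * form (α i) (y -[ b ] α i)
      ≡⟨ cong₂ (λ p q → p - a * q) (form-combʳ x y b (α i)) (form-combʳ (α i) y b (α i)) ⟩
    (form x y - b * form x (α i)) - a * (form (α i) y - b * form (α i) (α i))
      ≡⟨ cong₂ (λ p q → (form x y - b * p) - a * q)
           (trans (form-sym x (α i)) (form-α i x))
           (cong₂ (λ p q → p - b * q) (form-α i y) (form-αα i)) ⟩
    (form x y - b * (ℓ i * a)) - a * (ℓ i * b - b * (+ 2 * ℓ i))
      ≡⟨ eq (form x y) a b (ℓ i) ⟩
    form x y ∎
    where
    open ≡-Reasoning
    a = row i x
    b = row i y
    eq : ∀ f a b l → (f - b * (l * a)) - a * (l * b - b * (+ 2 * l)) ≡ f
    eq = solve-∀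

  act-form : ∀ w x y → form (act t w x) (act t w y) ≡ form x y
  act-form []      x y = refl
  act-form (i ∷ w) x y = trans (reflect-form i (act t w x) (act t w y)) (act-form w x y)

  -- Writing L x i = dom i * y i, the form of L x is bounded below by ∑ y i * y i:
  -- 2 (L x i) (L x j) = dom i dom j (y i² + y j² - (y i - y j)²), and e i j ≤ 0 off the diagonal.
  module Definite (x : Vect) where
    private
      multiple = common-multiple dom dom-pos
      L = proj₁ multiple
      1≤L = proj₁ (proj₂ multiple)
      m = proj₁ (proj₂ (proj₂ multiple))
      1≤m = proj₁ (proj₂ (proj₂ (proj₂ multiple)))
      dom*m = proj₂ (proj₂ (proj₂ (proj₂ multiple)))

      y : Vect
      y k = m k * x k

      Lx : ∀ k → L * x k ≡ dom k * y k
      Lx k = trans (cong (λ z → z * x k) (sym (dom*m k))) (ℤₚ.*-assoc (dom k) (m k) (x k))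

      -- The part of the expansion that contains y i². Summed over j it collapses to ℓ i * dom i *
      -- row i dom * y i², whose coefficient is at least 1 because `dom` is positive and strictly
      -- dominant.
      T′ : Fin r → Fin r → ℤ
      T′ i j = e i j * ((dom i * (y i * y i)) * dom j)

      0≤dom : ∀ k → + 0 ≤ dom k
      0≤dom k = ℤₚ.≤-trans (ℤ.+≤+ ℕ.z≤n) (dom-pos k)

      ∑T-bound : ∑ (λ i → y i * y i) ≤ ∑ (λ i → ∑ (T′ i))
      ∑T-bound = subst (∑ (λ i → y i * y i) ≤_) (sym (form-row (λ i → dom i * (y i * y i)) dom))
        (∑-mono (λ i → ≤-by
          (*-nonneg (square-nonneg (y i)) (ℤₚ.i≤j⇒0≤j-i (1≤abc (ℓ-pos i) (dom-pos i) (dom-row i))))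
          (eq (y i * y i) (ℓ i) (dom i) (row i dom))))
        where
        eq : ∀ s l d p → l * (d * s) * p - s ≡ s * (l * d * p - + 1)
        eq = solve-∀
        1≤* : ∀ {a b} → + 1 ≤ a → + 1 ≤ b → + 1 ≤ a * b
        1≤* {a} {b} p q = ≤-by
          (ℤₚ.+-mono-≤ (*-nonneg (ℤₚ.i≤j⇒0≤j-i p) (ℤₚ.≤-trans (ℤ.+≤+ ℕ.z≤n) q)) (ℤₚ.i≤j⇒0≤j-i q)) (eq′ a b)
          where
          eq′ : ∀ a b → a * b - + 1 ≡ (a - + 1) * b + (b - + 1)
          eq′ = solve-∀
        1≤abc : ∀ {a b c} → + 1 ≤ a → + 1 ≤ b → + 1 ≤ c → + 1 ≤ a * b * c
        1≤abc p q s = 1≤* (1≤* p q) s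

      termwise : ∀ i j → T′ i j + T′ j i ≤ + 2 * (L * L) * (e i j * (x i * x j))
      termwise i j = ≤-by nonneg (trans rewriteL (eq (e i j) (dom i) (dom j) (y i) (y j)))
        where
        rewriteL : + 2 * (L * L) * (e i j * (x i * x j)) - (T′ i j + T′ j i) ≡
                   + 2 * (e i j * ((dom i * y i) * (dom j * y j))) -
                   (T′ i j + e i j * ((dom j * (y j * y j)) * dom i))
        rewriteL = cong₂ (λ p q → p - (T′ i j + q * ((dom j * (y j * y j)) * dom i)))
          (trans (eq₁ L (e i j) (x i) (x j)) (cong₂ (λ p q → + 2 * (e i j * (p * q))) (Lx i) (Lx j)))
          (len-cartan j i)
          where
          eq₁ : ∀ L e x x′ → + 2 * (L * L) * (e * (x * x′)) ≡ + 2 * (e * ((L * x) * (L * x′)))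
          eq₁ = solve-∀
        eq : ∀ e d d′ y y′ → + 2 * (e * ((d * y) * (d′ * y′))) -
               (e * ((d * (y * y)) * d′) + e * ((d′ * (y′ * y′)) * d)) ≡
             (- e) * ((d * d′) * ((y - y′) * (y - y′)))
        eq = solve-∀
        nonneg : + 0 ≤ (- e i j) * ((dom i * dom j) * ((y i - y j) * (y i - y j)))
        nonneg with i ≟ j
        ... | yes refl = ℤₚ.≤-reflexive (sym (eq₀ (- e i i) (dom i * dom i) (y i)))
          where
          eq₀ : ∀ p q y → p * (q * ((y - y) * (y - y))) ≡ + 0
          eq₀ = solve-∀
        ... | no i≢j = *-nonneg
          (ℤₚ.neg-mono-≤ (subst (_≤ + 0) (ℤₚ.*-comm (c i j) (ℓ i))
             (*-nonpos (cartan-off t i≢j) (ℤ.+≤+ ℕ.z≤n))))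
          (*-nonneg (*-nonneg (0≤dom i) (0≤dom j)) (square-nonneg (y i - y j)))

      doubled : + 2 * ∑ (λ i → ∑ (T′ i)) ≤ + 2 * (L * L * form x x)
      doubled = subst₂ _≤_ left right (∑-mono (λ i → ∑-mono (termwise i)))
        where
        open ≡-Reasoning
        two : ∀ a → a + a ≡ + 2 * a
        two = solve-∀
        left : ∑ (λ i → ∑ (λ j → T′ i j + T′ j i)) ≡ + 2 * ∑ (λ i → ∑ (T′ i))
        left = begin
          ∑ (λ i → ∑ (λ j → T′ i j + T′ j i))
            ≡⟨ ∑-cong (λ i → ∑-+ (T′ i) (λ j → T′ j i)) ⟩
          ∑ (λ i → ∑ (T′ i) + ∑ (λ j → T′ j i))
            ≡⟨ ∑-+ (λ i → ∑ (T′ i)) (λ i → ∑ (λ j → T′ j i)) ⟩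
          ∑ (λ i → ∑ (T′ i)) + ∑ (λ i → ∑ (λ j → T′ j i))
            ≡⟨ cong (λ z → ∑ (λ i → ∑ (T′ i)) + z) (sym (∑-swap T′)) ⟩
          ∑ (λ i → ∑ (T′ i)) + ∑ (λ i → ∑ (T′ i))
            ≡⟨ two _ ⟩
          + 2 * ∑ (λ i → ∑ (T′ i)) ∎
        right : ∑ (λ i → ∑ (λ j → + 2 * (L * L) * (e i j * (x i * x j)))) ≡ + 2 * (L * L * form x x)
        right = begin
          ∑ (λ i → ∑ (λ j → + 2 * (L * L) * (e i j * (x i * x j))))
            ≡⟨ ∑-cong (λ i → ∑-* (+ 2 * (L * L)) (λ j → e i j * (x i * x j))) ⟩
          ∑ (λ i → + 2 * (L * L) * ∑ (λ j → e i j * (x i * x j)))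
            ≡⟨ ∑-* (+ 2 * (L * L)) (λ i → ∑ (λ j → e i j * (x i * x j))) ⟩
          + 2 * (L * L) * form x x
            ≡⟨ ℤₚ.*-assoc (+ 2) (L * L) (form x x) ⟩
          + 2 * (L * L * form x x) ∎

      bound : ∑ (λ i → y i * y i) ≤ L * L * form x x
      bound = ℤₚ.≤-trans ∑T-bound (ℤₚ.*-cancelˡ-≤-pos _ _ (+ 2) doubled)

      0≤L : + 0 ≤ L
      0≤L = ℤₚ.≤-trans (ℤ.+≤+ ℕ.z≤n) 1≤L

    form-nonneg : + 0 ≤ form x x
    form-nonneg = nonneg (form x x) (ℤₚ.≤-trans (∑-nonneg (λ i → square-nonneg (y i))) bound)
      where
      nonneg : ∀ f → + 0 ≤ L * L * f → + 0 ≤ f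
      nonneg f p with ℤₚ.≤-total (+ 0) f
      ... | inj₁ q = q
      ... | inj₂ q = ℤₚ.≤-trans p (≤-by (*-nonneg (*-nonneg′ 1≤L) (ℤₚ.neg-mono-≤ q)) (eq L f))
        where
        eq : ∀ L f → f - L * L * f ≡ (L * L - + 1) * (- f)
        eq = solve-∀
        *-nonneg′ : + 1 ≤ L → + 0 ≤ L * L - + 1
        *-nonneg′ 1≤L = subst (+ 0 ≤_) (eq₂ L)
          (*-nonneg (ℤₚ.i≤j⇒0≤j-i 1≤L) (ℤₚ.+-mono-≤ {+ 0} {L} {+ 0} {+ 1} 0≤L (ℤ.+≤+ ℕ.z≤n)))
          where
          eq₂ : ∀ L → (L - + 1) * (L + + 1) ≡ L * L - + 1
          eq₂ = solve-∀

    form≤0⇒≡0 : form x x ≤ + 0 → ∀ k → x k ≡ + 0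
    form≤0⇒≡0 f≤0 k = cancel (square≤0⇒≡0 (y k)
      (ℤₚ.≤-trans (term≤∑ (λ i → square-nonneg (y i)) k)
        (ℤₚ.≤-trans bound (subst (_≤ + 0) (ℤₚ.*-comm (form x x) (L * L)) (*-nonpos f≤0 (*-nonneg 0≤L 0≤L))))))
      where
      cancel : m k * x k ≡ + 0 → x k ≡ + 0
      cancel eq with ℤₚ.i*j≡0⇒i≡0∨j≡0 (m k) eq
      ... | inj₂ p = p
      ... | inj₁ p with subst (+ 1 ≤_) p (1≤m k)
      ...   | ℤ.+≤+ ()

  open Definite public

  -- Diagonal terms 2 ℓ i x i² carry the factor 2 themselves, and off-diagonal terms occur twice.
  -- For d = ℓ j the divisor is the norm of α j, which makes the norms of the two parts of a root
  -- multiples of the norm of that root.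
  form-even : ∀ d x → (∀ i → d ∣ ℓ i * x i) → + 2 * d ∣ form x x
  form-even d x d∣ = ∑∑-even (λ i j → e i j * (x i * x j))
    (λ i j → cong₂ _*_ (len-cartan i j) (ℤₚ.*-comm (x i) (x j)))
    (λ i → diag i (d∣ i))
    (λ i j → subst (d ∣_) (eq (ℓ i) (c i j) (x i) (x j)) (∣m⇒∣m*n (c i j * x j) (d∣ i)))
    where
    eq : ∀ l c x y → (l * x) * (c * y) ≡ l * c * (x * y)
    eq = solve-∀
    eq₂ : ∀ l x q d → l * + 2 * (x * x) ≡ + 2 * (l * x) * x
    eq₂ = solve-∀
    eq₃ : ∀ q d x → + 2 * (q * d) * x ≡ (q * x) * (+ 2 * d)
    eq₃ = solve-∀
    diag : ∀ i → d ∣ ℓ i * x i → + 2 * d ∣ e i i * (x i * x i)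
    diag i (divides q p) = divides (q * x i)
      (trans (cong (λ z → ℓ i * z * (x i * x i)) (cartan-diag t i))
        (trans (eq₂ (ℓ i) (x i) q d)
          (trans (cong (λ z → + 2 * z * x i) p) (eq₃ q d (x i)))))

  -- The coroot of β = w α j has coordinates ℓ i β i / ℓ j, and this is their integrality. In the
  -- induction only coordinate k changes, and `len-cartan` moves the length factor from k to m.
  root-∣ : ∀ w j i → ℓ j ∣ ℓ i * act t w (α j) i
  root-∣ [] j i with j ≟ i
  ... | yes refl = divides (+ 1) (trans (cong (λ z → ℓ j * z) (δ-diag j)) (ℤₚ.*-comm (ℓ j) (+ 1)))
  ... | no  j≢i  = divides (+ 0) (trans (cong (λ z → ℓ i * z) (δ-off j≢i)) (ℤₚ.*-zeroʳ (ℓ i)))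
  root-∣ (k ∷ w) j i with k ≟ i
  ... | no k≢i = subst (ℓ j ∣_) (cong (λ z → ℓ i * z) (sym unchanged)) (root-∣ w j i)
    where
    v = act t w (α j)
    lemma : ∀ x a → x - a * + 0 ≡ x
    lemma = solve-∀
    unchanged : reflect t k v i ≡ v i
    unchanged = trans (reflect-comb k v i) (trans (cong (λ z → v i - row k v * z) (δ-off k≢i)) (lemma (v i) (row k v)))
  ... | yes refl = subst (ℓ j ∣_) (sym changed)
      (∣m∣n⇒∣m-n (root-∣ w j k) (∑-∣ (λ m → subst (ℓ j ∣_) (move m) (∣n⇒∣m*n (c m k) (root-∣ w j m)))))
    where
    v = act t w (α j)
    lemma : ∀ l x a → l * (x - a * + 1) ≡ l * x - l * a
    lemma = solve-∀
    comm : ∀ a b c → a * (b * c) ≡ b * a * c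
    comm = solve-∀
    move : ∀ m → c m k * (ℓ m * v m) ≡ ℓ k * (c k m * v m)
    move m = trans (comm (c m k) (ℓ m) (v m))
      (trans (cong (λ z → z * v m) (len-cartan m k)) (ℤₚ.*-assoc (ℓ k) (c k m) (v m)))
    changed : ℓ k * reflect t k v k ≡ ℓ k * v k - ∑ (λ m → ℓ k * (c k m * v m))
    changed = trans (cong (λ z → ℓ k * z) (trans (reflect-comb k v k) (cong (λ z → v k - row k v * z) (δ-diag k))))
      (trans (lemma (ℓ k) (v k) (row k v)) (cong (λ z → ℓ k * v k - z) (sym (∑-* (ℓ k) (λ m → c k m * v m)))))

  -- The positive and the negative part of a root are not acute, and each is zero or at least
  -- as long as the root, because its norm is a multiple of the norm of the root.
  root-sign : ∀ w j → NonNeg (act t w (α j)) ⊎ NonPos (act t w (α j))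
  root-sign w j = decide
    (∣-nonneg 0≤2ℓ (form-even (ℓ j) p (λ i → ∣*posPart (ℓ i) (v i) (root-∣ w j i))) (form-nonneg p))
    (∣-nonneg 0≤2ℓ (form-even (ℓ j) q (λ i → ∣*negPart (ℓ i) (v i) (root-∣ w j i))) (form-nonneg q))
    where
    v p q : Vect
    v = act t w (α j)
    p k = posPart (v k)
    q k = negPart (v k)
    0≤2ℓ : + 0 ≤ + 2 * ℓ j
    0≤2ℓ = *-nonneg {+ 2} {ℓ j} (ℤ.+≤+ ℕ.z≤n) (ℤ.+≤+ ℕ.z≤n)
    obtuse : form p q ≤ + 0
    obtuse = ∑-nonpos (λ i → ∑-nonpos (λ k → term i k))
      where
      term : ∀ i k → e i k * (p i * q k) ≤ + 0
      term i k with i ≟ k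
      ... | yes refl = ℤₚ.≤-reflexive (trans (cong (λ z → e i i * z) (posPart*negPart (v i))) (ℤₚ.*-zeroʳ (e i i)))
      ... | no i≢k = *-nonpos (subst (_≤ + 0) (ℤₚ.*-comm (c i k) (ℓ i)) (*-nonpos (cartan-off t i≢k) (ℤ.+≤+ ℕ.z≤n)))
                              (*-nonneg (posPart-nonneg (v i)) (negPart-nonneg (v k)))
    norm : form p p + form q q - + 2 * form p q ≡ + 2 * ℓ j
    norm = begin
      form p p + form q q - + 2 * form p q ≡⟨ lemma (form p p) (form p q) (form q q) ⟩
      (form p p - + 1 * form p q) - + 1 * (form p q - + 1 * form q q)
        ≡⟨ cong₂ (λ a b → a - + 1 * b) (form-combʳ p p (+ 1) q)
             (trans (form-combʳ q p (+ 1) q) (cong (λ z → z - + 1 * form q q) (form-sym q p))) ⟨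
      form p (p -[ + 1 ] q) - + 1 * form q (p -[ + 1 ] q) ≡⟨ form-combˡ p (+ 1) q (p -[ + 1 ] q) ⟨
      form (p -[ + 1 ] q) (p -[ + 1 ] q) ≡⟨ form-cong split split ⟨
      form v v ≡⟨ act-form w (α j) (α j) ⟩
      form (α j) (α j) ≡⟨ form-αα j ⟩
      + 2 * ℓ j ∎
      where
      open ≡-Reasoning
      lemma : ∀ a b d → a + d - + 2 * b ≡ (a - + 1 * b) - + 1 * (b - + 1 * d)
      lemma = solve-∀
      split : v ≗ᵥ (p -[ + 1 ] q)
      split k = trans (posPart-negPart (v k)) (cong (λ z → p k - z) (sym (ℤₚ.*-identityˡ (q k))))
    -- As (p, q) ≤ 0, two such parts would give 4 ℓ j ≤ |p|² + |q|² - 2 (p, q) = 2 ℓ j.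
    too-long : + 2 * ℓ j ≤ form p p → + 2 * ℓ j ≤ form q q → ⊥
    too-long a b = ℤₚ.<⇒≱ (ℤ.+<+ (ℕ.s≤s ℕ.z≤n)) (ℤₚ.≤-trans (ℓ-pos j) (ℤₚ.*-cancelˡ-≤-pos _ _ (+ 2) 2ℓ≤0))
      where
      lemma : ∀ l a b d → + 2 * + 0 - + 2 * l ≡ (a - + 2 * l) + (b - + 2 * l) + + 2 * (- d) + (+ 2 * l - (a + b - + 2 * d))
      lemma = solve-∀
      2ℓ≤0 : + 2 * ℓ j ≤ + 2 * + 0
      2ℓ≤0 = ≤-by (ℤₚ.+-mono-≤ (ℤₚ.+-mono-≤ (ℤₚ.i≤j⇒0≤j-i a) (ℤₚ.i≤j⇒0≤j-i b))
                     (*-nonneg {+ 2} (ℤ.+≤+ ℕ.z≤n) (ℤₚ.neg-mono-≤ obtuse)))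
        (trans (lemma (ℓ j) (form p p) (form q q) (form p q))
          (trans (cong (λ z → base + (+ 2 * ℓ j - z)) norm) (cancel base (+ 2 * ℓ j))))
        where
        base = (form p p - + 2 * ℓ j) + (form q q - + 2 * ℓ j) + + 2 * (- form p q)
        cancel : ∀ a b → a + (b - b) ≡ a
        cancel = solve-∀

    decide : form p p ≤ + 0 ⊎ + 2 * ℓ j ≤ form p p → form q q ≤ + 0 ⊎ + 2 * ℓ j ≤ form q q →
             NonNeg v ⊎ NonPos v
    decide (inj₁ p≤0) _          = inj₂ (λ k → posPart≡0⇒≤0 (v k) (form≤0⇒≡0 p p≤0 k))
    decide (inj₂ _)   (inj₁ q≤0) = inj₁ (λ k → negPart≡0⇒0≤ (v k) (form≤0⇒≡0 q q≤0 k))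
    decide (inj₂ ℓ≤p) (inj₂ ℓ≤q) = ⊥-elim (too-long ℓ≤p ℓ≤q)

  -- Applying the inverse of w gives α j = a · w⁻¹ α i, and coordinate j exhibits a as a divisor of
  -- 1.
  root-primitive : ∀ w i j a → act t w (α j) ≗ᵥ (λ k → a * α i k) → ℤ.∣ a ∣ ≡ 1
  root-primitive w i j a eq = unit-∣∣ a (act t (reverse w) (α i) j) (begin
    a * act t (reverse w) (α i) j
      ≡⟨ lemma a (act t (reverse w) (α i) j) ⟩
    + 0 - (- a) * act t (reverse w) (α i) j
      ≡⟨ cong (λ z → z - (- a) * act t (reverse w) (α i) j) (act-zero (reverse w) {λ _ → + 0} (λ _ → refl) j) ⟨
    act t (reverse w) (λ _ → + 0) j - (- a) * act t (reverse w) (α i) j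
      ≡⟨ act-comb (reverse w) (λ _ → + 0) (- a) (α i) j ⟨
    act t (reverse w) ((λ _ → + 0) -[ - a ] α i) j
      ≡⟨ act-cong (reverse w) (λ k → trans (eq k) (lemma a (α i k))) j ⟨
    act t (reverse w) (act t w (α j)) j
      ≡⟨ act-reverseˡ w (α j) j ⟩
    δ j j ≡⟨ δ-diag j ⟩
    + 1 ∎)
    where
    open ≡-Reasoning
    lemma : ∀ a x → a * x ≡ + 0 - (- a) * x
    lemma = solve-∀

  root≢0 : ∀ w j → ¬ (∀ k → act t w (α j) k ≡ + 0)
  root≢0 w j eq with root-primitive w j j (+ 0) (λ k → trans (eq k) (sym (ℤₚ.*-zeroˡ (α j k))))
  ... | ()

  root-¬NonNeg×NonPos : ∀ w j → NonNeg (act t w (α j)) → ¬ NonPos (act t w (α j))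
  root-¬NonNeg×NonPos w j p q = root≢0 w j (λ k → ℤₚ.≤-antisym (q k) (p k))

  -- Words and elements

  Letters = List (Fin r)

  infix 4 _≈_
  record _≈_ (w u : Letters) : Set where
    constructor same
    field same-act : ∀ v → act t w v ≗ᵥ act t u v
  open _≈_ public

  SameElt⇒≈ : ∀ {w u} → SameElt t w u → w ≈ u
  SameElt⇒≈ {w} {u} s = same λ v k → trans (act-expand w v k)
    (trans (∑-cong (λ j → cong (λ z → v j * z) (s j k))) (sym (act-expand u v k)))

  ≈⇒SameElt : ∀ {w u} → w ≈ u → SameElt t w u
  ≈⇒SameElt w≈u j = same-act w≈u (α j)

  ≈-refl : ∀ {w} → w ≈ w
  ≈-refl = same λ v k → refl

  ≈-sym : ∀ {w u} → w ≈ u → u ≈ w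
  ≈-sym p = same λ v k → sym (same-act p v k)

  ≈-trans : ∀ {w u x} → w ≈ u → u ≈ x → w ≈ x
  ≈-trans p q = same λ v k → trans (same-act p v k) (same-act q v k)

  ++-≈ : ∀ {w w′ u u′} → w ≈ w′ → u ≈ u′ → w ++ u ≈ w′ ++ u′
  ++-≈ {w} {w′} {u} {u′} p q = same λ v k → begin
    act t (w ++ u) v k         ≡⟨ cong (λ f → f k) (act-++ w u v) ⟩
    act t w (act t u v) k      ≡⟨ act-cong w (same-act q v) k ⟩
    act t w (act t u′ v) k     ≡⟨ same-act p (act t u′ v) k ⟩
    act t w′ (act t u′ v) k    ≡⟨ cong (λ f → f k) (act-++ w′ u′ v) ⟨
    act t (w′ ++ u′) v k       ∎
    where open ≡-Reasoning

  ∷-≈ : ∀ i {w u} → w ≈ u → i ∷ w ≈ i ∷ u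
  ∷-≈ i = ++-≈ (≈-refl {i ∷ []})

  cancel-pair : ∀ i w → i ∷ i ∷ w ≈ w
  cancel-pair i w = same λ v → reflect-involutive i (act t w v)

  -- The rule w s w⁻¹ = s′ for the reflections in α j and w α j: by invariance of the form, v pairs
  -- with the coroot of α j as w v does with that of w α j. The equality of lengths converts values
  -- of the form into pairings.
  conjugate : ∀ w i j → act t w (α j) ≗ᵥ α i → w ∷ʳ j ≈ i ∷ w
  conjugate w i j wα = same λ v k → begin
    act t (w ∷ʳ j) v k               ≡⟨ cong (λ f → f k) (act-++ w (j ∷ []) v) ⟩
    act t w (reflect t j v) k        ≡⟨ act-cong w (reflect-comb j v) k ⟩
    act t w (v -[ row j v ] α j) k   ≡⟨ act-comb w v (row j v) (α j) k ⟩
    act t w v k - row j v * act t w (α j) k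
      ≡⟨ cong₂ (λ a b → act t w v k - a * b) (same-row v) (wα k) ⟩
    act t w v k - row i (act t w v) * α i k  ≡⟨ reflect-comb i (act t w v) k ⟨
    reflect t i (act t w v) k        ∎
    where
    open ≡-Reasoning
    same-len : ℓ j ≡ ℓ i
    same-len = ℤₚ.*-cancelˡ-≡ (+ 2) (ℓ j) (ℓ i) (begin
      + 2 * ℓ j                                    ≡⟨ form-αα j ⟨
      form (α j) (α j)                             ≡⟨ act-form w (α j) (α j) ⟨
      form (act t w (α j)) (act t w (α j))         ≡⟨ form-cong wα wα ⟩
      form (α i) (α i)                             ≡⟨ form-αα i ⟩
      + 2 * ℓ i                                    ∎)
    same-row : ∀ v → row j v ≡ row i (act t w v)
    same-row v = ℤₚ.*-cancelˡ-≡ (ℓ j) (row j v) (row i (act t w v)) (begin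
      ℓ j * row j v                                ≡⟨ form-α j v ⟨
      form (α j) v                                 ≡⟨ act-form w (α j) v ⟨
      form (act t w (α j)) (act t w v)             ≡⟨ form-cong wα (λ _ → refl) ⟩
      form (α i) (act t w v)                       ≡⟨ form-α i (act t w v) ⟩
      ℓ i * row i (act t w v)                      ≡⟨ cong (λ z → z * row i (act t w v)) same-len ⟨
      ℓ j * row i (act t w v)                      ∎)

  α-nonneg : ∀ j → NonNeg (α j)
  α-nonneg j k with toℕ j ℕ.≡ᵇ toℕ k
  ... | true  = ℤ.+≤+ ℕ.z≤n
  ... | false = ℤ.+≤+ ℕ.z≤n

  multiple-of-α : ∀ x i → (∀ k → i ≢ k → x k ≡ + 0) → x ≗ᵥ (λ k → x i * α i k)
  multiple-of-α x i off k = by-cases (i ≟ k)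
    where
    by-cases : Dec (i ≡ k) → x k ≡ x i * α i k
    by-cases (yes refl) = sym (trans (cong (λ z → x i * z) (δ-diag i)) (ℤₚ.*-identityʳ (x i)))
    by-cases (no  i≢k)  = trans (off k i≢k) (sym (trans (cong (λ z → x i * z) (δ-off i≢k)) (ℤₚ.*-zeroʳ (x i))))

  -- s_i changes only the i-th coordinate, so a positive root made negative by s_i is supported there.
  sign-change : ∀ w i j → NonNeg (act t w (α j)) → NonPos (act t (i ∷ w) (α j)) → act t w (α j) ≗ᵥ α i
  sign-change w i j pos neg k = trans (multiple k)
    (trans (cong (λ z → z * α i k) (0≤∧unit⇒≡1 (pos i) (root-primitive w i j (β i) multiple))) (ℤₚ.*-identityˡ (α i k)))
    where
    β : Vect
    β = act t w (α j)
    lemma : ∀ x a → x - a * + 0 ≡ x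
    lemma = solve-∀
    unchanged : ∀ k → i ≢ k → act t (i ∷ w) (α j) k ≡ β k
    unchanged k i≢k = trans (reflect-comb i β k)
      (trans (cong (λ z → β k - row i β * z) (δ-off i≢k)) (lemma (β k) (row i β)))
    multiple : β ≗ᵥ (λ k → β i * α i k)
    multiple = multiple-of-α β i
      (λ k i≢k → ℤₚ.≤-antisym (subst (_≤ + 0) (unchanged k i≢k) (neg k)) (pos k))

  -- Letters act from the right, and α j starts positive. At the letter i where the sign turns, the
  -- root is α i by `sign-change`; conjugation carries the reflection at j to the one at i, and the
  -- two cancel, which deletes the letter i.
  exchange : ∀ {I} w → Word t I w → ∀ j → NonPos (act t w (α j)) →
             ∃ λ w′ → Word t I w′ × w′ ≈ w ∷ʳ j × suc (length w′) ≡ length w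
  exchange [] _ j neg = ⊥-elim (root-¬NonNeg×NonPos [] j (α-nonneg j) neg)
  exchange {I} (i ∷ w) (i∈I ∷ w∈I) j neg = by-sign (root-sign w j)
    where
    by-sign : NonNeg (act t w (α j)) ⊎ NonPos (act t w (α j)) →
              ∃ λ w′ → Word t I w′ × w′ ≈ (i ∷ w) ∷ʳ j × suc (length w′) ≡ length (i ∷ w)
    by-sign (inj₁ pos) = w , w∈I ,
      ≈-sym (≈-trans (∷-≈ i (conjugate w i j (sign-change w i j pos neg))) (cancel-pair i w)) , refl
    by-sign (inj₂ neg′) =
      let w′ , w′∈I , w′≈ , len = exchange w w∈I j neg′
      in i ∷ w′ , i∈I ∷ w′∈I , ∷-≈ i w′≈ , cong suc len

-- Parabolic subgroups and their longest elements.

module Parabolic (t : CartanType) (fin : FiniteType t) (I : Subset (rank t)) where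
  open FiniteType fin
  open Weyl t fin

  SupportedOn : (Fin r → Set) → Vect → Set
  SupportedOn P v = ∀ k → ¬ P k → v k ≡ + 0

  -- A reflection at i subtracts a multiple of α i. If i is outside P, its coroot pairs to zero with
  -- vectors supported on P, so nothing is subtracted. Applied with P = I and with P the image of a
  -- component.
  act-supported : ∀ {P : Fin r → Set} → (∀ k → Dec (P k)) →
                  (∀ i → i ∈ I → ¬ P i → ∀ j → P j → c i j ≡ + 0) →
                  ∀ w → Word t I w → ∀ {v} → SupportedOn P v → SupportedOn P (act t w v)
  act-supported P? closed []      []          sup = sup
  act-supported {P} P? closed (i ∷ w) (i∈I ∷ w∈I) {v} sup k ¬Pk =
    trans (reflect-comb i x k) (trans (cong₂ (λ a b → a - b) (IH k ¬Pk) vanish) refl)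
    where
    x : Vect
    x = act t w v
    IH : SupportedOn P x
    IH = act-supported P? closed w w∈I sup
    term : ¬ P i → ∀ j → Dec (P j) → c i j * x j ≡ + 0
    term ¬Pi j (yes Pj) = trans (cong (λ z → z * x j) (closed i i∈I ¬Pi j Pj)) (ℤₚ.*-zeroˡ (x j))
    term ¬Pi j (no ¬Pj) = trans (cong (λ z → c i j * z) (IH j ¬Pj)) (ℤₚ.*-zeroʳ (c i j))
    by-cases : Dec (i ≡ k) → row i x * δ i k ≡ + 0
    by-cases (yes refl) = trans (cong (λ z → z * δ i i) (∑-zero (λ j → term ¬Pk j (P? j)))) (ℤₚ.*-zeroˡ (δ i i))
    by-cases (no i≢k)   = trans (cong (λ z → row i x * z) (δ-off i≢k)) (ℤₚ.*-zeroʳ (row i x))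
    vanish : row i x * δ i k ≡ + 0
    vanish = by-cases (i ≟ k)

  α-supported : ∀ {P : Fin r → Set} j → P j → SupportedOn P (α j)
  α-supported {P} j Pj k ¬Pk = δ-off (λ j≡k → ¬Pk (subst P j≡k Pj))

  root-supported : ∀ w → Word t I w → ∀ j → j ∈ I → SupportedOn (_∈ I) (act t w (α j))
  root-supported w w∈I j j∈I =
    act-supported (_∈? I) (λ i i∈I i∉I → contradiction i∈I i∉I) w w∈I (α-supported j j∈I)

  -- Longest elements described by their effect on roots; the description by word length is proved
  -- equivalent, and the opposition is studied in this form.
  record Maximal (w : Letters) : Set where
    field
      word : Word t I w
      down : ∀ j → j ∈ I → NonPos (act t w (α j))
  open Maximal

  reverse-word : ∀ {w} → Word t I w → Word t I (reverse w)
  reverse-word []          = []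
  reverse-word {i ∷ w} (i∈I ∷ w∈I) =
    subst (Word t I) (sym (unfold-reverse i w)) (Allₚ.++⁺ (reverse-word w∈I) (i∈I ∷ []))

  maximal-≈ : ∀ {w v} → Maximal w → Word t I v → v ≈ w → Maximal v
  maximal-≈ m v∈I v≈w = record
    { word = v∈I ; down = λ j j∈I k → subst (_≤ + 0) (sym (same-act v≈w (α j) k)) (down m j j∈I k) }

  maximal-flips : ∀ {v} → Maximal v → ∀ {x} → NonNeg x → SupportedOn (_∈ I) x → NonPos (act t v x)
  maximal-flips {v} m {x} pos sup k = subst (_≤ + 0) (sym (act-expand v x k)) (∑-nonpos term)
    where
    term : ∀ j → x j * act t v (α j) k ≤ + 0
    term j = by-cases (j ∈? I)
      where
      by-cases : Dec (j ∈ I) → x j * act t v (α j) k ≤ + 0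
      by-cases (yes j∈I) = subst (_≤ + 0) (ℤₚ.*-comm (act t v (α j) k) (x j)) (*-nonpos (down m j j∈I k) (pos j))
      by-cases (no  j∉I) = ℤₚ.≤-reflexive
        (trans (cong (λ z → z * act t v (α j) k) (sup j j∉I)) (ℤₚ.*-zeroˡ (act t v (α j) k)))

  -- In a maximal word every letter of u can be traded: lengthening a by one letter
  -- shortens b, and conversely.
  record Factorization (v u : Letters) : Set where
    field
      left right : Letters
      left-word  : Word t I left
      right-word : Word t I right
      left≈      : left ≈ u
      right≈     : right ≈ v ++ u
      lengths    : length left ℕ.+ length right ℕ.≤ length v
  open Factorization

  length-∷ʳ : ∀ (w : Letters) j → length (w ∷ʳ j) ≡ suc (length w)
  length-∷ʳ w j = trans (length-++ w) (ℕₚ.+-comm (length w) 1)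

  -- `right` represents v followed on the right by `left`, and v reverses the sign of every root
  -- supported on I. So exactly one of `left` and `right` makes α j negative: exchange shortens that
  -- one, the other takes the letter, and the total length is kept.
  factor-∷ʳ : ∀ {v u} → Maximal v → ∀ j → j ∈ I → Factorization v u → Factorization v (u ∷ʳ j)
  factor-∷ʳ {v} {u} m j j∈I F = by-sign (root-sign a j)
    where
    a = left F
    b = right F
    assoc : b ∷ʳ j ≈ v ++ (u ∷ʳ j)
    assoc = subst (b ∷ʳ j ≈_) (++-assoc v u (j ∷ [])) (++-≈ (right≈ F) ≈-refl)
    by-sign : NonNeg (act t a (α j)) ⊎ NonPos (act t a (α j)) → Factorization v (u ∷ʳ j)
    by-sign (inj₂ neg) =
      let a′ , a′∈I , a′≈ , len = exchange a (left-word F) j neg in record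
      { left = a′ ; right = b ∷ʳ j ; left-word = a′∈I ; right-word = Allₚ.++⁺ (right-word F) (j∈I ∷ [])
      ; left≈ = ≈-trans a′≈ (++-≈ (left≈ F) ≈-refl)
      ; right≈ = assoc
      ; lengths = subst (ℕ._≤ length v)
          (trans (cong (ℕ._+ length b) (sym len))
            (trans (sym (ℕₚ.+-suc (length a′) (length b))) (cong (length a′ ℕ.+_) (sym (length-∷ʳ b j)))))
          (lengths F) }
    by-sign (inj₁ pos) =
      let b′ , b′∈I , b′≈ , len = exchange b (right-word F) j b-neg in record
      { left = a ∷ʳ j ; right = b′ ; left-word = Allₚ.++⁺ (left-word F) (j∈I ∷ []) ; right-word = b′∈I
      ; left≈ = ++-≈ (left≈ F) ≈-refl
      ; right≈ = ≈-trans b′≈ assoc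
      ; lengths = subst (ℕ._≤ length v)
          (trans (cong (length a ℕ.+_) (sym len))
            (trans (ℕₚ.+-suc (length a) (length b′)) (cong (ℕ._+ length b′) (sym (length-∷ʳ a j)))))
          (lengths F) }
      where
      b-neg : NonPos (act t b (α j))
      b-neg k = subst (_≤ + 0)
        (sym (trans (same-act (right≈ F) (α j) k)
          (trans (sym (same-act (++-≈ (≈-refl {v}) (left≈ F)) (α j) k)) (cong (λ f → f k) (act-++ v a (α j))))))
        (maximal-flips m pos (root-supported a (left-word F) j j∈I) k)

  factor : ∀ {v} → Maximal v → ∀ u → Word t I u → Factorization v u
  -- Letters of u are appended on the right, so the recursion runs along the reversed word.
  factor {v} m u u∈I = subst (Factorization v) (reverse-involutive u) (go (reverse u) (reverse-word u∈I))
    where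
    go : ∀ l → Word t I l → Factorization v (reverse l)
    go []      []          = record
      { left = [] ; right = v ; left-word = [] ; right-word = word m ; left≈ = ≈-refl
      ; right≈ = subst (v ≈_) (sym (++-identityʳ v)) ≈-refl ; lengths = ℕₚ.≤-refl }
    go (j ∷ l) (j∈I ∷ l∈I) =
      subst (Factorization v) (sym (unfold-reverse j l)) (factor-∷ʳ m j j∈I (go l l∈I))

  -- Maximality depends on the element alone, so it passes to every word v for w; the `left` word
  -- then represents u and is no longer than v.
  maximal⇒longest : ∀ {w} → Maximal w → Longest t I w
  maximal⇒longest m = word m , λ v v∈I v~w u u∈I →
    let F = factor (maximal-≈ m v∈I (SameElt⇒≈ v~w)) u u∈I
    in left F , left-word F , ≈⇒SameElt (left≈ F) , ℕₚ.≤-trans (ℕₚ.m≤m+n _ _) (lengths F)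

  ¬NonNeg⇒NonPos : ∀ w j → ¬ NonNeg (act t w (α j)) → NonPos (act t w (α j))
  ¬NonNeg⇒NonPos w j ¬pos = [ (λ pos → contradiction pos ¬pos) , id ]′ (root-sign w j)

  -- Each letter w ∷ʳ j with act w (α j) positive lowers form (act w dom) dom by at least 1,
  -- and this quantity is bounded below because the form is nonnegative at act w dom + dom.
  potential : Letters → ℤ
  potential w = form (act t w dom) dom + form dom dom

  potential-nonneg : ∀ w → + 0 ≤ potential w
  potential-nonneg w = ℤₚ.*-cancelˡ-≤-pos (+ 0) (potential w) (+ 2)
    (subst (+ 0 ≤_) expand (form-nonneg (x -[ - + 1 ] dom)))
    where
    x : Vect
    x = act t w dom
    lemma : ∀ f g → (f - (- + 1) * g) - (- + 1) * (g - (- + 1) * f) ≡ + 2 * (g + f)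
    lemma = solve-∀
    expand : form (x -[ - + 1 ] dom) (x -[ - + 1 ] dom) ≡ + 2 * potential w
    expand = trans (form-combˡ x (- + 1) dom (x -[ - + 1 ] dom))
      (trans (cong₂ (λ p q → p - (- + 1) * q)
               (trans (form-combʳ x x (- + 1) dom) (cong (λ z → z - (- + 1) * form x dom) (act-form w dom dom)))
               (trans (form-combʳ dom x (- + 1) dom) (cong (λ z → z - (- + 1) * form dom dom) (form-sym dom x))))
             (lemma (form dom dom) (form x dom)))

  pos-root-dom : ∀ w j → NonNeg (act t w (α j)) → + 1 ≤ form (act t w (α j)) dom
  pos-root-dom w j pos = by-cases (ℤₚ.≤-total (+ 1) (form β dom))
    where
    β : Vect
    β = act t w (α j)
    0≤ℓ*row : ∀ i → + 1 ≤ ℓ i * row i dom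
    0≤ℓ*row i = ≤-by (ℤₚ.+-mono-≤ (*-nonneg (ℤₚ.i≤j⇒0≤j-i (ℓ-pos i)) (ℤₚ.≤-trans (ℤ.+≤+ ℕ.z≤n) (dom-row i)))
                       (ℤₚ.i≤j⇒0≤j-i (dom-row i))) (lemma (ℓ i) (row i dom))
      where
      lemma : ∀ a b → a * b - + 1 ≡ (a - + 1) * b + (b - + 1)
      lemma = solve-∀
    term : ∀ i → β i ≤ ℓ i * β i * row i dom
    term i = ≤-by (*-nonneg (pos i) (ℤₚ.i≤j⇒0≤j-i (0≤ℓ*row i))) (lemma (ℓ i) (β i) (row i dom))
      where
      lemma : ∀ l b p → l * b * p - b ≡ b * (l * p - + 1)
      lemma = solve-∀
    sum≤ : ∑ β ≤ form β dom
    sum≤ = subst (∑ β ≤_) (sym (form-row β dom)) (∑-mono term)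
    by-cases : + 1 ≤ form β dom ⊎ form β dom ≤ + 1 → + 1 ≤ form β dom
    by-cases (inj₁ p) = p
    by-cases (inj₂ _) = ℤₚ.i<j⇒suc[i]≤j (ℤₚ.≰⇒> λ f≤0 →
      root-¬NonNeg×NonPos w j pos (λ k → ℤₚ.≤-trans (term≤∑ pos k) (ℤₚ.≤-trans sum≤ f≤0)))

  potential-∷ʳ : ∀ w j → NonNeg (act t w (α j)) → potential (w ∷ʳ j) ℤ.< potential w
  potential-∷ʳ w j pos = ℤₚ.suc[i]≤j⇒i<j (≤-by
      (ℤₚ.+-mono-≤ (*-nonneg (ℤₚ.i≤j⇒0≤j-i (dom-row j)) (ℤₚ.≤-trans (ℤ.+≤+ ℕ.z≤n) (pos-root-dom w j pos)))
                   (ℤₚ.i≤j⇒0≤j-i (pos-root-dom w j pos)))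
      (trans (cong (λ z → potential w - (+ 1 + (z + form dom dom))) step)
             (lemma (form (act t w dom) dom) (form dom dom) (row j dom) (form (act t w (α j)) dom))))
    where
    lemma : ∀ f g a b → (f + g) - (+ 1 + ((f - a * b) + g)) ≡ (a - + 1) * b + (b - + 1)
    lemma = solve-∀
    step : form (act t (w ∷ʳ j) dom) dom ≡ form (act t w dom) dom - row j dom * form (act t w (α j)) dom
    step = trans (form-cong (λ k → trans (cong (λ f → f k) (act-++ w (j ∷ []) dom))
                                    (trans (act-cong w (reflect-comb j dom) k) (act-comb w dom (row j dom) (α j) k)))
                            (λ _ → refl))
                 (form-combˡ (act t w dom) (row j dom) (act t w (α j)) dom)

  maximal-exists : ∃ Maximal
  maximal-exists = grow ℤ.∣ potential [] ∣ [] [] (ℤₚ.≤-reflexive (sym (ℤₚ.0≤i⇒+∣i∣≡i (potential-nonneg []))))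
    where
    grow : ∀ fuel w → Word t I w → potential w ≤ + fuel → ∃ Maximal
    search : ∀ fuel w → Word t I w → potential w ≤ + fuel →
             Dec (∃ λ j → j ∈ I × NonNeg (act t w (α j))) → ∃ Maximal
    grow fuel w w∈I p≤ = search fuel w w∈I p≤
      (any? (λ j → (j ∈? I) ×-dec all? (λ k → + 0 ℤₚ.≤? act t w (α j) k)))
    search fuel w w∈I p≤ (no none) = w , record { word = w∈I ; down = down′ }
      where
      down′ : ∀ j → j ∈ I → NonPos (act t w (α j))
      down′ j j∈I = ¬NonNeg⇒NonPos w j (λ pos → none (j , j∈I , pos))
    search zero w w∈I p≤ (yes (j , j∈I , pos)) = contradiction
      (ℤₚ.≤-<-trans (potential-nonneg (w ∷ʳ j)) (ℤₚ.<-≤-trans (potential-∷ʳ w j pos) p≤)) (ℤₚ.<-irrefl refl)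
    search (suc fuel) w w∈I p≤ (yes (j , j∈I , pos)) =
      grow fuel (w ∷ʳ j) (Allₚ.++⁺ w∈I (j∈I ∷ []))
        (≤-by (ℤₚ.i≤j⇒0≤j-i (ℤₚ.i<j⇒suc[i]≤j (ℤₚ.<-≤-trans (potential-∷ʳ w j pos) p≤)))
              (lemma (potential (w ∷ʳ j)) (+ fuel)))
      where
      lemma : ∀ p f → f - p ≡ (+ 1 + f) - (+ 1 + p)
      lemma = solve-∀

  -- Let a be a word for w. The hypothesis supplies a word u for a maximal element with |u| ≤ |a|,
  -- and factoring gives `left` = w, `right` = u w and |left| + |right| ≤ |u|. If `right` is
  -- nonempty, `left` is a strictly shorter word for w and takes the place of a. If it is empty,
  -- then u w = 1; a positive w α j would be made negative by u, but u w α j = α j.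
  longest⇒maximal : ∀ {w} → Longest t I w → Maximal w
  longest⇒maximal {w} (w∈I , longest) = go (length w) w w∈I ≈-refl ℕₚ.≤-refl
    where
    w₀ = proj₁ maximal-exists
    m₀ = proj₂ maximal-exists
    go : ∀ fuel a → Word t I a → a ≈ w → length a ℕ.≤ fuel → Maximal w
    go fuel a a∈I a≈w len = by-length fuel (right F) refl len
      where
      shorter-word = longest a a∈I (≈⇒SameElt a≈w) w₀ (word m₀)
      u = proj₁ shorter-word
      u∈I = proj₁ (proj₂ shorter-word)
      u~w₀ = proj₁ (proj₂ (proj₂ shorter-word))
      u≤a = proj₂ (proj₂ (proj₂ shorter-word))
      m : Maximal u
      m = maximal-≈ m₀ u∈I (SameElt⇒≈ u~w₀)
      F : Factorization u w
      F = factor m w w∈I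
      inverse : right F ≡ [] → Maximal w
      inverse b≡[] = record { word = w∈I ; down = down′ }
        where
        u∘w : ∀ v → act t u (act t w v) ≗ᵥ v
        u∘w v k = trans (sym (cong (λ f → f k) (act-++ u w v)))
          (trans (sym (same-act (right≈ F) v k)) (cong (λ b → act t b v k) b≡[]))
        down′ : ∀ j → j ∈ I → NonPos (act t w (α j))
        down′ j j∈I = ¬NonNeg⇒NonPos w j λ pos → root-¬NonNeg×NonPos [] j (α-nonneg j)
          (λ k → subst (_≤ + 0) (u∘w (α j) k) (maximal-flips m pos (root-supported w w∈I j j∈I) k))
      shorter : ∀ {x b} → right F ≡ x ∷ b → suc (length (left F) ℕ.+ length b) ℕ.≤ length u
      shorter {x} {b} e = subst (ℕ._≤ length u)
        (trans (cong (λ z → length (left F) ℕ.+ length z) e) (ℕₚ.+-suc (length (left F)) (length b))) (lengths F)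
      by-length : ∀ fuel b → right F ≡ b → length a ℕ.≤ fuel → Maximal w
      by-length _          []      e _   = inverse e
      by-length zero       (x ∷ b) e len = contradiction (ℕₚ.≤-trans (shorter e) (ℕₚ.≤-trans u≤a len)) λ ()
      by-length (suc fuel) (x ∷ b) e len = go fuel (left F) (left-word F) (left≈ F)
        (ℕₚ.≤-trans (ℕₚ.m≤m+n (length (left F)) (length b)) (ℕ.s≤s⁻¹ (ℕₚ.≤-trans (shorter e) (ℕₚ.≤-trans u≤a len))))

  maximal-reverse : ∀ {w} → Maximal w → Maximal (reverse w)
  maximal-reverse {w} m = record { word = reverse-word (word m) ; down = down′ }
    where
    down′ : ∀ j → j ∈ I → NonPos (act t (reverse w) (α j))
    down′ j j∈I = ¬NonNeg⇒NonPos (reverse w) j λ pos → root-¬NonNeg×NonPos [] j (α-nonneg j)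
      (λ k → subst (_≤ + 0) (act-reverseʳ w (α j) k)
        (maximal-flips m pos (root-supported (reverse w) (reverse-word (word m)) j j∈I) k))

  -- α i is a nonnegative combination of the positive roots - w⁻¹ (α k), so each of those that
  -- occurs is a multiple of α i.
  opposition : ∀ {w} → Maximal w → ∀ i → i ∈ I → ∃ λ k → k ∈ I × (∀ m → act t w (α i) m ≡ - α k m)
  opposition {w} M i i∈I = found (any? (λ k → ¬? (β k ℤₚ.≟ + 0)))
    where
    w⁻ = reverse w
    β : Vect
    β = act t w (α i)
    found : Dec (∃ λ k → β k ≢ + 0) → ∃ λ k → k ∈ I × (∀ m → β m ≡ - α k m)
    found (no none) = ⊥-elim (root≢0 w i λ k → decidable-stable (β k ℤₚ.≟ + 0) (λ β≢0 → none (k , β≢0)))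
    found (yes (k , βk≢0)) = k , k∈I , wαi
      where
      k∈I : k ∈ I
      k∈I = decidable-stable (k ∈? I) λ k∉I → βk≢0 (root-supported w (word M) i i∈I k k∉I)
      γ : Vect
      γ = act t w⁻ (α k)
      γ≤0 : NonPos γ
      γ≤0 = down (maximal-reverse M) k k∈I
      expand : ∀ m → ∑ (λ j → β j * act t w⁻ (α j) m) ≡ α i m
      expand m = trans (sym (act-expand w⁻ β m)) (act-reverseˡ w (α i) m)
      term-nonneg : ∀ m j → + 0 ≤ β j * act t w⁻ (α j) m
      term-nonneg m j = by-cases (j ∈? I)
        where
        lemma : ∀ a b → (- a) * (- b) ≡ a * b
        lemma = solve-∀
        by-cases : Dec (j ∈ I) → + 0 ≤ β j * act t w⁻ (α j) m
        by-cases (yes j∈I) = subst (+ 0 ≤_) (lemma (β j) (act t w⁻ (α j) m))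
              (*-nonneg (ℤₚ.neg-mono-≤ (down M i i∈I j)) (ℤₚ.neg-mono-≤ (down (maximal-reverse M) j j∈I m)))
        by-cases (no j∉I) = ℤₚ.≤-reflexive (sym (trans
          (cong (λ z → z * act t w⁻ (α j) m) (root-supported w (word M) i i∈I j j∉I)) (ℤₚ.*-zeroˡ (act t w⁻ (α j) m))))
      product≡0 : ∀ m → i ≢ m → β k * γ m ≡ + 0
      product≡0 m i≢m = ℤₚ.≤-antisym
        (subst (β k * γ m ≤_) (trans (expand m) (δ-off i≢m)) (term≤∑ (term-nonneg m) k)) (term-nonneg m k)
      off : ∀ m → i ≢ m → γ m ≡ + 0
      off m i≢m = [ (λ p → contradiction p βk≢0) , id ]′ (ℤₚ.i*j≡0⇒i≡0∨j≡0 (β k) (product≡0 m i≢m))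
      γ≡-α : ∀ m → γ m ≡ + 0 - + 1 * α i m
      γ≡-α m = trans (multiple-of-α γ i off m)
        (trans (cong (λ z → z * α i m) (trans (sym (ℤₚ.neg-involutive (γ i))) (cong -_ -γi≡1))) (lemma (α i m)))
        where
        -γi≡1 : - γ i ≡ + 1
        -γi≡1 = 0≤∧unit⇒≡1 (ℤₚ.neg-mono-≤ (γ≤0 i))
          (trans (ℤₚ.∣-i∣≡∣i∣ (γ i)) (root-primitive w⁻ i k (γ i) (multiple-of-α γ i off)))
        lemma : ∀ a → (- + 1) * a ≡ + 0 - + 1 * a
        lemma = solve-∀
      wαi : ∀ m → β m ≡ - α k m
      wαi m = trans (lemma (β m)) (cong -_ (trans (sym combine) (act-reverseʳ w (α k) m)))
        where
        lemma : ∀ a → a ≡ - (+ 0 - + 1 * a)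
        lemma = solve-∀
        combine : act t w γ m ≡ + 0 - + 1 * β m
        combine = trans (act-cong w γ≡-α m) (trans (act-comb w (λ _ → + 0) (+ 1) (α i) m)
          (cong (λ z → z - + 1 * β m) (act-zero w {λ _ → + 0} (λ _ → refl) m)))

  -- Each reflection subtracts row i x * α i, where x is congruent to u modulo d by induction; hence
  -- row i x is congruent to row i u and divisible by d.
  act-mod : ∀ {d u} → (∀ i → i ∈ I → d ∣ row i u) → ∀ w → Word t I w → ∀ k → d ∣ act t w u k - u k
  act-mod {d} {u} rows []      []          k = divides (+ 0) (lemma (u k))
    where
    lemma : ∀ a → a - a ≡ + 0
    lemma = solve-∀
  act-mod {d} {u} rows (i ∷ w) (i∈I ∷ w∈I) k =
    subst (d ∣_) (trans (lemma₂ (x k) (u k) (row i x) (δ i k)) (cong (λ z → z - u k) (sym (reflect-comb i x k))))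
      (∣m∣n⇒∣m-n (IH k) (∣m⇒∣m*n (δ i k) row∣))
    where
    x : Vect
    x = act t w u
    IH : ∀ k → d ∣ x k - u k
    IH = act-mod rows w w∈I
    lemma : ∀ a b → (a - + 1 * b) + b ≡ a
    lemma = solve-∀
    lemma₂ : ∀ x u a e → (x - u) - a * e ≡ (x - a * e) - u
    lemma₂ = solve-∀
    row∣ : d ∣ row i x
    row∣ = subst (d ∣_) (lemma (row i x) (row i u))
      (∣m∣n⇒∣m+n (subst (d ∣_) (row-comb i x (+ 1) u)
                     (∑-∣ (λ j → ∣n⇒∣m*n (c i j) (subst (d ∣_) (cong (λ z → x j - z) (sym (ℤₚ.*-identityˡ (u j)))) (IH j)))))
                 (rows i i∈I))

-- Components of I, weights modulo the root lattice, and the opposition.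

cartan≢0⇒Adjacent : ∀ t {i j} → i ≢ j → cartan t i j ≢ + 0 → Adjacent t i j
cartan≢0⇒Adjacent t {i} {j} i≢j c≢0
  rewrite ≢⇒≡ᵇ-false {toℕ i} {toℕ j} (λ e → i≢j (toℕ-injective e)) with adjℕ t (toℕ i) (toℕ j)
... | true  = refl
... | false = contradiction refl c≢0

I≥2? : ∀ t I v → Dec (I≥2 t I v)
I≥2? t I v = (v ∈? I) ×-dec any? (λ u → (u ∈? I) ×-dec (adjℕ t (toℕ u) (toℕ v) Bool.≟ true))

-- By `closed`, I consists of the image and of vertices orthogonal to it. Injectivity follows from
-- `pres`, because 2 occurs in a Cartan matrix only on the diagonal.
record Component (t′ t : CartanType) (I : Subset (rank t)) : Set where
  field
    embed  : Fin (rank t′) → Fin (rank t)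
    inside : ∀ k → embed k ∈ I
    pres   : ∀ i j → cartan t′ i j ≡ cartan t (embed i) (embed j)
    closed : ∀ v → v ∈ I → (∃ λ k → embed k ≡ v) ⊎ (∀ k → cartan t v (embed k) ≡ + 0)

  embed-injective : ∀ {i j} → embed i ≡ embed j → i ≡ j
  embed-injective {i} {j} e =
    cartan≡2⇒≡ t′ (trans (pres i j) (trans (cong (cartan t (embed i)) (sym e)) (cartan-diag t (embed i))))

-- A vector u with all pairings divisible by d is d times a weight, and every Weyl group
-- element fixes weights modulo the root lattice.
Obstructed : CartanType → Set
Obstructed t = Σ ℤ λ d → Σ (Fin (rank t) → ℤ) λ u →
  (∀ i → d ∣ ∑ (λ j → cartan t i j * u j)) × ∃ λ a → ¬ d ∣ + 2 * u a

-- The last premise on τ records that -w acts as τ while w is trivial modulo the root lattice: `u`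
-- is twice a weight, and signs disappear modulo 2. In type D of even rank it excludes the
-- nontrivial diagram automorphisms.
Rigid : CartanType → Set
Rigid t = ∀ (τ : Fin (rank t) → Fin (rank t)) →
  (∀ i j → cartan t (τ i) (τ j) ≡ cartan t i j) →
  (∀ (u : Fin (rank t) → ℤ) → (∀ i → + 2 ∣ ∑ (λ j → cartan t i j * u j)) → ∀ a → + 2 ∣ u (τ a) - u a) →
  ∀ a → τ a ≡ a

module Push (t : CartanType) (fin : FiniteType t) (I : Subset (rank t))
            (t′ : CartanType) (K : Component t′ t I) where
  open FiniteType fin
  open Weyl t fin
  open Parabolic t fin I
  open Component K

  s : ℕ
  s = rank t′

  push : (Fin s → ℤ) → Vect
  push u j = ∑ (λ k → u k * α (embed k) j)

  ∑-δ′ : ∀ (u : Fin s → ℤ) (g : Fin s → Fin r) → (∀ {i j} → g i ≡ g j → i ≡ j) →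
         ∀ a → ∑ (λ k → u k * δ (g k) (g a)) ≡ u a
  ∑-δ′ u g inj a = trans (∑-cong (λ k → cong (λ z → u k * z) (same-δ k))) (∑-δ u a)
    where
    same-δ : ∀ k → δ (g k) (g a) ≡ δ a k
    same-δ k = by-cases (a ≟ k)
      where
      by-cases : Dec (a ≡ k) → δ (g k) (g a) ≡ δ a k
      by-cases (yes refl) = trans (δ-diag (g a)) (sym (δ-diag a))
      by-cases (no a≢k)   = trans (δ-off (λ e → a≢k (sym (inj e)))) (sym (δ-off a≢k))

  push-embed : ∀ u a → push u (embed a) ≡ u a
  push-embed u a = ∑-δ′ u embed embed-injective a

  row-push : ∀ i u → row i (push u) ≡ ∑ (λ k → u k * c i (embed k))
  row-push i u = trans (row-∑ i u (λ k → α (embed k)))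
                       (∑-cong (λ k → cong (λ z → u k * z) (row-α i (embed k))))

  row-push-∣ : ∀ {d} u → (∀ a → d ∣ ∑ (λ k → cartan t′ a k * u k)) → ∀ i → i ∈ I → d ∣ row i (push u)
  row-push-∣ {d} u rows i i∈I = by-cases (closed i i∈I)
    where
    by-cases : (∃ λ k → embed k ≡ i) ⊎ (∀ k → c i (embed k) ≡ + 0) → d ∣ row i (push u)
    by-cases (inj₁ (a , refl)) = subst (d ∣_)
      (trans (∑-cong (λ k → trans (ℤₚ.*-comm (cartan t′ a k) (u k)) (cong (λ z → u k * z) (pres a k))))
             (sym (row-push i u)))
      (rows a)
    by-cases (inj₂ zeros) = divides (+ 0) (trans (row-push i u)
      (∑-zero (λ k → trans (cong (λ z → u k * z) (zeros k)) (ℤₚ.*-zeroʳ (u k)))))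

  act-push : ∀ w u k → act t w (push u) k ≡ ∑ (λ m → u m * act t w (α (embed m)) k)
  act-push w u k = begin
    act t w (push u) k
      ≡⟨ act-expand w (push u) k ⟩
    ∑ (λ j → ∑ (λ m → u m * α (embed m) j) * a j)
      ≡⟨ ∑-cong (λ j → trans (ℤₚ.*-comm (push u j) (a j)) (sym (∑-* (a j) (λ m → u m * α (embed m) j)))) ⟩
    ∑ (λ j → ∑ (λ m → a j * (u m * α (embed m) j)))
      ≡⟨ ∑-swap (λ j m → a j * (u m * α (embed m) j)) ⟩
    ∑ (λ m → ∑ (λ j → a j * (u m * α (embed m) j)))
      ≡⟨ ∑-cong (λ m → trans (∑-cong (λ j → lemma (a j) (u m) (α (embed m) j)))
                 (trans (∑-* (u m) (λ j → a j * α (embed m) j)) (cong (λ z → u m * z) (∑-δ a (embed m))))) ⟩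
    ∑ (λ m → u m * act t w (α (embed m)) k) ∎
    where
    open ≡-Reasoning
    a : Vect
    a j = act t w (α j) k
    lemma : ∀ x y z → x * (y * z) ≡ y * (x * z)
    lemma = solve-∀

  ∑-neg : ∀ (u v : Fin s → ℤ) → ∑ (λ m → u m * - v m) ≡ - ∑ (λ m → u m * v m)
  ∑-neg u v = trans (∑-cong (λ m → lemma (u m) (v m)))
    (trans (∑-* (- + 1) (λ m → u m * v m)) (lemma₂ (∑ (λ m → u m * v m))))
    where
    lemma : ∀ a b → a * - b ≡ (- + 1) * (a * b)
    lemma = solve-∀
    lemma₂ : ∀ a → (- + 1) * a ≡ - a
    lemma₂ = solve-∀

  -- `OppositionTrivial` speaks of longest words, so one is produced first. It negates `push u`, the
  -- extension of u by zero, and fixes it modulo d, whence d divides 2 u a.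
  obstruction : Obstructed t′ → ¬ OppositionTrivial t I
  obstruction (d , u , rows , a , ¬d∣2u) opp = ¬d∣2u (subst (d ∣_) value
    (∣m⇒∣-m (act-mod (row-push-∣ u rows) w (Maximal.word M) (embed a))))
    where
    w = proj₁ maximal-exists
    M = proj₂ maximal-exists
    lemma : ∀ x → - (- x - x) ≡ + 2 * x
    lemma = solve-∀
    moved : act t w (push u) (embed a) ≡ - u a
    moved = trans (act-push w u (embed a))
      (trans (∑-cong (λ m → cong (λ z → u m * z) (opp w (maximal⇒longest M) (embed m) (inside m) (embed a))))
        (trans (∑-neg u (λ m → δ (embed m) (embed a))) (cong -_ (push-embed u a))))
    value : - (act t w (push u) (embed a) - push u (embed a)) ≡ + 2 * u a
    value = trans (cong₂ (λ x y → - (x - y)) moved (push-embed u a)) (lemma (u a))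

  module Opposite {w : Letters} (M : Maximal w) where

    InImage : Fin r → Set
    InImage v = ∃ λ k → embed k ≡ v

    image? : ∀ v → Dec (InImage v)
    image? v = any? (λ k → embed k ≟ v)

    -- `opposition` yields some k in I. Reflections at vertices of I off the component do nothing to
    -- a vector supported on it, so k lies in the component.
    opposite : ∀ a → ∃ λ b → ∀ m → act t w (α (embed a)) m ≡ - α (embed b) m
    opposite a with opposition M (embed a) (inside a)
    ... | k , k∈I , wα = proj₁ k∈image , λ m → trans (wα m) (cong (λ z → - α z m) (sym (proj₂ k∈image)))
      where
      supported : SupportedOn InImage (act t w (α (embed a)))
      supported = act-supported image?
        (λ i i∈I i∉im j (b , eb≡j) → subst (λ z → c i z ≡ + 0) eb≡j
          ([ (λ i∈im → contradiction i∈im i∉im) , (λ zeros → zeros b) ]′ (closed i i∈I)))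
        w (Maximal.word M) (α-supported (embed a) (a , refl))
      k∈image : InImage k
      k∈image = decidable-stable (image? k) λ k∉im →
        contradiction (trans (cong -_ (sym (δ-diag k))) (trans (sym (wα k)) (supported k k∉im))) λ ()

    τ : Fin s → Fin s
    τ a = proj₁ (opposite a)

    wα : ∀ a m → act t w (α (embed a)) m ≡ - α (embed (τ a)) m
    wα a = proj₂ (opposite a)

    τ-form : ∀ a b → form (α (embed (τ a))) (α (embed (τ b))) ≡ form (α (embed a)) (α (embed b))
    τ-form a b = trans double-neg (trans
      (form-cong (λ m → sym (wα′ a m)) (λ m → sym (wα′ b m))) (act-form w (α (embed a)) (α (embed b))))
      where
      x y zero-vect : Vect
      x = α (embed (τ a))
      y = α (embed (τ b))
      zero-vect _ = + 0
      lemma : ∀ z → - z ≡ + 0 - + 1 * z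
      lemma = solve-∀
      wα′ : ∀ a → act t w (α (embed a)) ≗ᵥ (zero-vect -[ + 1 ] α (embed (τ a)))
      wα′ a m = trans (wα a m) (lemma (α (embed (τ a)) m))
      form-zeroˡ : ∀ v → form zero-vect v ≡ + 0
      form-zeroˡ v = ∑-zero (λ i → ∑-zero (λ j → trans (cong (λ z → e i j * z) (ℤₚ.*-zeroˡ (v j))) (ℤₚ.*-zeroʳ (e i j))))
      lemma₂ : ∀ f → f ≡ + 0 - + 1 * (+ 0 - + 1 * f)
      lemma₂ = solve-∀
      double-neg : form x y ≡ form (zero-vect -[ + 1 ] x) (zero-vect -[ + 1 ] y)
      double-neg = sym (trans (form-combˡ zero-vect (+ 1) x (zero-vect -[ + 1 ] y))
        (trans (cong₂ (λ p q → p - + 1 * q) (form-zeroˡ (zero-vect -[ + 1 ] y))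
                 (trans (form-combʳ x zero-vect (+ 1) y)
                   (cong (λ z → z - + 1 * form x y) (trans (form-sym x zero-vect) (form-zeroˡ x)))))
               (sym (lemma₂ (form x y)))))

    form-αα′ : ∀ i j → form (α i) (α j) ≡ ℓ i * c i j
    form-αα′ i j = trans (form-α i (α j)) (cong (λ z → ℓ i * z) (row-α i j))

    τ-len : ∀ a → ℓ (embed (τ a)) ≡ ℓ (embed a)
    τ-len a = ℤₚ.*-cancelˡ-≡ (+ 2) _ _
      (trans (sym (form-αα (embed (τ a)))) (trans (τ-form a a) (form-αα (embed a))))

    τ-cartan : ∀ a b → cartan t′ (τ a) (τ b) ≡ cartan t′ a b
    τ-cartan a b = trans (pres (τ a) (τ b)) (trans (ℤₚ.*-cancelˡ-≡ (ℓ (embed a)) _ _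
      (trans (cong (λ z → z * c (embed (τ a)) (embed (τ b))) (sym (τ-len a)))
        (trans (sym (form-αα′ (embed (τ a)) (embed (τ b)))) (trans (τ-form a b) (form-αα′ (embed a) (embed b))))))
      (sym (pres a b)))

    τ-injective : ∀ {a b} → embed (τ a) ≡ embed (τ b) → a ≡ b
    τ-injective {a} {b} eq = cartan≡2⇒≡ t′ (trans (sym (τ-cartan a b))
      (trans (cong (cartan t′ (τ a)) (sym (embed-injective eq))) (cartan-diag t′ (τ a))))

    -- At coordinate τ a the image of `push u` is -u a, since τ is injective. `act-mod` compares
    -- this with u (τ a), and subtracting 2 u a repairs the sign.
    τ-mod2 : ∀ u → (∀ i → + 2 ∣ ∑ (λ j → cartan t′ i j * u j)) → ∀ a → + 2 ∣ u (τ a) - u a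
    τ-mod2 u rows a = subst (+ 2 ∣_) value
      (∣m∣n⇒∣m-n (∣m⇒∣-m (act-mod (row-push-∣ u rows) w (Maximal.word M) (embed (τ a))))
                 (divides (u a) refl))
      where
      moved : act t w (push u) (embed (τ a)) ≡ - u a
      moved = trans (act-push w u (embed (τ a)))
        (trans (∑-cong (λ m → cong (λ z → u m * z) (wα m (embed (τ a)))))
          (trans (∑-neg u (λ m → δ (embed (τ m)) (embed (τ a))))
                 (cong -_ (∑-δ′ u (λ m → embed (τ m)) τ-injective a))))
      lemma : ∀ x y → - (- x - y) - x * + 2 ≡ y - x
      lemma = solve-∀
      value : - (act t w (push u) (embed (τ a)) - push u (embed (τ a))) - u a * + 2 ≡ u (τ a) - u a
      value = trans (cong₂ (λ x y → - (x - y) - u a * + 2) moved (push-embed u (τ a))) (lemma (u a) (u (τ a)))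

    rigid⇒negated : Rigid t′ → ∀ a m → act t w (α (embed a)) m ≡ - α (embed a) m
    rigid⇒negated rigid a m = trans (wα a m) (cong (λ z → - α (embed z) m) (rigid τ τ-cartan τ-mod2 a))

module Criterion (t : CartanType) (fin : FiniteType t) (I : Subset (rank t)) where
  open FiniteType fin
  open Weyl t fin
  open Parabolic t fin I

  cartan-zero-sym : ∀ i j → cartan t i j ≡ + 0 → cartan t j i ≡ + 0
  cartan-zero-sym i j cij≡0 = [ (λ ℓ≡0 → contradiction (subst (+ 1 ≤_) ℓ≡0 (ℓ-pos j)) λ { (ℤ.+≤+ ()) }) , id ]′
    (ℤₚ.i*j≡0⇒i≡0∨j≡0 (ℓ j) (trans (sym (len-cartan i j)) (trans (cong (λ z → ℓ i * z) cij≡0) (ℤₚ.*-zeroʳ (ℓ i)))))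

  I≥2-neighbour : ∀ {u v} → u ∈ I → v ∈ I → u ≢ v → cartan t u v ≢ + 0 → I≥2 t I v
  I≥2-neighbour {u} u∈I v∈I u≢v c≢0 = v∈I , u , u∈I , cartan≢0⇒Adjacent t u≢v c≢0

  ofType⇒component : ∀ {t′} → OfType t′ t (I≥2 t I) → Component t′ t I
  ofType⇒component {t′} (f , _ , image , pres) = record
    { embed = f ; inside = inside ; pres = pres ; closed = closed }
    where
    inside : ∀ k → f k ∈ I
    inside k = proj₁ (proj₂ (image (f k)) (k , refl))
    closed : ∀ v → v ∈ I → (∃ λ k → f k ≡ v) ⊎ (∀ k → cartan t v (f k) ≡ + 0)
    closed v v∈I with any? (λ k → f k ≟ v)
    ... | yes v∈im = inj₁ v∈im
    ... | no  v∉im = inj₂ λ k → cartan-zero-sym (f k) v (decidable-stable (cartan t (f k) v ℤₚ.≟ + 0)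
      λ c≢0 → v∉im (proj₁ (image v) (I≥2-neighbour (inside k) v∈I (λ e → v∉im (k , e)) c≢0)))

  -- The opposition has to be trivial at isolated vertices too, although they lie outside `I≥2`. As
  -- components with one vertex they leave τ no choice.
  isolated⇒component : ∀ {i} → i ∈ I → ¬ I≥2 t I i → Component (A 1) t I
  isolated⇒component {i} i∈I isolated = record
    { embed = λ _ → i ; inside = λ _ → i∈I
    ; pres = λ { zero zero → sym (cartan-diag t i) }
    ; closed = closed }
    where
    closed : ∀ v → v ∈ I → (∃ λ (k : Fin 1) → i ≡ v) ⊎ (∀ (k : Fin 1) → cartan t v i ≡ + 0)
    closed v v∈I with i ≟ v
    ... | yes i≡v = inj₁ (zero , i≡v)
    ... | no  i≢v = inj₂ λ _ → decidable-stable (cartan t v i ℤₚ.≟ + 0)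
      λ c≢0 → isolated (I≥2-neighbour v∈I i∈I (≢-sym i≢v) c≢0)

  ofType⇒trivial : ∀ {t′} → Rigid t′ → OfType t′ t (I≥2 t I) → OppositionTrivial t I
  ofType⇒trivial {t′} rigid K w longest i i∈I = by-cases (I≥2? t I i)
    where
    by-cases : Dec (I≥2 t I i) → ∀ k → act t w (simpleRoot t i) k ≡ - simpleRoot t i k
    by-cases (yes big) with proj₁ (proj₁ (proj₂ (proj₂ K)) i) big
    ... | a , refl = Push.Opposite.rigid⇒negated t fin I t′ (ofType⇒component K) (longest⇒maximal longest) rigid a
    by-cases (no isolated) = Push.Opposite.rigid⇒negated t fin I (A 1) (isolated⇒component i∈I isolated)
      (longest⇒maximal longest) (λ { τ _ _ zero → fin1 (τ zero) }) zero
      where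
      fin1 : ∀ (a : Fin 1) → a ≡ zero
      fin1 zero = refl

-- Classical Cartan matrices by recursion, and dominant vectors.

Matrix : ℕ → Set
Matrix n = Fin n → Fin n → ℤ

-- A new vertex 0, joined to the old one by a simple bond. The classical series arise in this way
-- from A_1, B_2, C_2 and D_3, with the special end untouched.
grow : ∀ {n} → Matrix (suc n) → Matrix (suc (suc n))
grow M zero          zero          = + 2
grow M zero          (suc zero)    = - + 1
grow M zero          (suc (suc _)) = + 0
grow M (suc zero)    zero          = - + 1
grow M (suc (suc _)) zero          = + 0
grow M (suc i)       (suc j)       = M i j

cartan-A : ∀ n i j → cartan (A (2 ℕ.+ n)) i j ≡ grow (cartan (A (1 ℕ.+ n))) i j
cartan-A n zero          zero          = refl
cartan-A n zero          (suc zero)    = refl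
cartan-A n zero          (suc (suc _)) = refl
cartan-A n (suc zero)    zero          = refl
cartan-A n (suc (suc _)) zero          = refl
cartan-A n (suc zero)    (suc j)       = refl
cartan-A n (suc (suc i)) (suc j)       = refl

cartan-B : ∀ n i j → cartan (B (3 ℕ.+ n)) i j ≡ grow (cartan (B (2 ℕ.+ n))) i j
cartan-B n zero          zero          = refl
cartan-B n zero          (suc zero)    = refl
cartan-B n zero          (suc (suc _)) = refl
cartan-B n (suc zero)    zero          = refl
cartan-B n (suc (suc _)) zero          = refl
cartan-B n (suc zero)    (suc j)       = refl
cartan-B n (suc (suc i)) (suc j)       = refl

cartan-C : ∀ n i j → cartan (C (3 ℕ.+ n)) i j ≡ grow (cartan (C (2 ℕ.+ n))) i j
cartan-C n zero          zero          = refl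
cartan-C n zero          (suc zero)    = refl
cartan-C n zero          (suc (suc _)) = refl
cartan-C n (suc zero)    zero          = refl
cartan-C n (suc (suc _)) zero          = refl
cartan-C n (suc zero)    (suc j)       = refl
cartan-C n (suc (suc i)) (suc j)       = refl

≤ᵇ-suc : ∀ i m → (suc i ℕ.≤ᵇ suc m) ≡ (i ℕ.≤ᵇ m)
≤ᵇ-suc zero    m = refl
≤ᵇ-suc (suc i) m = refl

adj-D-suc : ∀ n i j → adjℕ (D (4 ℕ.+ n)) (suc i) (suc j) ≡ adjℕ (D (3 ℕ.+ n)) i j
adj-D-suc n i j rewrite ≤ᵇ-suc i (suc n) | ≤ᵇ-suc j (suc n) = refl

cartan-D-suc : ∀ n i j → cartan (D (4 ℕ.+ n)) (suc i) (suc j) ≡ cartan (D (3 ℕ.+ n)) i j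
cartan-D-suc n i j rewrite adj-D-suc n (toℕ i) (toℕ j) = refl

-- The series starts at `D 3`, the path 1 - 0 - 2, whose middle vertex is the branch point that the
-- first new vertex is joined to.
cartan-D : ∀ n i j → cartan (D (4 ℕ.+ n)) i j ≡ grow (cartan (D (3 ℕ.+ n))) i j
cartan-D n zero          zero          = refl
cartan-D n zero          (suc zero)    = refl
cartan-D zero    zero          (suc (suc j)) = from-yes (all? λ j → cartan (D 4) zero (suc (suc j)) ℤₚ.≟ + 0) j
cartan-D (suc n) zero          (suc (suc _)) = refl
cartan-D n (suc zero)    zero          = refl
cartan-D zero    (suc (suc i)) zero          = from-yes (all? λ i → cartan (D 4) (suc (suc i)) zero ℤₚ.≟ + 0) i
cartan-D (suc n) (suc (suc i)) zero
  rewrite ∧-zeroʳ (toℕ i ℕ.≡ᵇ n) | ∧-zeroʳ (suc (suc (toℕ i)) ℕ.≡ᵇ 4 ℕ.+ n) = refl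
cartan-D n (suc zero)    (suc j)       = cartan-D-suc n zero j
cartan-D n (suc (suc i)) (suc j)       = cartan-D-suc n (suc i) j

-- The pairing with v of row i, when v takes the value x at a virtual vertex before vertex 0.
prow : ∀ {n} → Matrix (suc n) → ℤ → Fin (suc n) → (Fin (suc n) → ℤ) → ℤ
prow M x zero    v = ∑ (λ j → M zero j * v j) - x
prow M x (suc i) v = ∑ (λ j → M (suc i) j * v j)

prow-cong : ∀ {n} {M N : Matrix (suc n)} → (∀ i j → M i j ≡ N i j) → ∀ x i v → prow M x i v ≡ prow N x i v
prow-cong M≗N x zero    v = cong (λ z → z - x) (∑-cong (λ j → cong (λ z → z * v j) (M≗N zero j)))
prow-cong M≗N x (suc i) v = ∑-cong (λ j → cong (λ z → z * v j) (M≗N (suc i) j))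

prow-0 : ∀ {n} (M : Matrix (suc n)) i v → prow M (+ 0) i v ≡ ∑ (λ j → M i j * v j)
prow-0 M zero    v = ℤₚ.+-identityʳ _
prow-0 M (suc i) v = refl

prow-grow-zero : ∀ {n} (M : Matrix (suc n)) x v → prow (grow M) x zero v ≡ + 2 * v zero - v (suc zero) - x
prow-grow-zero M x v = cong (λ z → z - x)
  (trans (cong (λ z → + 2 * v zero + ((- + 1) * v (suc zero) + z)) (∑-zero (λ j → ℤₚ.*-zeroˡ (v (suc (suc j))))))
         (lemma (v zero) (v (suc zero))))
  where
  lemma : ∀ a b → + 2 * a + ((- + 1) * b + + 0) ≡ + 2 * a - b
  lemma = solve-∀

prow-grow-suc : ∀ {n} (M : Matrix (suc n)) x i v → prow (grow M) x (suc i) v ≡ prow M (v zero) i (v ∘ suc)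
prow-grow-suc M x zero    v = lemma (v zero) (∑ (λ j → M zero j * v (suc j)))
  where
  lemma : ∀ a s → (- + 1) * a + s ≡ s - a
  lemma = solve-∀
prow-grow-suc M x (suc i) v = lemma (v zero) (∑ (λ j → M (suc i) j * v (suc j)))
  where
  lemma : ∀ a s → + 0 * a + s ≡ s
  lemma = solve-∀

-- A positive vector with positive rows that begins with 2 (a + b), where 2 a is the virtual
-- value before vertex 0; the increment 2 b drops by 2 along the chain.
Dominant : ∀ {n} → Matrix (suc n) → ℕ → Set
Dominant M b = ∀ (a : ℕ) → ∃ λ v → v zero ≡ + 2 * (+ a + + b) × (∀ i → + 1 ≤ v i) × (∀ i → + 1 ≤ prow M (+ 2 * + a) i v)

dominant-cong : ∀ {n} {M N : Matrix (suc n)} {b} → (∀ i j → M i j ≡ N i j) → Dominant N b → Dominant M b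
dominant-cong M≗N dom a with dom a
... | v , v₀ , pos , rows = v , v₀ , pos , λ i → subst (+ 1 ≤_) (sym (prow-cong M≗N _ i v)) (rows i)

even≥1 : ∀ a b → + 1 ≤ + 2 * (+ a + + suc b)
even≥1 a b = ≤-by (ℤ.+≤+ (ℕ.z≤n {1 ℕ.+ 2 ℕ.* (a ℕ.+ b)})) 
  (trans (lemma (+ a) (+ b)) (cong (λ z → + 1 + z) (sym (ℤₚ.pos-* 2 (a ℕ.+ b)))))
  where
  lemma : ∀ a b → + 2 * (a + (+ 1 + b)) - + 1 ≡ + 1 + + 2 * (a + b)
  lemma = solve-∀

dominant-grow : ∀ {n} {M : Matrix (suc n)} {b} → Dominant M b → Dominant (grow M) (suc b)
dominant-grow {n} {M} {b} dom a = v′ , refl , pos′ , rows′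
  where
  -- The entry at the new vertex is the virtual value seen by the tail. The first entry of the tail
  -- exceeds it by 2 b, which makes row 0 equal to 2.
  a′ = a ℕ.+ suc b
  tail = dom a′
  v = proj₁ tail
  v₀ = proj₁ (proj₂ tail)
  pos = proj₁ (proj₂ (proj₂ tail))
  rows = proj₂ (proj₂ (proj₂ tail))
  v′ : Fin (suc (suc n)) → ℤ
  v′ zero    = + 2 * (+ a + + suc b)
  v′ (suc i) = v i
  pos′ : ∀ i → + 1 ≤ v′ i
  pos′ zero    = even≥1 a b
  pos′ (suc i) = pos i
  rows′ : ∀ i → + 1 ≤ prow (grow M) (+ 2 * + a) i v′
  rows′ zero    = subst (+ 1 ≤_) (sym (trans (prow-grow-zero M (+ 2 * + a) v′)
      (trans (cong (λ z → + 2 * (+ 2 * (+ a + + suc b)) - z - + 2 * + a) v₀) (lemma (+ a) (+ b)))))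
      (ℤ.+≤+ (ℕ.s≤s (ℕ.z≤n {1})))
    where
    lemma : ∀ a b → + 2 * (+ 2 * (a + (+ 1 + b))) - + 2 * ((a + (+ 1 + b)) + b) - + 2 * a ≡ + 2
    lemma = solve-∀
  rows′ (suc i) = subst (+ 1 ≤_) (sym (prow-grow-suc M (+ 2 * + a) i v′)) (rows i)

1≤2 : + 1 ≤ + 2
1≤2 = ℤ.+≤+ (ℕ.s≤s ℕ.z≤n)

dominant-A : ∀ n → Dominant (cartan (A (1 ℕ.+ n))) (2 ℕ.+ n)
dominant-A zero a = (λ _ → + 2 * (+ a + + 2)) , refl , (λ _ → even≥1 a 1) ,
  λ { zero → ≤-by (ℤ.+≤+ (ℕ.z≤n {7 ℕ.+ 2 ℕ.* a})) (trans (lemma (+ a)) (cong (λ z → + 7 + z) (sym (ℤₚ.pos-* 2 a)))) }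
  where
  lemma : ∀ a → + 2 * (+ 2 * (a + + 2)) + + 0 - + 2 * a - + 1 ≡ + 7 + + 2 * a
  lemma = solve-∀
dominant-A (suc n) = dominant-cong (cartan-A n) (dominant-grow (dominant-A n))

dominant-B : ∀ n → Dominant (cartan (B (2 ℕ.+ n))) (2 ℕ.+ n)
dominant-B zero a = v , refl ,
  (λ { zero → even≥1 a 1 ; (suc zero) → ≤-by (ℤ.+≤+ (ℕ.z≤n {4 ℕ.+ 2 ℕ.* a}))
       (trans (lemma (+ a)) (cong (λ z → + 4 + z) (sym (ℤₚ.pos-* 2 a)))) }) ,
  λ { zero → ℤₚ.≤-trans 1≤2 (ℤₚ.≤-trans (ℤ.+≤+ (ℕ.s≤s (ℕ.s≤s (ℕ.z≤n {1})))) (ℤₚ.≤-reflexive (sym (lemma₀ (+ a)))))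
    ; (suc zero) → subst (+ 1 ≤_) (sym (lemma₁ (+ a))) 1≤2 }
  where
  v : Fin 2 → ℤ
  v zero       = + 2 * (+ a + + 2)
  v (suc zero) = + 2 * (+ a + + 2) + + 1
  lemma : ∀ a → + 2 * (a + + 2) + + 1 - + 1 ≡ + 4 + + 2 * a
  lemma = solve-∀
  lemma₀ : ∀ a → + 2 * (+ 2 * (a + + 2)) + ((- + 1) * (+ 2 * (a + + 2) + + 1) + + 0) - + 2 * a ≡ + 3
  lemma₀ = solve-∀
  lemma₁ : ∀ a → (- + 2) * (+ 2 * (a + + 2)) + (+ 2 * (+ 2 * (a + + 2) + + 1) + + 0) ≡ + 2
  lemma₁ = solve-∀
dominant-B (suc n) = dominant-cong (cartan-B n) (dominant-grow (dominant-B n))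

-- The next value along the chain would be 2 (a + 3). The long end vertex takes half of it, as do
-- both ends of the fork in type D; hence the even values in `Dominant`.
dominant-C : ∀ n → Dominant (cartan (C (2 ℕ.+ n))) (2 ℕ.+ n)
dominant-C zero a = v , refl ,
  (λ { zero → even≥1 a 1 ; (suc zero) → ℤ.+≤+ (ℕₚ.≤-trans (ℕ.s≤s ℕ.z≤n) (ℕₚ.m≤n+m 3 a)) }) ,
  λ { zero → subst (+ 1 ≤_) (sym (lemma₀ (+ a))) 1≤2
    ; (suc zero) → subst (+ 1 ≤_) (sym (lemma₁ (+ a))) 1≤2 }
  where
  v : Fin 2 → ℤ
  v zero       = + 2 * (+ a + + 2)
  v (suc zero) = + a + + 3
  lemma₀ : ∀ a → + 2 * (+ 2 * (a + + 2)) + ((- + 2) * (a + + 3) + + 0) - + 2 * a ≡ + 2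
  lemma₀ = solve-∀
  lemma₁ : ∀ a → (- + 1) * (+ 2 * (a + + 2)) + (+ 2 * (a + + 3) + + 0) ≡ + 2
  lemma₁ = solve-∀
dominant-C (suc n) = dominant-cong (cartan-C n) (dominant-grow (dominant-C n))

dominant-D : ∀ n → Dominant (cartan (D (3 ℕ.+ n))) (2 ℕ.+ n)
dominant-D zero a = v , refl ,
  (λ { zero → even≥1 a 1 ; (suc _) → ℤ.+≤+ (ℕₚ.≤-trans (ℕ.s≤s ℕ.z≤n) (ℕₚ.m≤n+m 3 a)) }) ,
  λ { zero → subst (+ 1 ≤_) (sym (lemma₀ (+ a))) 1≤2
    ; (suc zero) → subst (+ 1 ≤_) (sym (lemma₁ (+ a))) 1≤2
    ; (suc (suc zero)) → subst (+ 1 ≤_) (sym (lemma₂ (+ a))) 1≤2 }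
  where
  v : Fin 3 → ℤ
  v zero    = + 2 * (+ a + + 2)
  v (suc _) = + a + + 3
  lemma₀ : ∀ a → + 2 * (+ 2 * (a + + 2)) + ((- + 1) * (a + + 3) + ((- + 1) * (a + + 3) + + 0)) - + 2 * a ≡ + 2
  lemma₀ = solve-∀
  lemma₁ : ∀ a → (- + 1) * (+ 2 * (a + + 2)) + (+ 2 * (a + + 3) + (+ 0 * (a + + 3) + + 0)) ≡ + 2
  lemma₁ = solve-∀
  lemma₂ : ∀ a → (- + 1) * (+ 2 * (a + + 2)) + (+ 0 * (a + + 3) + (+ 2 * (a + + 3) + + 0)) ≡ + 2
  lemma₂ = solve-∀
dominant-D (suc n) = dominant-cong (cartan-D n) (dominant-grow (dominant-D n))

∑rows : ∀ t → (Fin (rank t) → ℤ) → Fin (rank t) → ℤ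
∑rows t v i = ∑ (λ j → cartan t i j * v j)

-- Between unequal lengths one entry is minus the longer squared length and the other is -1. The
-- products agree when the shorter squared length is 1, which is what the premises demand.
balanced : ∀ a b → ((a ℕ.<ᵇ b) ≡ true → a ≡ 1) → ((b ℕ.<ᵇ a) ≡ true → b ≡ 1) →
           + a * (if a ℕ.<ᵇ b then - + b else - + 1) ≡ + b * (if b ℕ.<ᵇ a then - + a else - + 1)
balanced zero    zero    p q = refl
balanced zero    (suc b) p q with p refl
... | ()
balanced (suc a) zero    p q with q refl
... | ()
balanced (suc zero) (suc zero) p q = refl
balanced (suc zero) (suc (suc b)) p q = lemma (+ suc (suc b))
  where
  lemma : ∀ x → + 1 * (- x) ≡ x * (- + 1)
  lemma = solve-∀
balanced (suc (suc a)) (suc zero) p q = lemma (+ suc (suc a))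
  where
  lemma : ∀ x → x * (- + 1) ≡ + 1 * (- x)
  lemma = solve-∀
balanced (suc (suc a)) (suc (suc b)) p q with a ℕ.<ᵇ b in a<b | b ℕ.<ᵇ a in b<a
... | true  | _     = contradiction (p refl) λ ()
... | false | true  = contradiction (q refl) λ ()
... | false | false = cong (λ z → + suc (suc z) * (- + 1)) {a} {b}
  (ℕₚ.≤-antisym (ℕₚ.≮⇒≥ λ b<a′ → ≢true b<a (ℕₚ.<⇒<ᵇ {b} {a} b<a′)) (ℕₚ.≮⇒≥ λ a<b′ → ≢true a<b (ℕₚ.<⇒<ᵇ {a} {b} a<b′)))
  where
  ≢true : ∀ {x} → x ≡ false → ¬ T x
  ≢true refl ()

len-cartan-from : ∀ t → (∀ i j → adjℕ t i j ≡ adjℕ t j i) →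
  (∀ i j → (lenℕ t i ℕ.<ᵇ lenℕ t j) ≡ true → lenℕ t i ≡ 1) →
  ∀ (i j : Fin (rank t)) → + lenℕ t (toℕ i) * cartan t i j ≡ + lenℕ t (toℕ j) * cartan t j i
len-cartan-from t adj-sym short i j with i ≟ j
... | yes refl = refl
... | no  i≢j
  rewrite ≢⇒≡ᵇ-false {toℕ i} {toℕ j} (λ e → i≢j (toℕ-injective e))
        | ≢⇒≡ᵇ-false {toℕ j} {toℕ i} (λ e → i≢j (sym (toℕ-injective e)))
        | adj-sym (toℕ j) (toℕ i)
  with adjℕ t (toℕ i) (toℕ j)
... | true  = balanced (lenℕ t (toℕ i)) (lenℕ t (toℕ j)) (short (toℕ i) (toℕ j)) (short (toℕ j) (toℕ i))
... | false = trans (ℤₚ.*-zeroʳ (+ lenℕ t (toℕ i))) (sym (ℤₚ.*-zeroʳ (+ lenℕ t (toℕ j))))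

∨-elim : ∀ x {y} → x ∨ y ≡ true → x ≡ true ⊎ y ≡ true
∨-elim true  _ = inj₁ refl
∨-elim false e = inj₂ e

consec-sym : ∀ i j → ((suc i ℕ.≡ᵇ j) ∨ (suc j ℕ.≡ᵇ i)) ≡ ((suc j ℕ.≡ᵇ i) ∨ (suc i ℕ.≡ᵇ j))
consec-sym i j = ∨-comm (suc i ℕ.≡ᵇ j) (suc j ℕ.≡ᵇ i)

adj-sym-D : ∀ n i j → adjℕ (D n) i j ≡ adjℕ (D n) j i
adj-sym-D n i j = cong₂ _∨_
  (cong₂ _∧_ (consec-sym i j) (∧-comm (i ℕ.≤ᵇ (n ℕ.∸ 2)) (j ℕ.≤ᵇ (n ℕ.∸ 2))))
  (swap (i ℕ.≡ᵇ (n ℕ.∸ 3)) (j ℕ.≡ᵇ (n ℕ.∸ 1)) (i ℕ.≡ᵇ (n ℕ.∸ 1)) (j ℕ.≡ᵇ (n ℕ.∸ 3)))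
  where
  swap : ∀ p q r s → (p ∧ q) ∨ (r ∧ s) ≡ (s ∧ r) ∨ (q ∧ p)
  swap p q r s = trans (∨-comm (p ∧ q) (r ∧ s)) (cong₂ _∨_ (∧-comm r s) (∧-comm p q))

finite-A : ∀ n → FiniteType (A (suc n))
finite-A n = record
  { len-pos = λ _ → ℕₚ.≤-refl
  ; len-cartan = len-cartan-from (A (suc n)) consec-sym (λ _ _ ())
  ; dom = proj₁ d ; dom-pos = proj₁ (proj₂ (proj₂ d))
  ; dom-row = λ i → subst (+ 1 ≤_) (prow-0 (cartan (A (suc n))) i (proj₁ d)) (proj₂ (proj₂ (proj₂ d)) i) }
  where d = dominant-A n 0

finite-B : ∀ n → FiniteType (B (2 ℕ.+ n))
finite-B n = record
  { len-pos = λ i → pos (toℕ i ℕ.≡ᵇ suc n)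
  ; len-cartan = len-cartan-from (B (2 ℕ.+ n)) consec-sym (λ i j → short (i ℕ.≡ᵇ suc n) (j ℕ.≡ᵇ suc n))
  ; dom = proj₁ d ; dom-pos = proj₁ (proj₂ (proj₂ d))
  ; dom-row = λ i → subst (+ 1 ≤_) (prow-0 (cartan (B (2 ℕ.+ n))) i (proj₁ d)) (proj₂ (proj₂ (proj₂ d)) i) }
  where
  d = dominant-B n 0
  pos : ∀ b → 1 ℕ.≤ (if b then 1 else 2)
  pos true  = ℕ.s≤s ℕ.z≤n
  pos false = ℕ.s≤s ℕ.z≤n
  short : ∀ b b′ → ((if b then 1 else 2) ℕ.<ᵇ (if b′ then 1 else 2)) ≡ true → (if b then 1 else 2) ≡ 1
  short true  _     _ = refl
  short false true  ()
  short false false ()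

finite-C : ∀ n → FiniteType (C (2 ℕ.+ n))
finite-C n = record
  { len-pos = λ i → pos (toℕ i ℕ.≡ᵇ suc n)
  ; len-cartan = len-cartan-from (C (2 ℕ.+ n)) consec-sym (λ i j → short (i ℕ.≡ᵇ suc n) (j ℕ.≡ᵇ suc n))
  ; dom = proj₁ d ; dom-pos = proj₁ (proj₂ (proj₂ d))
  ; dom-row = λ i → subst (+ 1 ≤_) (prow-0 (cartan (C (2 ℕ.+ n))) i (proj₁ d)) (proj₂ (proj₂ (proj₂ d)) i) }
  where
  d = dominant-C n 0
  pos : ∀ b → 1 ℕ.≤ (if b then 2 else 1)
  pos true  = ℕ.s≤s ℕ.z≤n
  pos false = ℕ.s≤s ℕ.z≤n
  short : ∀ b b′ → ((if b then 2 else 1) ℕ.<ᵇ (if b′ then 2 else 1)) ≡ true → (if b then 2 else 1) ≡ 1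
  short false _     _ = refl
  short true  true  ()
  short true  false ()

finite-D : ∀ n → FiniteType (D (3 ℕ.+ n))
finite-D n = record
  { len-pos = λ _ → ℕₚ.≤-refl
  ; len-cartan = len-cartan-from (D (3 ℕ.+ n)) (adj-sym-D (3 ℕ.+ n)) (λ _ _ ())
  ; dom = proj₁ d ; dom-pos = proj₁ (proj₂ (proj₂ d))
  ; dom-row = λ i → subst (+ 1 ≤_) (prow-0 (cartan (D (3 ℕ.+ n))) i (proj₁ d)) (proj₂ (proj₂ (proj₂ d)) i) }
  where d = dominant-D n 0

finite-check : ∀ t (v : Vec ℤ (rank t)) →
  Dec ((∀ (i : Fin (rank t)) → 1 ℕ.≤ lenℕ t (toℕ i)) ×
       (∀ (i j : Fin (rank t)) → + lenℕ t (toℕ i) * cartan t i j ≡ + lenℕ t (toℕ j) * cartan t j i) ×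
       (∀ i → + 1 ≤ lookup v i) × (∀ i → + 1 ≤ ∑rows t (lookup v) i))
finite-check t v =
  all? (λ i → 1 ℕₚ.≤? lenℕ t (toℕ i)) ×-dec
  all? (λ i → all? λ j → (+ lenℕ t (toℕ i) * cartan t i j) ℤₚ.≟ (+ lenℕ t (toℕ j) * cartan t j i)) ×-dec
  all? (λ i → + 1 ℤₚ.≤? lookup v i) ×-dec
  all? (λ i → + 1 ℤₚ.≤? ∑rows t (lookup v) i)

finite-from : ∀ t (v : Vec ℤ (rank t)) → True (finite-check t v) → FiniteType t
finite-from t v ok = record
  { len-pos = proj₁ checked ; len-cartan = proj₁ (proj₂ checked) ; dom = lookup v
  ; dom-pos = proj₁ (proj₂ (proj₂ checked)) ; dom-row = proj₂ (proj₂ (proj₂ checked)) }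
  where checked = toWitness {a? = finite-check t v} ok

-- The sum of the positive roots.
finite-E₆ : FiniteType E₆
finite-E₆ = finite-from E₆ (+ 16 ∷ + 22 ∷ + 30 ∷ + 42 ∷ + 30 ∷ + 16 ∷ []) _

finite-E₇ : FiniteType E₇
finite-E₇ = finite-from E₇ (+ 34 ∷ + 49 ∷ + 66 ∷ + 96 ∷ + 75 ∷ + 52 ∷ + 27 ∷ []) _

finite-E₈ : FiniteType E₈
finite-E₈ = finite-from E₈ (+ 92 ∷ + 136 ∷ + 182 ∷ + 270 ∷ + 220 ∷ + 168 ∷ + 114 ∷ + 58 ∷ []) _

finite-F₄ : FiniteType F₄
finite-F₄ = finite-from F₄ (+ 16 ∷ + 30 ∷ + 42 ∷ + 22 ∷ []) _

finite-G₂ : FiniteType G₂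
finite-G₂ = finite-from G₂ (+ 10 ∷ + 6 ∷ []) _

-- Obstructed types

-- For x = 0 this is (1, 2, ..., n), that is n + 1 times the last fundamental weight of A_n: all
-- rows vanish but the last, which is n + 1. Twice the first entry is 2, not a multiple of n + 1
-- when n ≥ 2. In the recursion x is the value at the virtual vertex.
ramp : ∀ n → ℕ → Fin n → ℤ
ramp (suc n) x zero    = + suc x
ramp (suc n) x (suc i) = ramp n (suc x) i

ramp-rows : ∀ n x i → + suc (suc (n ℕ.+ x)) ∣ prow (cartan (A (suc n))) (+ x) i (ramp (suc n) x)
ramp-rows zero x zero = divides (+ 1) (lemma (+ x))
  where
  lemma : ∀ x → + 2 * (+ 1 + x) + + 0 - x ≡ + 1 * (+ 2 + x)
  lemma = solve-∀
ramp-rows (suc n) x zero = divides (+ 0) (trans (prow-cong (cartan-A n) (+ x) zero (ramp (suc (suc n)) x))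
  (trans (prow-grow-zero (cartan (A (suc n))) (+ x) (ramp (suc (suc n)) x)) (lemma (+ x))))
  where
  lemma : ∀ x → + 2 * (+ 1 + x) - (+ 2 + x) - x ≡ + 0
  lemma = solve-∀
ramp-rows (suc n) x (suc i) = subst₂ _∣_ (cong (λ z → + suc (suc z)) (ℕₚ.+-suc n x))
  (sym (trans (prow-cong (cartan-A n) (+ x) (suc i) (ramp (suc (suc n)) x))
              (prow-grow-suc (cartan (A (suc n))) (+ x) i (ramp (suc (suc n)) x))))
  (ramp-rows n (suc x) i)

obstructed-A : ∀ n → Obstructed (A (2 ℕ.+ n))
obstructed-A n = + suc (suc (suc n)) , ramp (2 ℕ.+ n) 0 ,
  (λ i → subst₂ _∣_ (cong (λ z → + suc (suc (suc z))) (ℕₚ.+-identityʳ n))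
           (prow-0 (cartan (A (2 ℕ.+ n))) i (ramp (2 ℕ.+ n) 0))
           (ramp-rows (suc n) 0 i)) ,
  zero , λ d∣2 → ℕₚ.<⇒≱ (ℕ.s≤s (ℕ.s≤s (ℕ.s≤s (ℕ.z≤n {n})))) (∣⇒≤ (∣⇒∣ᵤ d∣2))

-- Four times a half-spin weight of D_n for odd n, reduced modulo 4. Doubled, the entries 1 and -1
-- at the fork are not divisible by 4.
alternating : ∀ p → Fin (3 ℕ.+ p ℕ.* 2) → ℤ
alternating zero    zero             = + 2
alternating zero    (suc zero)       = + 1
alternating zero    (suc (suc zero)) = - + 1
alternating (suc p) zero             = + 2
alternating (suc p) (suc zero)       = + 0
alternating (suc p) (suc (suc i))    = alternating p i

alternating-zero : ∀ p → alternating p zero ≡ + 2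
alternating-zero zero    = refl
alternating-zero (suc p) = refl

module _ (n : ℕ) (x : ℤ) (v : Fin (5 ℕ.+ n) → ℤ) where
  private
    M = cartan (D (3 ℕ.+ n))

  prow-D-zero : prow (cartan (D (5 ℕ.+ n))) x zero v ≡ + 2 * v zero - v (suc zero) - x
  prow-D-zero = trans (prow-cong (cartan-D (suc n)) x zero v) (prow-grow-zero (cartan (D (4 ℕ.+ n))) x v)

  prow-D-one : prow (cartan (D (5 ℕ.+ n))) x (suc zero) v ≡ + 2 * v (suc zero) - v (suc (suc zero)) - v zero
  prow-D-one = trans (prow-cong (cartan-D (suc n)) x (suc zero) v)
    (trans (prow-grow-suc (cartan (D (4 ℕ.+ n))) x zero v)
      (trans (prow-cong (cartan-D n) (v zero) zero (v ∘ suc)) (prow-grow-zero M (v zero) (v ∘ suc))))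

  prow-D-suc : ∀ i → prow (cartan (D (5 ℕ.+ n))) x (suc (suc i)) v ≡ prow M (v (suc zero)) i (λ j → v (suc (suc j)))
  prow-D-suc i = trans (prow-cong (cartan-D (suc n)) x (suc (suc i)) v)
    (trans (prow-grow-suc (cartan (D (4 ℕ.+ n))) x (suc i) v)
      (trans (prow-cong (cartan-D n) (v zero) (suc i) (v ∘ suc)) (prow-grow-suc M (v zero) i (v ∘ suc))))

alternating-rows : ∀ p i → + 4 ∣ prow (cartan (D (3 ℕ.+ p ℕ.* 2))) (+ 0) i (alternating p)
alternating-rows zero i = from-yes (all? λ i → + 4 ∣? prow (cartan (D 3)) (+ 0) i (alternating zero)) i
alternating-rows (suc p) zero = divides (+ 1) (prow-D-zero (p ℕ.* 2) (+ 0) (alternating (suc p)))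
alternating-rows (suc p) (suc zero) = divides (- + 1)
  (trans (prow-D-one (p ℕ.* 2) (+ 0) (alternating (suc p))) (cong (λ z → + 2 * + 0 - z - + 2) (alternating-zero p)))
alternating-rows (suc p) (suc (suc i)) =
  subst (+ 4 ∣_) (sym (prow-D-suc (p ℕ.* 2) (+ 0) (alternating (suc p)) i)) (alternating-rows p i)

obstructed-D : ∀ p → Obstructed (D (3 ℕ.+ p ℕ.* 2))
obstructed-D p = + 4 , alternating p ,
  (λ i → subst (+ 4 ∣_) (prow-0 (cartan (D (3 ℕ.+ p ℕ.* 2))) i (alternating p)) (alternating-rows p i)) , fork p
  where
  fork : ∀ p → ∃ λ a → ¬ + 4 ∣ + 2 * alternating p a
  fork zero    = suc zero , from-no (+ 4 ∣? + 2)
  fork (suc p) = suc (suc (proj₁ (fork p))) , proj₂ (fork p)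

-- Three times the first fundamental weight is (4, 3, 5, 6, 4, 2); `u` is its reduction modulo 3.
obstructed-E₆ : Obstructed E₆
obstructed-E₆ = + 3 , u , from-yes (all? λ i → + 3 ∣? ∑rows E₆ u i) , zero , from-no (+ 3 ∣? + 2)
  where
  u : Fin 6 → ℤ
  u = lookup (+ 1 ∷ + 0 ∷ + 2 ∷ + 0 ∷ + 1 ∷ + 2 ∷ [])

≢true⇒≡false : ∀ x → x ≢ true → x ≡ false
≢true⇒≡false true  h = contradiction refl h
≢true⇒≡false false h = refl

Adjacent⇒cartan≢0 : ∀ t {i j} → i ≢ j → Adjacent t i j → cartan t i j ≢ + 0
Adjacent⇒cartan≢0 t {i} {j} i≢j adj
  rewrite ≢⇒≡ᵇ-false {toℕ i} {toℕ j} (λ e → i≢j (toℕ-injective e)) | adj = nonzero (lenℕ t (toℕ i)) (lenℕ t (toℕ j))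
  where
  nonzero : ∀ a b → (if a ℕ.<ᵇ b then - + b else - + 1) ≢ + 0
  nonzero zero    zero    ()
  nonzero (suc a) zero    ()
  nonzero a       (suc b) with a ℕ.<ᵇ suc b
  ... | true  = λ ()
  ... | false = λ ()

-- Edges of the classical diagrams

Consecutive : ℕ → ℕ → Set
Consecutive i j = suc i ≡ j ⊎ suc j ≡ i

≡⇒≡ᵇ-true : ∀ {i j} → i ≡ j → (i ℕ.≡ᵇ j) ≡ true
≡⇒≡ᵇ-true {i} refl = ≡ᵇ-refl i

consec⇒ : ∀ i j → ((suc i ℕ.≡ᵇ j) ∨ (suc j ℕ.≡ᵇ i)) ≡ true → Consecutive i j
consec⇒ i j e = [ (λ p → inj₁ (≡ᵇ-true⇒≡ (suc i) j p)) , (λ p → inj₂ (≡ᵇ-true⇒≡ (suc j) i p)) ]′ (∨-elim (suc i ℕ.≡ᵇ j) e)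

⇒consec : ∀ {i j} → Consecutive i j → ((suc i ℕ.≡ᵇ j) ∨ (suc j ℕ.≡ᵇ i)) ≡ true
⇒consec {i} {j} (inj₁ p) = cong (_∨ (suc j ℕ.≡ᵇ i)) (≡⇒≡ᵇ-true p)
⇒consec {i} {j} (inj₂ p) = trans (consec-sym i j) (cong (_∨ (suc i ℕ.≡ᵇ j)) (≡⇒≡ᵇ-true p))

-- In `D (3 + p)` the vertices 0 to p + 1 form a chain, and p + 2 hangs on the branch point p.
data EdgeD (p : ℕ) : ℕ → ℕ → Set where
  up    : ∀ {i} → i ℕ.≤ p → EdgeD p i (suc i)
  down  : ∀ {i} → i ℕ.≤ p → EdgeD p (suc i) i
  fork↑ : EdgeD p p (2 ℕ.+ p)
  fork↓ : EdgeD p (2 ℕ.+ p) p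

≤ᵇ-true⇒≤ : ∀ i j → (i ℕ.≤ᵇ j) ≡ true → i ℕ.≤ j
≤ᵇ-true⇒≤ i j e = ℕₚ.≤ᵇ⇒≤ i j (subst T (sym e) _)

≤⇒≤ᵇ-true : ∀ {i j} → i ℕ.≤ j → (i ℕ.≤ᵇ j) ≡ true
≤⇒≤ᵇ-true {i} {j} i≤j with i ℕ.≤ᵇ j | ℕₚ.≤⇒≤ᵇ i≤j
... | true | _ = refl

edgeD⇒ : ∀ p i j → adjℕ (D (3 ℕ.+ p)) i j ≡ true → EdgeD p i j
edgeD⇒ p i j e = [ chain , [ fork₁ , fork₂ ]′ ∘ ∨-elim ((i ℕ.≡ᵇ p) ∧ (j ℕ.≡ᵇ 2 ℕ.+ p)) ]′
  (∨-elim (((suc i ℕ.≡ᵇ j) ∨ (suc j ℕ.≡ᵇ i)) ∧ ((i ℕ.≤ᵇ suc p) ∧ (j ℕ.≤ᵇ suc p))) e)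
  where
  chain : ((suc i ℕ.≡ᵇ j) ∨ (suc j ℕ.≡ᵇ i)) ∧ ((i ℕ.≤ᵇ suc p) ∧ (j ℕ.≤ᵇ suc p)) ≡ true → EdgeD p i j
  chain e = by-cases (consec⇒ i j (∧-conicalˡ _ _ e))
              (≤ᵇ-true⇒≤ i (suc p) (∧-conicalˡ _ _ bounds)) (≤ᵇ-true⇒≤ j (suc p) (∧-conicalʳ (i ℕ.≤ᵇ suc p) _ bounds))
    where
    bounds = ∧-conicalʳ ((suc i ℕ.≡ᵇ j) ∨ (suc j ℕ.≡ᵇ i)) _ e
    by-cases : Consecutive i j → i ℕ.≤ suc p → j ℕ.≤ suc p → EdgeD p i j
    by-cases (inj₁ refl) _ (ℕ.s≤s i≤p) = up i≤p
    by-cases (inj₂ refl) (ℕ.s≤s j≤p) _ = down j≤p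
  fork₁ : (i ℕ.≡ᵇ p) ∧ (j ℕ.≡ᵇ 2 ℕ.+ p) ≡ true → EdgeD p i j
  fork₁ e with ≡ᵇ-true⇒≡ i p (∧-conicalˡ _ _ e) | ≡ᵇ-true⇒≡ j (2 ℕ.+ p) (∧-conicalʳ (i ℕ.≡ᵇ p) _ e)
  ... | refl | refl = fork↑
  fork₂ : (i ℕ.≡ᵇ 2 ℕ.+ p) ∧ (j ℕ.≡ᵇ p) ≡ true → EdgeD p i j
  fork₂ e with ≡ᵇ-true⇒≡ i (2 ℕ.+ p) (∧-conicalˡ _ _ e) | ≡ᵇ-true⇒≡ j p (∧-conicalʳ (i ℕ.≡ᵇ 2 ℕ.+ p) _ e)
  ... | refl | refl = fork↓

edgeD-sym : ∀ {p i j} → EdgeD p i j → EdgeD p j i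
edgeD-sym (up i≤p)   = down i≤p
edgeD-sym (down i≤p) = up i≤p
edgeD-sym fork↑      = fork↓
edgeD-sym fork↓      = fork↑

⇒edgeD : ∀ {p i j} → EdgeD p i j → adjℕ (D (3 ℕ.+ p)) i j ≡ true
⇒edgeD {p} {i} (up i≤p)
  rewrite ≡ᵇ-refl i | ≤⇒≤ᵇ-true (ℕₚ.m≤n⇒m≤1+n i≤p) | ≤⇒≤ᵇ-true (ℕ.s≤s i≤p) = refl
⇒edgeD {p} {i} {j} (down i≤p) = trans (adj-sym-D (3 ℕ.+ p) i j) (⇒edgeD (up i≤p))
⇒edgeD {p} fork↑ rewrite ≡ᵇ-refl p =
  ∨-true (((suc p ℕ.≡ᵇ 2 ℕ.+ p) ∨ (3 ℕ.+ p ℕ.≡ᵇ p)) ∧ ((p ℕ.≤ᵇ suc p) ∧ (2 ℕ.+ p ℕ.≤ᵇ suc p)))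
  where
  ∨-true : ∀ x → x ∨ true ≡ true
  ∨-true true  = refl
  ∨-true false = refl
⇒edgeD {p} {i} {j} fork↓ = trans (adj-sym-D (3 ℕ.+ p) i j) (⇒edgeD {p} {j} {i} fork↑)

-- Diagram automorphisms

module Automorphism (t : CartanType) (τ : Fin (rank t) → Fin (rank t))
                    (pres : ∀ i j → cartan t (τ i) (τ j) ≡ cartan t i j) where

  τ-injective : ∀ {i j} → τ i ≡ τ j → i ≡ j
  τ-injective {i} {j} e =
    cartan≡2⇒≡ t (trans (sym (pres i j)) (trans (cong (cartan t (τ i)) (sym e)) (cartan-diag t (τ i))))

  τ-adjacent : ∀ {i j} → i ≢ j → Adjacent t i j → Adjacent t (τ i) (τ j)
  τ-adjacent {i} {j} i≢j adj = cartan≢0⇒Adjacent t (i≢j ∘ τ-injective)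
    (λ z → Adjacent⇒cartan≢0 t i≢j adj (trans (sym (pres i j)) z))

  -- Fixed vertices propagate down the chain below q. If v + 1 is fixed, τ v is a neighbour of it:
  -- either the one below, which is v, or a vertex above v, which is already fixed, so that
  -- injectivity gives τ v = v.
  walk : ∀ q → q ℕ.< rank t →
         (∀ x y → toℕ y ℕ.≤ q → toℕ x ℕ.< toℕ y → Adjacent t y x → suc (toℕ x) ≡ toℕ y) →
         (∀ x y → toℕ y ℕ.≤ q → suc (toℕ x) ≡ toℕ y → Adjacent t y x) →
         (∀ v → q ℕ.≤ toℕ v → τ v ≡ v) → ∀ v → τ v ≡ v
  walk q q<r chain edge end v = go q v (ℕₚ.m≤n+m q (toℕ v))
    where
    go : ∀ k v → q ℕ.≤ toℕ v ℕ.+ k → τ v ≡ v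
    go zero    v q≤ = end v (subst (q ℕ.≤_) (ℕₚ.+-identityʳ (toℕ v)) q≤)
    go (suc k) v q≤ = by-cases (q ℕₚ.≤? toℕ v)
      where
      by-cases : Dec (q ℕ.≤ toℕ v) → τ v ≡ v
      by-cases (yes q≤v) = end v q≤v
      by-cases (no q≰v)  = compare (toℕ (τ v) ℕₚ.<? suc (toℕ v))
        where
        v<q : toℕ v ℕ.< q
        v<q = ℕₚ.≰⇒> q≰v
        y : Fin (rank t)
        y = fromℕ< (ℕₚ.≤-<-trans v<q q<r)
        y≡ : toℕ y ≡ suc (toℕ v)
        y≡ = toℕ-fromℕ< (ℕₚ.≤-<-trans v<q q<r)
        y≤q : toℕ y ℕ.≤ q
        y≤q = subst (ℕ._≤ q) (sym y≡) v<q
        next : ∀ x → suc (toℕ v) ℕ.≤ toℕ x → q ℕ.≤ toℕ x ℕ.+ k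
        next x v<x = ℕₚ.≤-trans (subst (q ℕ.≤_) (ℕₚ.+-suc (toℕ v) k) q≤) (ℕₚ.+-monoˡ-≤ k v<x)
        y-fixed : τ y ≡ y
        y-fixed = go k y (next y (ℕₚ.≤-reflexive (sym y≡)))
        adj : Adjacent t y (τ v)
        adj = subst (λ z → Adjacent t z (τ v)) y-fixed
          (τ-adjacent (λ y≡v → ℕₚ.1+n≢n (trans (sym y≡) (cong toℕ y≡v))) (edge v y y≤q (sym y≡)))
        compare : Dec (toℕ (τ v) ℕ.< suc (toℕ v)) → τ v ≡ v
        compare (yes τv<) = toℕ-injective (ℕₚ.suc-injective
          (trans (chain (τ v) y y≤q (subst (toℕ (τ v) ℕ.<_) (sym y≡) τv<) adj) y≡))
        compare (no τv≮) = τ-injective (go k (τ v) (next (τ v) (ℕₚ.≮⇒≥ τv≮)))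

last₂ : ∀ n → Fin 2 → Fin (2 ℕ.+ n)
last₂ zero    i = i
last₂ (suc n) i = suc (last₂ n i)

toℕ-last₂ : ∀ n → toℕ (last₂ n (suc zero)) ≡ suc n
toℕ-last₂ zero    = refl
toℕ-last₂ (suc n) = cong suc (toℕ-last₂ n)

consec-chain : ∀ {n} (x y : Fin n) → toℕ x ℕ.< toℕ y →
               ((suc (toℕ y) ℕ.≡ᵇ toℕ x) ∨ (suc (toℕ x) ℕ.≡ᵇ toℕ y)) ≡ true → suc (toℕ x) ≡ toℕ y
consec-chain x y x<y e =
  [ (λ p → contradiction x<y (ℕₚ.≤⇒≯ (ℕₚ.≤-trans (ℕₚ.n≤1+n _) (ℕₚ.≤-reflexive p)))) , id ]′
    (consec⇒ (toℕ y) (toℕ x) e)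

-- The entry -2 singles out the end with the double bond, so automorphisms fix that vertex and
-- `walk` starts there. In type C the entry is transposed.
cartan-B≡-2 : ∀ n i j → cartan (B (2 ℕ.+ n)) i j ≡ - + 2 → toℕ i ≡ suc n
cartan-B≡-2 n i j e
  with toℕ i ℕ.≡ᵇ toℕ j | (suc (toℕ i) ℕ.≡ᵇ toℕ j) ∨ (suc (toℕ j) ℕ.≡ᵇ toℕ i)
     | toℕ i ℕ.≡ᵇ suc n in i≡ | toℕ j ℕ.≡ᵇ suc n
... | false | true | true  | _     = ≡ᵇ-true⇒≡ (toℕ i) (suc n) i≡
cartan-B≡-2 n i j () | false | true | false | true
cartan-B≡-2 n i j () | false | true | false | false
cartan-B≡-2 n i j () | true  | _ | _ | _
cartan-B≡-2 n i j () | false | false | _ | _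

cartan-C≡-2 : ∀ n i j → cartan (C (2 ℕ.+ n)) i j ≡ - + 2 → toℕ j ≡ suc n
cartan-C≡-2 n i j e
  with toℕ i ℕ.≡ᵇ toℕ j | (suc (toℕ i) ℕ.≡ᵇ toℕ j) ∨ (suc (toℕ j) ℕ.≡ᵇ toℕ i)
     | toℕ i ℕ.≡ᵇ suc n | toℕ j ℕ.≡ᵇ suc n in j≡
... | false | true | _ | true  = ≡ᵇ-true⇒≡ (toℕ j) (suc n) j≡
cartan-C≡-2 n i j () | false | true | true  | false
cartan-C≡-2 n i j () | false | true | false | false
cartan-C≡-2 n i j () | true  | _ | _ | _
cartan-C≡-2 n i j () | false | false | _ | _

last-unique : ∀ {n} (v w : Fin (2 ℕ.+ n)) → suc n ℕ.≤ toℕ v → toℕ w ≡ suc n → v ≡ w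
last-unique v w n≤v w≡ = toℕ-injective (trans (ℕₚ.≤-antisym (ℕ.s≤s⁻¹ (toℕ<n v)) n≤v) (sym w≡))

rigid-B : ∀ n → Rigid (B (2 ℕ.+ n))
rigid-B n τ pres _ = walk (suc n) ℕₚ.≤-refl
  (λ x y _ x<y → consec-chain x y x<y) (λ x y _ e → ⇒consec (inj₂ e)) end
  where
  open Automorphism (B (2 ℕ.+ n)) τ pres
  bond : ∀ n → cartan (B (2 ℕ.+ n)) (last₂ n (suc zero)) (last₂ n zero) ≡ - + 2
  bond zero    = refl
  bond (suc n) = bond n
  end : ∀ v → suc n ℕ.≤ toℕ v → τ v ≡ v
  end v n≤v with last-unique v (last₂ n (suc zero)) n≤v (toℕ-last₂ n)
  ... | refl = sym (last-unique v (τ v) n≤v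
    (cartan-B≡-2 n (τ (last₂ n (suc zero))) (τ (last₂ n zero)) (trans (pres (last₂ n (suc zero)) (last₂ n zero)) (bond n))))

rigid-C : ∀ n → Rigid (C (2 ℕ.+ n))
rigid-C n τ pres _ = walk (suc n) ℕₚ.≤-refl
  (λ x y _ x<y → consec-chain x y x<y) (λ x y _ e → ⇒consec (inj₂ e)) end
  where
  open Automorphism (C (2 ℕ.+ n)) τ pres
  bond : ∀ n → cartan (C (2 ℕ.+ n)) (last₂ n zero) (last₂ n (suc zero)) ≡ - + 2
  bond zero    = refl
  bond (suc n) = bond n
  end : ∀ v → suc n ℕ.≤ toℕ v → τ v ≡ v
  end v n≤v with last-unique v (last₂ n (suc zero)) n≤v (toℕ-last₂ n)
  ... | refl = sym (last-unique v (τ v) n≤v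
    (cartan-C≡-2 n (τ (last₂ n zero)) (τ (last₂ n (suc zero))) (trans (pres (last₂ n zero) (last₂ n (suc zero))) (bond n))))

last₄ : ∀ q → Fin 4 → Fin (4 ℕ.+ q ℕ.* 2)
last₄ zero    i = i
last₄ (suc q) i = suc (suc (last₄ q i))

toℕ-last₄ : ∀ q i → toℕ (last₄ q i) ≡ toℕ i ℕ.+ q ℕ.* 2
toℕ-last₄ zero    i = sym (ℕₚ.+-identityʳ (toℕ i))
toℕ-last₄ (suc q) i = trans (cong (2 ℕ.+_) (toℕ-last₄ q i))
  (sym (trans (ℕₚ.+-suc (toℕ i) (suc (q ℕ.* 2))) (cong suc (ℕₚ.+-suc (toℕ i) (q ℕ.* 2)))))

-- Twice a half-spin weight, modulo 2; the Boolean chooses the half-spin weight.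
parity : Bool → ∀ q → Fin (4 ℕ.+ q ℕ.* 2) → ℤ
parity b zero    zero                   = + 1
parity b zero    (suc zero)             = + 0
parity b zero    (suc (suc zero))       = if b then + 1 else + 0
parity b zero    (suc (suc (suc zero))) = if b then + 0 else + 1
parity b (suc q) zero                   = + 1
parity b (suc q) (suc zero)             = + 0
parity b (suc q) (suc (suc i))          = parity b q i

parity-zero : ∀ b q → parity b q zero ≡ + 1
parity-zero b zero    = refl
parity-zero b (suc q) = refl

parity-last₄ : ∀ b q i → parity b q (last₄ q i) ≡ parity b zero i
parity-last₄ b zero    i = refl
parity-last₄ b (suc q) i = parity-last₄ b q i

parity-rows : ∀ b q i → + 2 ∣ prow (cartan (D (4 ℕ.+ q ℕ.* 2))) (+ 0) i (parity b q)
parity-rows true  zero i = from-yes (all? λ i → + 2 ∣? prow (cartan (D 4)) (+ 0) i (parity true zero)) i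
parity-rows false zero i = from-yes (all? λ i → + 2 ∣? prow (cartan (D 4)) (+ 0) i (parity false zero)) i
parity-rows b (suc q) zero = divides (+ 1) (prow-D-zero (suc (q ℕ.* 2)) (+ 0) (parity b (suc q)))
parity-rows b (suc q) (suc zero) = divides (- + 1)
  (trans (prow-D-one (suc (q ℕ.* 2)) (+ 0) (parity b (suc q))) (cong (λ z → + 2 * + 0 - z - + 1) (parity-zero b q)))
parity-rows b (suc q) (suc (suc i)) =
  subst (+ 2 ∣_) (sym (prow-D-suc (suc (q ℕ.* 2)) (+ 0) (parity b (suc q)) i)) (parity-rows b q i)

-- A vertex other than p has at most two neighbours, so an automorphism cannot move a branch point
-- with three.
edgeD-two : ∀ {p} j → j ≢ p → ∃ λ d → ∀ {x} → EdgeD p j x → x ≡ suc j ⊎ x ≡ d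
edgeD-two {p} j j≢p with j ℕₚ.≟ 2 ℕ.+ p
... | yes refl = p , λ { (up i≤p) → inj₁ refl ; (down i≤p) → contradiction i≤p (ℕₚ.<⇒≱ ℕₚ.≤-refl)
                       ; fork↓ → inj₂ refl }
-- At j = 0 the value of `pred` is a mere default: no `down` edge starts there.
... | no j≢2+p = ℕ.pred j , λ { (up i≤p) → inj₁ refl ; (down i≤p) → inj₂ refl
                              ; fork↑ → contradiction refl j≢p ; fork↓ → contradiction refl j≢2+p }

pigeonhole : ∀ {a b x y z : ℕ} → x ≡ a ⊎ x ≡ b → y ≡ a ⊎ y ≡ b → z ≡ a ⊎ z ≡ b → x ≡ y ⊎ y ≡ z ⊎ x ≡ z
pigeonhole (inj₁ p) (inj₁ q) _        = inj₁ (trans p (sym q))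
pigeonhole (inj₂ p) (inj₂ q) _        = inj₁ (trans p (sym q))
pigeonhole (inj₁ p) (inj₂ q) (inj₁ s) = inj₂ (inj₂ (trans p (sym s)))
pigeonhole (inj₁ p) (inj₂ q) (inj₂ s) = inj₂ (inj₁ (trans q (sym s)))
pigeonhole (inj₂ p) (inj₁ q) (inj₁ s) = inj₂ (inj₁ (trans q (sym s)))
pigeonhole (inj₂ p) (inj₁ q) (inj₂ s) = inj₂ (inj₂ (trans p (sym s)))

-- The trivalent vertex is fixed; its neighbours are told apart by the parities of the half-spin weights.
rigid-D : ∀ q → Rigid (D (4 ℕ.+ q ℕ.* 2))
rigid-D q τ pres mod2 = walk p (ℕₚ.m≤n+m (suc p) 2) chain edge end
  where
  open Automorphism (D (4 ℕ.+ q ℕ.* 2)) τ pres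
  p = suc (q ℕ.* 2)
  n = 4 ℕ.+ q ℕ.* 2
  w T′ f₁ f₂ : Fin n
  w  = last₄ q zero
  T′ = last₄ q (suc zero)
  f₁ = last₄ q (suc (suc zero))
  f₂ = last₄ q (suc (suc (suc zero)))
  toℕT : toℕ T′ ≡ p
  toℕT = toℕ-last₄ q (suc zero)
  at : ∀ {i} k → toℕ i ≡ toℕ k ℕ.+ q ℕ.* 2 → i ≡ last₄ q k
  at k e = toℕ-injective (trans e (sym (toℕ-last₄ q k)))
  edge-at : ∀ {i j} → Adjacent (D n) i j → EdgeD p (toℕ i) (toℕ j)
  edge-at {i} {j} = edgeD⇒ p (toℕ i) (toℕ j)
  adj-at : ∀ {i j} k l → toℕ i ≡ k → toℕ j ≡ l → EdgeD p k l → Adjacent (D n) i j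
  adj-at k l refl refl = ⇒edgeD
  distinct : ∀ k l → toℕ k ≢ toℕ l → last₄ q k ≢ last₄ q l
  distinct k l k≢l e = k≢l (ℕₚ.+-cancelʳ-≡ (q ℕ.* 2) (toℕ k) (toℕ l)
    (trans (sym (toℕ-last₄ q k)) (trans (cong toℕ e) (toℕ-last₄ q l))))
  T-w : Adjacent (D n) T′ w
  T-w = adj-at _ _ toℕT (toℕ-last₄ q zero) (down (ℕₚ.n≤1+n _))
  T-f₁ : Adjacent (D n) T′ f₁
  T-f₁ = adj-at _ _ toℕT (toℕ-last₄ q _) (up ℕₚ.≤-refl)
  T-f₂ : Adjacent (D n) T′ f₂
  T-f₂ = adj-at _ _ toℕT (toℕ-last₄ q _) fork↑
  image : ∀ k → suc zero ≢ k → Adjacent (D n) T′ (last₄ q k) → EdgeD p (toℕ (τ T′)) (toℕ (τ (last₄ q k)))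
  image k 1≢k adj = edge-at (τ-adjacent (distinct (suc zero) k (λ e → 1≢k (toℕ-injective e))) adj)
  collide : ∀ k l → toℕ k ≢ toℕ l → toℕ (τ (last₄ q k)) ≢ toℕ (τ (last₄ q l))
  collide k l k≢l e = distinct k l k≢l (τ-injective (toℕ-injective e))
  T-fixed : τ T′ ≡ T′
  T-fixed = toℕ-injective (trans (decidable-stable (toℕ (τ T′) ℕₚ.≟ p) two) (sym toℕT))
    where
    two : ¬ (toℕ (τ T′) ≢ p)
    two ≢p =
      let d , nbr = edgeD-two (toℕ (τ T′)) ≢p
      in [ collide zero (suc (suc zero)) (λ ()) ,
         [ collide (suc (suc zero)) (suc (suc (suc zero))) (λ ()) ,
           collide zero (suc (suc (suc zero))) (λ ()) ]′ ]′
           (pigeonhole (nbr (image zero (λ ()) T-w)) (nbr (image (suc (suc zero)) (λ ()) T-f₁))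
                       (nbr (image (suc (suc (suc zero))) (λ ()) T-f₂)))
  near-T : ∀ k → suc zero ≢ k → Adjacent (D n) T′ (last₄ q k) →
           τ (last₄ q k) ≡ w ⊎ τ (last₄ q k) ≡ f₁ ⊎ τ (last₄ q k) ≡ f₂
  near-T k 1≢k adj = by-edge
    (subst (λ z → EdgeD p z (toℕ (τ (last₄ q k)))) (trans (cong toℕ T-fixed) toℕT) (image k 1≢k adj)) refl refl
    where
    by-edge : ∀ {i j} → EdgeD p i j → i ≡ p → ∀ {x} → toℕ x ≡ j → x ≡ w ⊎ x ≡ f₁ ⊎ x ≡ f₂
    by-edge (up _)   refl e = inj₂ (inj₁ (at (suc (suc zero)) e))
    by-edge (down _) refl e = inj₁ (at zero e)
    by-edge fork↑    _    e = inj₂ (inj₂ (at (suc (suc (suc zero))) e))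
    by-edge fork↓    e    _ = contradiction (sym e) (ℕₚ.m≢1+n+m p {1})
  chain : ∀ x y → toℕ y ℕ.≤ p → toℕ x ℕ.< toℕ y → Adjacent (D n) y x → suc (toℕ x) ≡ toℕ y
  chain x y y≤p x<y adj = by-edge (edge-at adj) y≤p x<y
    where
    by-edge : ∀ {i j} → EdgeD p i j → i ℕ.≤ p → j ℕ.< i → suc j ≡ i
    by-edge (up _)   _ j<i = contradiction j<i (ℕₚ.<⇒≯ ℕₚ.≤-refl)
    by-edge (down _) _ _   = refl
    by-edge fork↑    _ j<i = contradiction j<i (ℕₚ.<⇒≯ (ℕₚ.m≤n+m (suc p) 1))
    by-edge fork↓ 2+p≤p _  = contradiction 2+p≤p (ℕₚ.<⇒≱ (ℕₚ.m≤n+m (suc p) 1))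
  edge : ∀ x y → toℕ y ℕ.≤ p → suc (toℕ x) ≡ toℕ y → Adjacent (D n) y x
  edge x y y≤p e = adj-at _ _ (sym e) refl (down (ℕₚ.≤-trans (ℕₚ.n≤1+n _) (subst (ℕ._≤ p) (sym e) y≤p)))
  odd : ¬ (+ 2 ∣ + 1)
  odd = from-no (+ 2 ∣? + 1)
  rows : ∀ b i → + 2 ∣ ∑rows (D n) (parity b q) i
  rows b i = subst (+ 2 ∣_) (prow-0 (cartan (D n)) i (parity b q)) (parity-rows b q i)
  separated : ∀ b k l → parity b zero k ≡ + 0 → parity b zero l ≡ + 1 → τ (last₄ q k) ≢ last₄ q l
  separated b k l k≡0 l≡1 e = odd (subst (+ 2 ∣_)
    (cong₂ _-_ (trans (cong (parity b q) e) (trans (parity-last₄ b q l) l≡1)) (trans (parity-last₄ b q k) k≡0))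
    (mod2 (parity b q) (rows b) (last₄ q k)))
  -- `parity false` is 0 at f₁ and 1 at w and f₂; `parity true` is 0 at f₂ and 1 at w and f₁. The
  -- vertex w is left to `walk`.
  f₁-fixed : τ f₁ ≡ f₁
  f₁-fixed = [ (λ e → contradiction e (separated false (suc (suc zero)) zero refl refl)) ,
    [ id , (λ e → contradiction e (separated false (suc (suc zero)) (suc (suc (suc zero))) refl refl)) ]′ ]′
    (near-T (suc (suc zero)) (λ ()) T-f₁)
  f₂-fixed : τ f₂ ≡ f₂
  f₂-fixed = [ (λ e → contradiction e (separated true (suc (suc (suc zero))) zero refl refl)) ,
    [ (λ e → contradiction e (separated true (suc (suc (suc zero))) (suc (suc zero)) refl refl)) , id ]′ ]′
    (near-T (suc (suc (suc zero))) (λ ()) T-f₂)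
  fixed : ∀ {v} x → toℕ v ≡ toℕ x → τ x ≡ x → τ v ≡ v
  fixed {v} x e τx = trans (cong τ v≡x) (trans τx (sym v≡x))
    where
    v≡x : v ≡ x
    v≡x = toℕ-injective e
  end : ∀ v → p ℕ.≤ toℕ v → τ v ≡ v
  end v p≤v = by-excess (toℕ v ℕ.∸ p) (ℕₚ.m+[n∸m]≡n p≤v) (toℕ<n v)
    where
    by-excess : ∀ k → p ℕ.+ k ≡ toℕ v → toℕ v ℕ.< 3 ℕ.+ p → τ v ≡ v
    by-excess 0 e _ = fixed T′ (trans (sym e) (trans (ℕₚ.+-comm p 0) (sym toℕT))) T-fixed
    by-excess 1 e _ = fixed f₁ (trans (sym e) (trans (ℕₚ.+-comm p 1) (sym (toℕ-last₄ q _)))) f₁-fixed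
    by-excess 2 e _ = fixed f₂ (trans (sym e) (trans (ℕₚ.+-comm p 2) (sym (toℕ-last₄ q _)))) f₂-fixed
    by-excess (suc (suc (suc k))) e v< = contradiction v<
      (ℕₚ.≤⇒≯ (subst (3 ℕ.+ p ℕ.≤_) (trans (ℕₚ.+-comm (3 ℕ.+ k) p) e) (ℕₚ.+-monoʳ-≤ 3 (ℕₚ.m≤n+m p k))))

-- Exhaustive search over the diagram automorphisms of the exceptional types

module AutomorphismSearch (t : CartanType) where

  Consistent : List (Fin (rank t) × Fin (rank t)) → Fin (rank t) → Fin (rank t) → Set
  Consistent asg v x = All (λ (u , y) → cartan t y x ≡ cartan t u v) asg

  -- Backtracking instead of a list of all maps: an image is followed up only if its Cartan entries
  -- with the earlier images are right.
  AllExtensionsIdentical : List (Fin (rank t) × Fin (rank t)) → List (Fin (rank t)) → Set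
  AllExtensionsIdentical asg []       = All (λ (v , x) → x ≡ v) asg
  AllExtensionsIdentical asg (v ∷ vs) =
    ∀ x → Consistent asg v x → AllExtensionsIdentical ((v , x) ∷ asg) vs

  search : ∀ asg vs → Dec (AllExtensionsIdentical asg vs)
  search asg []       = Allₗ.all? (λ (v , x) → x ≟ v) asg
  search asg (v ∷ vs) = all? λ x →
    Allₗ.all? (λ (u , y) → cartan t y x ℤₚ.≟ cartan t u v) asg →-dec search ((v , x) ∷ asg) vs

  module _ (τ : Fin (rank t) → Fin (rank t)) (pres : ∀ i j → cartan t (τ i) (τ j) ≡ cartan t i j) where

    sound : ∀ asg vs → AllExtensionsIdentical asg vs → All (λ (v , x) → τ v ≡ x) asg →
            All (λ (v , x) → τ v ≡ v) asg × All (λ v → τ v ≡ v) vs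
    sound asg []       found graph = Allₗ.zipWith (λ (e , e′) → trans e′ e) (found , graph) , []
    sound asg (v ∷ vs) found graph
      with sound _ vs (found (τ v) (Allₗ.map (λ { {u , _} refl → pres u v }) graph)) (refl ∷ graph)
    ... | τv ∷ fixed , fixed′ = fixed , τv ∷ fixed′

  rigid-search : True (search [] (allFin (rank t))) → Rigid t
  rigid-search ok τ pres _ = Allₚ.tabulate⁻ (proj₂ (sound τ pres [] (allFin (rank t)) (toWitness ok) []))

rigid-E₇ : Rigid E₇
rigid-E₇ = AutomorphismSearch.rigid-search E₇ _

rigid-E₈ : Rigid E₈
rigid-E₈ = AutomorphismSearch.rigid-search E₈ _

rigid-F₄ : Rigid F₄
rigid-F₄ = AutomorphismSearch.rigid-search F₄ _

rigid-G₂ : Rigid G₂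
rigid-G₂ = AutomorphismSearch.rigid-search G₂ _

-- Exceptional diagrams: evaluation over all subsets.

allSubsets? : ∀ {n} {P : Subset n → Set} → (∀ I → Dec (P I)) → Dec (∀ I → P I)
allSubsets? {zero}  P? = map′ (λ p → λ { [] → p }) (λ p → p []) (P? [])
allSubsets? {suc n} P? = map′ (λ (p , q) → λ { (true ∷ I) → p I ; (false ∷ I) → q I })
  (λ p → (λ I → p (true ∷ I)) , λ I → p (false ∷ I))
  (allSubsets? (λ I → P? (true ∷ I)) ×-dec allSubsets? (λ I → P? (false ∷ I)))

module SubsetSearch (t : CartanType) (fin : FiniteType t) where

  Embedding : CartanType → Set
  Embedding t′ = Fin (rank t′) → Fin (rank t)

  ObstructedEmbedding : Set
  ObstructedEmbedding = Σ CartanType λ t′ → Obstructed t′ × Embedding t′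

  ClassifiedEmbedding : Set
  ClassifiedEmbedding = Σ CartanType λ t′ → Σ (Embedding t′) λ f →
    ∀ I → (∀ i → I≥2 t I (f i)) → OfType t′ t (I≥2 t I) → Classified t I

  -- All intervals with at least two vertices of a path, as candidates for components of type A;
  -- `inits` supplies the possible ends for each start.
  subchains : List (Fin (rank t)) → List ObstructedEmbedding
  subchains (x ∷ y ∷ ys) =
    List.map (λ zs → A (2 ℕ.+ length zs) , obstructed-A (length zs) , List.lookup (x ∷ y ∷ zs)) (List.inits ys)
    ++ subchains (y ∷ ys)
  subchains _ = []

  Preserves : ∀ t′ → Embedding t′ → Set
  Preserves t′ f = ∀ i j → cartan t′ i j ≡ cartan t (f i) (f j)

  preserves? : ∀ t′ f → Dec (Preserves t′ f)
  preserves? t′ f = all? λ i → all? λ j → cartan t′ i j ℤₚ.≟ cartan t (f i) (f j)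

  module _ (I : Subset (rank t)) where

    IsComponent : ObstructedEmbedding → Set
    IsComponent (t′ , _ , f) =
      (∀ k → f k ∈ I) ×
      (∀ v → v ∈ I → (∃ λ k → f k ≡ v) ⊎ (∀ k → cartan t v (f k) ≡ + 0)) ×
      Preserves t′ f

    isComponent? : ∀ K → Dec (IsComponent K)
    isComponent? (t′ , _ , f) =
      all? (λ k → f k ∈? I) ×-dec
      all? (λ v → (v ∈? I) →-dec (any? (λ k → f k ≟ v) ⊎-dec all? λ k → cartan t v (f k) ℤₚ.≟ + 0)) ×-dec
      preserves? t′ f

    IsImage : ClassifiedEmbedding → Set
    IsImage (t′ , f , _) =
      (∀ v → (I≥2 t I v → ∃ λ i → f i ≡ v) × ((∃ λ i → f i ≡ v) → I≥2 t I v)) × Preserves t′ f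

    isImage? : ∀ K → Dec (IsImage K)
    isImage? (t′ , f , _) =
      all? (λ v → (I≥2? t I v →-dec any? (λ i → f i ≟ v)) ×-dec (any? (λ i → f i ≟ v) →-dec I≥2? t I v))
      ×-dec preserves? t′ f

    obstructed : ∀ Ks → Any IsComponent Ks → ¬ OppositionTrivial t I
    obstructed ((t′ , obs , f) ∷ _) (here (inside , closed , pres)) =
      Push.obstruction t fin I t′ (record { embed = f ; inside = inside ; pres = pres ; closed = closed }) obs
    obstructed (_ ∷ Ks) (there K) = obstructed Ks K

    classified : ∀ Ks → Any IsImage Ks → Classified t I
    classified ((t′ , f , classify) ∷ _) (here (image , pres)) =
      classify I (λ i → proj₂ (image (f i)) (i , refl)) (f , injective , image , pres)
      where
      injective : ∀ {i j} → f i ≡ f j → i ≡ j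
      injective {i} {j} e = cartan≡2⇒≡ t′ (trans (pres i j)
        (trans (cong (cartan t (f i)) (sym e)) (cartan-diag t (f i))))
    classified (_ ∷ Ks) (there K) = classified Ks K

  module _ (bad : List ObstructedEmbedding) (good : List ClassifiedEmbedding) where

    -- Each alternative is exploited by a general argument; evaluation only confirms that the two
    -- lists cover every subset.
    Outcome : Subset (rank t) → Set
    Outcome I = Any (IsComponent I) bad ⊎ Any (IsImage I) good ⊎ (∀ v → ¬ I≥2 t I v)

    outcome? : ∀ I → Dec (Outcome I)
    outcome? I = Anyₗ.any? (isComponent? I) bad ⊎-dec Anyₗ.any? (isImage? I) good ⊎-dec all? (λ v → ¬? (I≥2? t I v))

    classify-by-search : True (allSubsets? outcome?) → ∀ I → ∃ (I≥2 t I) → OppositionTrivial t I → Classified t I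
    classify-by-search ok I (v , v∈I≥2) opp = by-outcome (toWitness {a? = allSubsets? outcome?} ok I)
      where
      by-outcome : Outcome I → Classified t I
      by-outcome (inj₁ K)        = contradiction opp (obstructed I bad K)
      by-outcome (inj₂ (inj₁ K)) = classified I good K
      by-outcome (inj₂ (inj₂ none)) = contradiction v∈I≥2 (none v)

trivial⇒classified-G₂ : ∀ I → ∃ (I≥2 G₂ I) → OppositionTrivial G₂ I → Classified G₂ I
trivial⇒classified-G₂ = classify-by-search [] ((G₂ , id , λ I all _ → case2G all) ∷ []) _
  where open SubsetSearch G₂ finite-G₂

trivial⇒classified-F₄ : ∀ I → ∃ (I≥2 F₄ I) → OppositionTrivial F₄ I → Classified F₄ I
trivial⇒classified-F₄ = classify-by-search
  -- The middle bond is double, so a component of type A with two vertices is the long pair or the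
  -- short pair.
  (subchains (# 0 ∷ # 1 ∷ []) ++ subchains (# 2 ∷ # 3 ∷ []))
  ( (B 2 , lookup (# 1 ∷ # 2 ∷ [])       , λ I _ K → case4 (inj₁ K))
  ∷ (B 3 , lookup (# 0 ∷ # 1 ∷ # 2 ∷ []) , λ I _ K → case4 (inj₂ (inj₁ K)))
  ∷ (C 3 , lookup (# 3 ∷ # 2 ∷ # 1 ∷ []) , λ I _ K → case4 (inj₂ (inj₂ (inj₁ K))))
  ∷ (F₄  , id                            , λ I _ K → case4 (inj₂ (inj₂ (inj₂ K))))
  ∷ []) _
  where open SubsetSearch F₄ finite-F₄

trivial⇒classified-E₆ : ∀ I → ∃ (I≥2 E₆ I) → OppositionTrivial E₆ I → Classified E₆ I
trivial⇒classified-E₆ = classify-by-search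
  -- The three paths join the leaves 0, 1 and 5 in pairs; every connected subdiagram of type A is an
  -- interval of one of them.
  (subchains (# 0 ∷ # 2 ∷ # 3 ∷ # 4 ∷ # 5 ∷ []) ++ subchains (# 1 ∷ # 3 ∷ # 4 ∷ # 5 ∷ []) ++
   subchains (# 0 ∷ # 2 ∷ # 3 ∷ # 1 ∷ []) ++
   (D 5 , obstructed-D 1 , lookup (# 5 ∷ # 4 ∷ # 3 ∷ # 2 ∷ # 1 ∷ [])) ∷
   (D 5 , obstructed-D 1 , lookup (# 0 ∷ # 2 ∷ # 3 ∷ # 4 ∷ # 1 ∷ [])) ∷
   (E₆ , obstructed-E₆ , id) ∷ [])
  ((D 4 , lookup (# 2 ∷ # 3 ∷ # 4 ∷ # 1 ∷ []) , λ I _ K → case5 K) ∷ []) _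
  where open SubsetSearch E₆ finite-E₆

trivial⇒classified-E₇ : ∀ I → ∃ (I≥2 E₇ I) → OppositionTrivial E₇ I → Classified E₇ I
trivial⇒classified-E₇ = classify-by-search
  (subchains (# 0 ∷ # 2 ∷ # 3 ∷ # 4 ∷ # 5 ∷ # 6 ∷ []) ++ subchains (# 1 ∷ # 3 ∷ # 4 ∷ # 5 ∷ # 6 ∷ []) ++
   subchains (# 0 ∷ # 2 ∷ # 3 ∷ # 1 ∷ []) ++
   (D 5 , obstructed-D 1 , lookup (# 5 ∷ # 4 ∷ # 3 ∷ # 2 ∷ # 1 ∷ [])) ∷
   (D 5 , obstructed-D 1 , lookup (# 0 ∷ # 2 ∷ # 3 ∷ # 4 ∷ # 1 ∷ [])) ∷
   (E₆ , obstructed-E₆ , lookup (# 0 ∷ # 1 ∷ # 2 ∷ # 3 ∷ # 4 ∷ # 5 ∷ [])) ∷ [])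
  ( (D 4 , lookup (# 2 ∷ # 3 ∷ # 4 ∷ # 1 ∷ [])             , λ I _ K → case6 (inj₁ K))
  ∷ (D 6 , lookup (# 6 ∷ # 5 ∷ # 4 ∷ # 3 ∷ # 2 ∷ # 1 ∷ []) , λ I _ K → case6 (inj₂ (inj₁ K)))
  ∷ (E₇  , id                                              , λ I _ K → case6 (inj₂ (inj₂ K)))
  ∷ []) _
  where open SubsetSearch E₇ finite-E₇

trivial⇒classified-E₈ : ∀ I → ∃ (I≥2 E₈ I) → OppositionTrivial E₈ I → Classified E₈ I
trivial⇒classified-E₈ = classify-by-search
  (subchains (# 0 ∷ # 2 ∷ # 3 ∷ # 4 ∷ # 5 ∷ # 6 ∷ # 7 ∷ []) ++ subchains (# 1 ∷ # 3 ∷ # 4 ∷ # 5 ∷ # 6 ∷ # 7 ∷ []) ++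
   subchains (# 0 ∷ # 2 ∷ # 3 ∷ # 1 ∷ []) ++
   (D 5 , obstructed-D 1 , lookup (# 5 ∷ # 4 ∷ # 3 ∷ # 2 ∷ # 1 ∷ [])) ∷
   (D 5 , obstructed-D 1 , lookup (# 0 ∷ # 2 ∷ # 3 ∷ # 4 ∷ # 1 ∷ [])) ∷
   (D 7 , obstructed-D 2 , lookup (# 7 ∷ # 6 ∷ # 5 ∷ # 4 ∷ # 3 ∷ # 2 ∷ # 1 ∷ [])) ∷
   (E₆ , obstructed-E₆ , lookup (# 0 ∷ # 1 ∷ # 2 ∷ # 3 ∷ # 4 ∷ # 5 ∷ [])) ∷ [])
  ( (D 4 , lookup (# 2 ∷ # 3 ∷ # 4 ∷ # 1 ∷ [])                   , λ I _ K → case7 (inj₁ K))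
  ∷ (D 6 , lookup (# 6 ∷ # 5 ∷ # 4 ∷ # 3 ∷ # 2 ∷ # 1 ∷ [])       , λ I _ K → case7 (inj₂ (inj₁ K)))
  ∷ (E₇  , lookup (# 0 ∷ # 1 ∷ # 2 ∷ # 3 ∷ # 4 ∷ # 5 ∷ # 6 ∷ []) , λ I _ K → case7 (inj₂ (inj₂ (inj₁ K))))
  ∷ (E₈  , id                                                    , λ I _ K → case7 (inj₂ (inj₂ (inj₂ K))))
  ∷ []) _
  where open SubsetSearch E₈ finite-E₈

-- Classical diagrams: runs of I along paths.

cartan-cong : ∀ t′ t {x y : Fin (rank t′)} {x′ y′ : Fin (rank t)} →
  (toℕ x ℕ.≡ᵇ toℕ y) ≡ (toℕ x′ ℕ.≡ᵇ toℕ y′) →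
  adjℕ t′ (toℕ x) (toℕ y) ≡ adjℕ t (toℕ x′) (toℕ y′) →
  (if lenℕ t′ (toℕ x) ℕ.<ᵇ lenℕ t′ (toℕ y) then - + lenℕ t′ (toℕ y) else - + 1) ≡
  (if lenℕ t (toℕ x′) ℕ.<ᵇ lenℕ t (toℕ y′) then - + lenℕ t (toℕ y′) else - + 1) →
  cartan t′ x y ≡ cartan t x′ y′
cartan-cong t′ t eq adj bond rewrite eq | adj | bond = refl

same-length : ∀ {a b} → a ≡ b → (if a ℕ.<ᵇ b then - + b else - + 1) ≡ - + 1
same-length {a} refl = cong (if_then - + a else - + 1)
  (≢true⇒≡false (a ℕ.<ᵇ a) (λ e → ℕₚ.<-irrefl refl (ℕₚ.<ᵇ⇒< a a (subst T (sym e) _))))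

bool-ext : ∀ {x y : Bool} → (x ≡ true → y ≡ true) → (y ≡ true → x ≡ true) → x ≡ y
bool-ext {true}          p q = sym (p refl)
bool-ext {false} {true}  p q = q refl
bool-ext {false} {false} p q = refl

-- Membership by number. Numbers beyond the rank are not members, so a path may be followed one step
-- past the end of the diagram.
Mem : ∀ {n} → Subset n → ℕ → Set
Mem I k = ∃ λ v → v ∈ I × toℕ v ≡ k

mem? : ∀ {n} (I : Subset n) k → Dec (Mem I k)
mem? I k = any? (λ v → (v ∈? I) ×-dec (toℕ v ℕₚ.≟ k))

mem : ∀ {n} {I : Subset n} {v} → v ∈ I → Mem I (toℕ v)
mem {v = v} v∈I = v , v∈I , refl

module Runs (P : ℕ → Set) (P? : ∀ k → Dec (P k)) where

  run-up : ∀ fuel i → P i →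
    (∀ j → i ℕ.≤ j → j ℕ.≤ i ℕ.+ fuel → P j) ⊎
    (∃ λ e → i ℕ.< e × e ℕ.≤ i ℕ.+ fuel × (∀ j → i ℕ.≤ j → j ℕ.< e → P j) × ¬ P e)
  run-up zero i Pi = inj₁ λ j i≤j j≤i → subst P (ℕₚ.≤-antisym i≤j (subst (j ℕ.≤_) (ℕₚ.+-identityʳ i) j≤i)) Pi
  run-up (suc fuel) i Pi = step (P? (suc i))
    where
    first : ∀ {Q : ℕ → Set} → (∀ j → suc i ℕ.≤ j → Q j → P j) → ∀ j → i ℕ.≤ j → Q j → P j
    first h j i≤j q = [ (λ i<j → h j i<j q) , (λ { refl → Pi }) ]′ (ℕₚ.m≤n⇒m<n∨m≡n i≤j)
    step : Dec (P (suc i)) → _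
    step (no ¬P) = inj₂ (suc i , ℕₚ.≤-refl , subst (suc i ℕ.≤_) (sym (ℕₚ.+-suc i fuel)) (ℕ.s≤s (ℕₚ.m≤m+n i fuel)) ,
      (λ j i≤j j≤i → subst P (ℕₚ.≤-antisym i≤j (ℕ.s≤s⁻¹ j≤i)) Pi) , ¬P)
    step (yes Psi) = [
      (λ all → inj₁ λ j i≤j j≤ → first (λ j i<j j≤ → all j i<j (subst (j ℕ.≤_) (ℕₚ.+-suc i fuel) j≤)) j i≤j j≤) ,
      (λ (e , i<e , e≤ , all , ¬Pe) →
        inj₂ (e , ℕₚ.<-trans (ℕₚ.n<1+n i) i<e , subst (e ℕ.≤_) (sym (ℕₚ.+-suc i fuel)) e≤ , first all , ¬Pe)) ]′
      (run-up fuel (suc i) Psi)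

  run-down : ∀ i → P i → ∃ λ a → a ℕ.≤ i × (∀ j → a ℕ.≤ j → j ℕ.≤ i → P j) × (∀ b → suc b ≡ a → ¬ P b)
  run-down zero P0 = 0 , ℕ.z≤n , (λ { .0 ℕ.z≤n ℕ.z≤n → P0 }) , λ b ()
  run-down (suc i) Psi = step (P? i)
    where
    step : Dec (P i) → _
    step (no ¬Pi) = suc i , ℕₚ.≤-refl , (λ j i≤j j≤i → subst P (ℕₚ.≤-antisym i≤j j≤i) Psi) , λ { b refl → ¬Pi }
    step (yes Pi) =
      let a , a≤i , all , ¬Pb = run-down i Pi
      in a , ℕₚ.m≤n⇒m≤1+n a≤i ,
         (λ j a≤j j≤ → [ (λ j< → all j a≤j (ℕ.s≤s⁻¹ j<)) , (λ { refl → Psi }) ]′ (ℕₚ.m≤n⇒m<n∨m≡n j≤)) , ¬Pb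

-- A maximal run of I inside a path g 0, g 1, …, g L of the diagram, ending before g L,
-- would be a component of type A, which -1 does not allow once it has two vertices.
module Path (t : CartanType) (fin : FiniteType t) (I : Subset (rank t)) (opp : OppositionTrivial t I)
  (L : ℕ) (g : ℕ → ℕ)
  (g-injective : ∀ {i j} → i ℕ.≤ L → j ℕ.≤ L → g i ≡ g j → i ≡ j)
  (edges : ∀ i q → i ℕ.< L → Mem I q → adjℕ t (g i) q ≡ true → ∃ λ j → q ≡ g j × Consecutive i j)
  (bonds : ∀ i → suc i ℕ.< L → adjℕ t (g i) (g (suc i)) ≡ true × adjℕ t (g (suc i)) (g i) ≡ true)
  (lengths : ∀ i j → i ℕ.< L → j ℕ.< L → lenℕ t (g i) ≡ lenℕ t (g j)) where

  open Runs (λ i → Mem I (g i)) (λ i → mem? I (g i))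

  module _ (a k : ℕ) (e≤L : a ℕ.+ (2 ℕ.+ k) ℕ.≤ L)
           (all : ∀ j → a ℕ.≤ j → j ℕ.< a ℕ.+ (2 ℕ.+ k) → Mem I (g j))
           (¬before : ∀ b → suc b ≡ a → ¬ Mem I (g b))
           (¬after : ¬ Mem I (g (a ℕ.+ (2 ℕ.+ k)))) where

    private
      m = 2 ℕ.+ k

      member : ∀ (x : Fin m) → Mem I (g (a ℕ.+ toℕ x))
      member x = all (a ℕ.+ toℕ x) (ℕₚ.m≤m+n a (toℕ x)) (ℕₚ.+-monoʳ-< a (toℕ<n x))

      embed : Fin m → Fin (rank t)
      embed x = proj₁ (member x)

      toℕ-embed : ∀ x → toℕ (embed x) ≡ g (a ℕ.+ toℕ x)
      toℕ-embed x = proj₂ (proj₂ (member x))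

      below : ∀ (x : Fin m) → a ℕ.+ toℕ x ℕ.< L
      below x = ℕₚ.<-≤-trans (ℕₚ.+-monoʳ-< a (toℕ<n x)) e≤L

      consecutive≤ : ∀ {i j} → i ℕ.< L → Consecutive i j → j ℕ.≤ L
      consecutive≤ i<L (inj₁ refl) = i<L
      consecutive≤ i<L (inj₂ refl) = ℕₚ.≤-trans (ℕₚ.n≤1+n _) (ℕₚ.<⇒≤ i<L)

      cancel : ∀ x y → Consecutive (a ℕ.+ x) (a ℕ.+ y) → Consecutive x y
      cancel x y (inj₁ p) = inj₁ (ℕₚ.+-cancelˡ-≡ a (suc x) y (trans (ℕₚ.+-suc a x) p))
      cancel x y (inj₂ p) = inj₂ (ℕₚ.+-cancelˡ-≡ a (suc y) x (trans (ℕₚ.+-suc a y) p))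

      bond : ∀ (x y : Fin m) → Consecutive (toℕ x) (toℕ y) → adjℕ t (g (a ℕ.+ toℕ x)) (g (a ℕ.+ toℕ y)) ≡ true
      bond x y (inj₁ p) = subst (λ z → adjℕ t (g (a ℕ.+ toℕ x)) (g z) ≡ true) next
        (proj₁ (bonds (a ℕ.+ toℕ x) (subst (ℕ._< L) (sym next) (below y))))
        where
        next : suc (a ℕ.+ toℕ x) ≡ a ℕ.+ toℕ y
        next = trans (sym (ℕₚ.+-suc a (toℕ x))) (cong (a ℕ.+_) p)
      bond x y (inj₂ p) = subst (λ z → adjℕ t (g z) (g (a ℕ.+ toℕ y)) ≡ true) next
        (proj₂ (bonds (a ℕ.+ toℕ y) (subst (ℕ._< L) (sym next) (below x))))
        where
        next : suc (a ℕ.+ toℕ y) ≡ a ℕ.+ toℕ x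
        next = trans (sym (ℕₚ.+-suc a (toℕ y))) (cong (a ℕ.+_) p)

      same-vertex : ∀ (x y : Fin m) → (toℕ x ℕ.≡ᵇ toℕ y) ≡ (g (a ℕ.+ toℕ x) ℕ.≡ᵇ g (a ℕ.+ toℕ y))
      same-vertex x y = bool-ext
        (λ e → ≡⇒≡ᵇ-true (cong (λ z → g (a ℕ.+ z)) (≡ᵇ-true⇒≡ (toℕ x) (toℕ y) e)))
        (λ e → ≡⇒≡ᵇ-true (ℕₚ.+-cancelˡ-≡ a (toℕ x) (toℕ y) (g-injective (ℕₚ.<⇒≤ (below x)) (ℕₚ.<⇒≤ (below y))
                 (≡ᵇ-true⇒≡ (g (a ℕ.+ toℕ x)) (g (a ℕ.+ toℕ y)) e))))

      same-edge : ∀ (x y : Fin m) → adjℕ (A m) (toℕ x) (toℕ y) ≡ adjℕ t (g (a ℕ.+ toℕ x)) (g (a ℕ.+ toℕ y))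
      same-edge x y = bool-ext
        (λ e → bond x y (consec⇒ (toℕ x) (toℕ y) e))
        (λ e → let j , gy≡gj , con = edges (a ℕ.+ toℕ x) _ (below x) (member y) e
                   y≡j = g-injective (ℕₚ.<⇒≤ (below y)) (consecutive≤ (below x) con) gy≡gj
               in ⇒consec (cancel (toℕ x) (toℕ y) (subst (Consecutive (a ℕ.+ toℕ x)) (sym y≡j) con)))

      pres : ∀ x y → cartan (A m) x y ≡ cartan t (embed x) (embed y)
      pres x y = cartan-cong (A m) t {x} {y}
        (trans (same-vertex x y) (sym (cong₂ ℕ._≡ᵇ_ (toℕ-embed x) (toℕ-embed y))))
        (trans (same-edge x y) (sym (cong₂ (adjℕ t) (toℕ-embed x) (toℕ-embed y))))
        (sym (same-length (trans (cong (lenℕ t) (toℕ-embed x))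
          (trans (lengths _ _ (below x) (below y)) (cong (lenℕ t) (sym (toℕ-embed y)))))))

      inside : ∀ (x : Fin m) j → Consecutive (a ℕ.+ toℕ x) j → Mem I (g j) → ∃ λ (y : Fin m) → a ℕ.+ toℕ y ≡ j
      inside x j con j∈ = fromℕ< j∸a<m , trans (cong (a ℕ.+_) (toℕ-fromℕ< j∸a<m)) (ℕₚ.m+[n∸m]≡n a≤j)
        where
        a≤ : Consecutive (a ℕ.+ toℕ x) j → a ℕ.≤ j
        a≤ (inj₁ refl) = ℕₚ.m≤n⇒m≤1+n (ℕₚ.m≤m+n a (toℕ x))
        a≤ (inj₂ p) = [ (λ a<sj → ℕ.s≤s⁻¹ a<sj) , (λ a≡sj → contradiction j∈ (¬before j (sym a≡sj))) ]′
          (ℕₚ.m≤n⇒m<n∨m≡n (subst (a ℕ.≤_) (sym p) (ℕₚ.m≤m+n a (toℕ x))))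
        <e : Consecutive (a ℕ.+ toℕ x) j → j ℕ.< a ℕ.+ m
        <e (inj₁ refl) = [ id , (λ j≡e → contradiction (subst (λ z → Mem I (g z)) j≡e j∈) ¬after) ]′
          (ℕₚ.m≤n⇒m<n∨m≡n (ℕₚ.+-monoʳ-< a (toℕ<n x)))
        <e (inj₂ p) = ℕₚ.<-trans (ℕₚ.≤-reflexive p) (ℕₚ.+-monoʳ-< a (toℕ<n x))
        a≤j = a≤ con
        j∸a<m : j ℕ.∸ a ℕ.< m
        j∸a<m = ℕₚ.+-cancelˡ-< a (j ℕ.∸ a) m (subst (ℕ._< a ℕ.+ m) (sym (ℕₚ.m+[n∸m]≡n a≤j)) (<e con))

      closed : ∀ v → v ∈ I → (∃ λ x → embed x ≡ v) ⊎ (∀ x → cartan t v (embed x) ≡ + 0)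
      closed v v∈I with any? (λ x → embed x ≟ v)
      ... | yes im = inj₁ im
      ... | no ¬im = inj₂ λ x → Criterion.cartan-zero-sym t fin I (embed x) v
        (decidable-stable (cartan t (embed x) v ℤₚ.≟ + 0) λ c≢0 →
          let j , v≡gj , con = edges (a ℕ.+ toℕ x) (toℕ v) (below x) (mem v∈I)
                (subst (λ z → adjℕ t z (toℕ v) ≡ true) (toℕ-embed x) (cartan≢0⇒Adjacent t (λ e → ¬im (x , e)) c≢0))
              y , y≡j = inside x j con (v , v∈I , v≡gj)
          in ¬im (y , toℕ-injective (trans (toℕ-embed y) (trans (cong g y≡j) (sym v≡gj)))))

    no-run : ⊥
    no-run = Push.obstruction t fin I (A m)
      (record { embed = embed ; inside = λ x → proj₁ (proj₂ (member x)) ; pres = pres ; closed = closed })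
      (obstructed-A k) opp

  -- The neighbour i′ ensures that the maximal run through i has at least two vertices, hence length
  -- 2 + k. Stopping before g L would contradict `no-run`.
  reaches-end : ∀ i i′ → i ℕ.< L → Consecutive i i′ → Mem I (g i) → Mem I (g i′) →
                ∀ j → i ℕ.≤ j → j ℕ.≤ L → Mem I (g j)
  reaches-end i i′ i<L con i∈ i′∈ j i≤j j≤L = by-run (run-up (L ℕ.∸ i) i i∈)
    where
    L≡ : i ℕ.+ (L ℕ.∸ i) ≡ L
    L≡ = ℕₚ.m+[n∸m]≡n (ℕₚ.<⇒≤ i<L)
    by-run : _ → Mem I (g j)
    by-run (inj₁ all) = all j i≤j (subst (j ℕ.≤_) (sym L≡) j≤L)
    by-run (inj₂ (e , i<e , e≤ , all , ¬e)) = ⊥-elim (no-run a k (subst (ℕ._≤ L) (sym e≡) (subst (e ℕ.≤_) L≡ e≤))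
        (λ j a≤j j<e → [ (λ i≤j → all j i≤j (subst (j ℕ.<_) e≡ j<e)) , (λ j≤i → all′ j a≤j j≤i) ]′ (ℕₚ.≤-total i j))
        ¬before (subst (λ z → ¬ Mem I (g z)) (sym e≡) ¬e))
      where
      down-run = run-down i i∈
      a = proj₁ down-run
      a≤i = proj₁ (proj₂ down-run)
      all′ = proj₁ (proj₂ (proj₂ down-run))
      ¬before = proj₂ (proj₂ (proj₂ down-run))
      two : Consecutive i i′ → 2 ℕ.+ a ℕ.≤ e
      two (inj₁ refl) = [ ℕₚ.≤-trans (ℕ.s≤s (ℕ.s≤s a≤i)) , (λ { refl → contradiction i′∈ ¬e }) ]′ (ℕₚ.m≤n⇒m<n∨m≡n i<e)
      two (inj₂ refl) = [ (λ a<i → ℕₚ.≤-trans (ℕ.s≤s a<i) i<e) ,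
        (λ { a≡i → contradiction i′∈ (¬before i′ (sym a≡i)) }) ]′ (ℕₚ.m≤n⇒m<n∨m≡n a≤i)
      k = e ℕ.∸ (2 ℕ.+ a)
      e≡ : a ℕ.+ (2 ℕ.+ k) ≡ e
      e≡ = trans (trans (ℕₚ.+-suc a (suc k)) (cong suc (ℕₚ.+-suc a k))) (ℕₚ.m+[n∸m]≡n (two con))

≡ᵇ-+ : ∀ a i j → (a ℕ.+ i ℕ.≡ᵇ a ℕ.+ j) ≡ (i ℕ.≡ᵇ j)
≡ᵇ-+ zero    i j = refl
≡ᵇ-+ (suc a) i j = ≡ᵇ-+ a i j

consec-+ : ∀ a i j → ((suc (a ℕ.+ i) ℕ.≡ᵇ a ℕ.+ j) ∨ (suc (a ℕ.+ j) ℕ.≡ᵇ a ℕ.+ i)) ≡ ((suc i ℕ.≡ᵇ j) ∨ (suc j ℕ.≡ᵇ i))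
consec-+ zero    i j = refl
consec-+ (suc a) i j = consec-+ a i j

end-+ : ∀ a k i → (a ℕ.+ i ℕ.≡ᵇ (a ℕ.+ (2 ℕ.+ k)) ℕ.∸ 1) ≡ (i ℕ.≡ᵇ suc k)
end-+ a k i = trans (cong (λ z → a ℕ.+ i ℕ.≡ᵇ z ℕ.∸ 1) (ℕₚ.+-suc a (suc k))) (≡ᵇ-+ a i (suc k))

adj-D-+ : ∀ a k i j → adjℕ (D (a ℕ.+ (3 ℕ.+ k))) (a ℕ.+ i) (a ℕ.+ j) ≡ adjℕ (D (3 ℕ.+ k)) i j
adj-D-+ zero    k i j = refl
adj-D-+ (suc a) k i j = trans
  (subst (λ n → adjℕ (D (suc n)) (suc (a ℕ.+ i)) (suc (a ℕ.+ j)) ≡ adjℕ (D n) (a ℕ.+ i) (a ℕ.+ j)) (sym n≡)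
         (adj-D-suc (a ℕ.+ k) (a ℕ.+ i) (a ℕ.+ j)))
  (adj-D-+ a k i j)
  where
  n≡ : a ℕ.+ (3 ℕ.+ k) ≡ 3 ℕ.+ (a ℕ.+ k)
  n≡ = trans (ℕₚ.+-suc a (2 ℕ.+ k)) (cong suc (trans (ℕₚ.+-suc a (suc k)) (cong suc (ℕₚ.+-suc a k))))

cartan-B-↑ : ∀ a k i j → cartan (B (2 ℕ.+ k)) i j ≡ cartan (B (a ℕ.+ (2 ℕ.+ k))) (a ↑ʳ i) (a ↑ʳ j)
cartan-B-↑ a k i j = cartan-cong (B (2 ℕ.+ k)) (B (a ℕ.+ (2 ℕ.+ k))) {i} {j} {a ↑ʳ i} {a ↑ʳ j}
  (sym (trans (cong₂ ℕ._≡ᵇ_ (toℕ-↑ʳ a i) (toℕ-↑ʳ a j)) (≡ᵇ-+ a (toℕ i) (toℕ j))))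
  (sym (trans (cong₂ (λ p q → (suc p ℕ.≡ᵇ q) ∨ (suc q ℕ.≡ᵇ p)) (toℕ-↑ʳ a i) (toℕ-↑ʳ a j)) (consec-+ a (toℕ i) (toℕ j))))
  (cong₂ (λ p q → if p ℕ.<ᵇ q then - + q else - + 1) (len i) (len j))
  where
  len : ∀ i → lenℕ (B (2 ℕ.+ k)) (toℕ i) ≡ lenℕ (B (a ℕ.+ (2 ℕ.+ k))) (toℕ (a ↑ʳ i))
  len i = cong (if_then 1 else 2) (sym (trans (cong (ℕ._≡ᵇ (a ℕ.+ (2 ℕ.+ k)) ℕ.∸ 1) (toℕ-↑ʳ a i)) (end-+ a k (toℕ i))))

cartan-C-↑ : ∀ a k i j → cartan (C (2 ℕ.+ k)) i j ≡ cartan (C (a ℕ.+ (2 ℕ.+ k))) (a ↑ʳ i) (a ↑ʳ j)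
cartan-C-↑ a k i j = cartan-cong (C (2 ℕ.+ k)) (C (a ℕ.+ (2 ℕ.+ k))) {i} {j} {a ↑ʳ i} {a ↑ʳ j}
  (sym (trans (cong₂ ℕ._≡ᵇ_ (toℕ-↑ʳ a i) (toℕ-↑ʳ a j)) (≡ᵇ-+ a (toℕ i) (toℕ j))))
  (sym (trans (cong₂ (λ p q → (suc p ℕ.≡ᵇ q) ∨ (suc q ℕ.≡ᵇ p)) (toℕ-↑ʳ a i) (toℕ-↑ʳ a j)) (consec-+ a (toℕ i) (toℕ j))))
  (cong₂ (λ p q → if p ℕ.<ᵇ q then - + q else - + 1) (len i) (len j))
  where
  len : ∀ i → lenℕ (C (2 ℕ.+ k)) (toℕ i) ≡ lenℕ (C (a ℕ.+ (2 ℕ.+ k))) (toℕ (a ↑ʳ i))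
  len i = cong (if_then 2 else 1) (sym (trans (cong (ℕ._≡ᵇ (a ℕ.+ (2 ℕ.+ k)) ℕ.∸ 1) (toℕ-↑ʳ a i)) (end-+ a k (toℕ i))))

cartan-D-↑ : ∀ a k i j → cartan (D (3 ℕ.+ k)) i j ≡ cartan (D (a ℕ.+ (3 ℕ.+ k))) (a ↑ʳ i) (a ↑ʳ j)
cartan-D-↑ a k i j = cartan-cong (D (3 ℕ.+ k)) (D (a ℕ.+ (3 ℕ.+ k))) {i} {j} {a ↑ʳ i} {a ↑ʳ j}
  (sym (trans (cong₂ ℕ._≡ᵇ_ (toℕ-↑ʳ a i) (toℕ-↑ʳ a j)) (≡ᵇ-+ a (toℕ i) (toℕ j))))
  (sym (trans (cong₂ (adjℕ (D (a ℕ.+ (3 ℕ.+ k)))) (toℕ-↑ʳ a i) (toℕ-↑ʳ a j)) (adj-D-+ a k (toℕ i) (toℕ j))))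
  refl

tail-image : ∀ a {k} {P : Fin (a ℕ.+ k) → Set} → (∀ v → P v → a ℕ.≤ toℕ v) → (∀ v → a ℕ.≤ toℕ v → P v) →
             ∀ v → (P v → ∃ λ i → a ↑ʳ i ≡ v) × ((∃ λ i → a ↑ʳ i ≡ v) → P v)
tail-image a {k} lower upper v = (λ Pv → preimage (lower v Pv)) ,
  λ { (i , refl) → upper (a ↑ʳ i) (subst (a ℕ.≤_) (sym (toℕ-↑ʳ a i)) (ℕₚ.m≤m+n a (toℕ i))) }
  where
  preimage : a ℕ.≤ toℕ v → ∃ λ i → a ↑ʳ i ≡ v
  preimage a≤v = fromℕ< v∸a<k , toℕ-injective
    (trans (toℕ-↑ʳ a _) (trans (cong (a ℕ.+_) (toℕ-fromℕ< v∸a<k)) (ℕₚ.m+[n∸m]≡n a≤v)))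
    where
    v∸a<k : toℕ v ℕ.∸ a ℕ.< k
    v∸a<k = ℕₚ.+-cancelˡ-< a (toℕ v ℕ.∸ a) k (subst (ℕ._< a ℕ.+ k) (sym (ℕₚ.m+[n∸m]≡n a≤v)) (toℕ<n v))

-- Descending from one vertex of `Big` finds the start of the segment for all of them: a lower one
-- would put the vertex just before the segment into I.
tail : ∀ {n} (I : Subset n) (Big : Fin n → Set) → (∀ v → Big v → ∀ j → toℕ v ℕ.≤ j → j ℕ.< n → Mem I j) →
       ∀ v₀ → Big v₀ → ∃ λ a → a ℕ.≤ toℕ v₀ × (∀ j → a ℕ.≤ j → j ℕ.< n → Mem I j) × (∀ v → Big v → a ℕ.≤ toℕ v)
tail {n} I Big onwards v₀ big₀ = a , a≤v₀ ,
  (λ j a≤j j<n → [ (λ v₀≤j → onwards v₀ big₀ j v₀≤j j<n) , all j a≤j ]′ (ℕₚ.≤-total (toℕ v₀) j)) ,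
  λ v big → ℕₚ.≮⇒≥ λ v<a → low v big a refl v<a (ℕₚ.≤-<-trans a≤v₀ (toℕ<n v₀))
  where
  open Runs (Mem I) (mem? I)
  run = run-down (toℕ v₀) (onwards v₀ big₀ (toℕ v₀) ℕₚ.≤-refl (toℕ<n v₀))
  a = proj₁ run
  a≤v₀ = proj₁ (proj₂ run)
  all = proj₁ (proj₂ (proj₂ run))
  low : ∀ v → Big v → ∀ b → b ≡ a → toℕ v ℕ.< b → b ℕ.< n → ⊥
  low v big (suc b) e (ℕ.s≤s v≤b) b<n = proj₂ (proj₂ (proj₂ run)) b e (onwards v big b v≤b (ℕₚ.<-trans (ℕₚ.n<1+n b) b<n))

consecutive-sym : ∀ {i j} → Consecutive i j → Consecutive j i
consecutive-sym (inj₁ p) = inj₂ p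
consecutive-sym (inj₂ p) = inj₁ p

mem<n : ∀ {n} {I : Subset n} {k} → Mem I k → k ℕ.< n
mem<n (v , _ , refl) = toℕ<n v

module Chain (t : CartanType) (fin : FiniteType t) (I : Subset (rank t)) (opp : OppositionTrivial t I) (L : ℕ)
  (edges : ∀ i q → i ℕ.< L → Mem I q → adjℕ t i q ≡ true → Consecutive i q)
  (bonds : ∀ i → suc i ℕ.< L → adjℕ t i (suc i) ≡ true × adjℕ t (suc i) i ≡ true)
  (lengths : ∀ i j → i ℕ.< L → j ℕ.< L → lenℕ t i ≡ lenℕ t j) where

  open Path t fin I opp L id (λ _ _ → id) (λ i q i<L q∈ adj → q , refl , edges i q i<L q∈ adj) bonds lengths public

chain-bonds : ∀ i → ((suc i ℕ.≡ᵇ suc i) ∨ (suc (suc i) ℕ.≡ᵇ i)) ≡ true × ((suc (suc i) ℕ.≡ᵇ i) ∨ (suc i ℕ.≡ᵇ suc i)) ≡ true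
chain-bonds i = ⇒consec {i} {suc i} (inj₁ refl) , ⇒consec {suc i} {i} (inj₂ refl)

-- The path is taken one step too long: L is the rank, so the run would have to contain a number
-- beyond the last vertex.
no-trivial-A : ∀ n I → ∃ (I≥2 (A (suc n)) I) → ¬ OppositionTrivial (A (suc n)) I
no-trivial-A n I (v , v∈I , u , u∈I , adj) opp =
  ℕₚ.<-irrefl refl (mem<n (reaches-end (toℕ v) (toℕ u) (toℕ<n v) (consecutive-sym (consec⇒ (toℕ u) (toℕ v) adj))
    (mem v∈I) (mem u∈I) (suc n) (ℕₚ.<⇒≤ (toℕ<n v)) ℕₚ.≤-refl))
  where
  open Chain (A (suc n)) (finite-A n) I opp (suc n) (λ i q _ _ → consec⇒ i q) (λ i _ → chain-bonds i) (λ _ _ _ _ → refl)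

module ConsecutiveTail {m : ℕ} (I : Subset (2 ℕ.+ m)) where

  -- Unfolds to `I≥2` both in type B and in type C, so one argument serves the two.
  Big : Fin (2 ℕ.+ m) → Set
  Big v = v ∈ I × ∃ λ u → u ∈ I × ((suc (toℕ u) ℕ.≡ᵇ toℕ v) ∨ (suc (toℕ v) ℕ.≡ᵇ toℕ u)) ≡ true

  big : ∀ {i j} → (i∈ : Mem I i) → Mem I j → Consecutive j i → Big (proj₁ i∈)
  big (v , v∈I , refl) (u , u∈I , refl) con = v∈I , u , u∈I , ⇒consec con

  final-segment : (∀ v u → v ∈ I → u ∈ I → Consecutive (toℕ v) (toℕ u) → ∀ j → toℕ v ℕ.≤ j → j ℕ.< 2 ℕ.+ m → Mem I j) →
    ∃ Big → ∃ λ a → ∃ λ k → a ℕ.+ (2 ℕ.+ k) ≡ 2 ℕ.+ m × (∀ v → Big v → a ℕ.≤ toℕ v) × (∀ v → a ℕ.≤ toℕ v → Big v)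
  final-segment onwards (v₀ , v₀∈I , u₀ , u₀∈I , adj₀) = a , k , a+k , lower , upper
    where
    onwards′ : ∀ v → Big v → ∀ j → toℕ v ℕ.≤ j → j ℕ.< 2 ℕ.+ m → Mem I j
    onwards′ v (v∈I , u , u∈I , adj) = onwards v u v∈I u∈I (consecutive-sym (consec⇒ (toℕ u) (toℕ v) adj))
    segment = tail I Big onwards′ v₀ (v₀∈I , u₀ , u₀∈I , adj₀)
    a = proj₁ segment
    all = proj₁ (proj₂ (proj₂ segment))
    lower = proj₂ (proj₂ (proj₂ segment))
    con₀ : Consecutive (toℕ u₀) (toℕ v₀)
    con₀ = consec⇒ (toℕ u₀) (toℕ v₀) adj₀
    a≤u₀ : a ℕ.≤ toℕ u₀
    a≤u₀ = lower u₀ (u₀∈I , v₀ , v₀∈I , ⇒consec (consecutive-sym con₀))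
    room : a ℕ.+ 2 ℕ.≤ 2 ℕ.+ m
    room = subst (ℕ._≤ 2 ℕ.+ m) (ℕₚ.+-comm 2 a) (by-cases con₀)
      where
      by-cases : Consecutive (toℕ u₀) (toℕ v₀) → 2 ℕ.+ a ℕ.≤ 2 ℕ.+ m
      by-cases (inj₁ p) = ℕₚ.≤-trans (ℕ.s≤s (ℕₚ.≤-trans (ℕ.s≤s a≤u₀) (ℕₚ.≤-reflexive p))) (toℕ<n v₀)
      by-cases (inj₂ p) = ℕₚ.≤-trans (ℕ.s≤s (ℕₚ.≤-trans (ℕ.s≤s (proj₁ (proj₂ segment))) (ℕₚ.≤-reflexive p))) (toℕ<n u₀)
    k = (2 ℕ.+ m) ℕ.∸ (a ℕ.+ 2)
    a+k : a ℕ.+ (2 ℕ.+ k) ≡ 2 ℕ.+ m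
    a+k = trans (sym (ℕₚ.+-assoc a 2 k)) (ℕₚ.m+[n∸m]≡n room)
    upper : ∀ v → a ℕ.≤ toℕ v → Big v
    upper v a≤v = subst Big (toℕ-injective (proj₂ (proj₂ v∈))) (by-cases (suc (toℕ v) ℕₚ.<? 2 ℕ.+ m))
      where
      v∈ : Mem I (toℕ v)
      v∈ = all (toℕ v) a≤v (toℕ<n v)
      by-cases : Dec (suc (toℕ v) ℕ.< 2 ℕ.+ m) → Big (proj₁ v∈)
      by-cases (yes sv<) = big v∈ (all (suc (toℕ v)) (ℕₚ.m≤n⇒m≤1+n a≤v) sv<) (inj₂ refl)
      by-cases (no sv≮) = big v∈ (all m a≤m (ℕₚ.m≤n+m (suc m) 1)) (inj₁ sm≡v)
        where
        sm≡v : suc m ≡ toℕ v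
        sm≡v = ℕₚ.≤-antisym (ℕ.s≤s⁻¹ (ℕₚ.≮⇒≥ sv≮)) (ℕ.s≤s⁻¹ (toℕ<n v))
        a≤m : a ℕ.≤ m
        a≤m = ℕ.s≤s⁻¹ (ℕ.s≤s⁻¹ (subst (ℕ._≤ 2 ℕ.+ m) (ℕₚ.+-comm a 2) room))

ofType-B-tail : ∀ {n} (I : Subset n) a k → a ℕ.+ (2 ℕ.+ k) ≡ n →
  (∀ v → I≥2 (B n) I v → a ℕ.≤ toℕ v) → (∀ v → a ℕ.≤ toℕ v → I≥2 (B n) I v) → OfType (B (2 ℕ.+ k)) (B n) (I≥2 (B n) I)
ofType-B-tail I a k refl lower upper =
  (a ↑ʳ_) , ↑ʳ-injective a _ _ , tail-image a lower upper , cartan-B-↑ a k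

ofType-C-tail : ∀ {n} (I : Subset n) a k → a ℕ.+ (2 ℕ.+ k) ≡ n →
  (∀ v → I≥2 (C n) I v → a ℕ.≤ toℕ v) → (∀ v → a ℕ.≤ toℕ v → I≥2 (C n) I v) → OfType (C (2 ℕ.+ k)) (C n) (I≥2 (C n) I)
ofType-C-tail I a k refl lower upper =
  (a ↑ʳ_) , ↑ʳ-injective a _ _ , tail-image a lower upper , cartan-C-↑ a k

ofType-D-tail : ∀ {n} (I : Subset n) a k → a ℕ.+ (3 ℕ.+ k) ≡ n →
  (∀ v → I≥2 (D n) I v → a ℕ.≤ toℕ v) → (∀ v → a ℕ.≤ toℕ v → I≥2 (D n) I v) → OfType (D (3 ℕ.+ k)) (D n) (I≥2 (D n) I)
ofType-D-tail I a k refl lower upper =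
  (a ↑ʳ_) , ↑ʳ-injective a _ _ , tail-image a lower upper , cartan-D-↑ a k

below-end : ∀ {m i} → i ℕ.< suc m → (i ℕ.≡ᵇ suc m) ≡ false
below-end i<sm = ≢⇒≡ᵇ-false (ℕₚ.<⇒≢ i<sm)

onwards-from : ∀ {m} (I : Subset (2 ℕ.+ m)) →
  (∀ i i′ → i ℕ.< suc m → Consecutive i i′ → Mem I i → Mem I i′ → ∀ j → i ℕ.≤ j → j ℕ.≤ suc m → Mem I j) →
  ∀ v u → v ∈ I → u ∈ I → Consecutive (toℕ v) (toℕ u) → ∀ j → toℕ v ℕ.≤ j → j ℕ.< 2 ℕ.+ m → Mem I j
onwards-from {m} I run v u v∈I u∈I con j v≤j j<n = [
  (λ v<sm → run (toℕ v) (toℕ u) v<sm con (mem v∈I) (mem u∈I) j v≤j (ℕ.s≤s⁻¹ j<n)) ,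
  (λ v≡sm → subst (Mem I) (ℕₚ.≤-antisym v≤j (subst (j ℕ.≤_) (sym v≡sm) (ℕ.s≤s⁻¹ j<n))) (mem v∈I)) ]′
  (ℕₚ.m≤n⇒m<n∨m≡n (ℕ.s≤s⁻¹ (toℕ<n v)))

trivial⇒classified-B : ∀ m I → ∃ (I≥2 (B (2 ℕ.+ m)) I) → OppositionTrivial (B (2 ℕ.+ m)) I → Classified (B (2 ℕ.+ m)) I
trivial⇒classified-B m I v₀ opp =
  let a , k , a+k , lower , upper = final-segment (onwards-from I reaches-end) v₀
  in case1B (2 ℕ.+ k) (ℕₚ.m≤m+n 2 k) (subst (2 ℕ.+ k ℕ.≤_) a+k (ℕₚ.m≤n+m (2 ℕ.+ k) a)) (ofType-B-tail I a k a+k lower upper)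
  where
  open ConsecutiveTail I
  -- The path ends at the last vertex, the only one of different length; runs that stop earlier are
  -- simply laced.
  open Chain (B (2 ℕ.+ m)) (finite-B m) I opp (suc m) (λ i q _ _ → consec⇒ i q) (λ i _ → chain-bonds i)
    (λ i j i< j< → cong (if_then 1 else 2) (trans (below-end i<) (sym (below-end j<))))

trivial⇒classified-C : ∀ m I → ∃ (I≥2 (C (2 ℕ.+ m)) I) → OppositionTrivial (C (2 ℕ.+ m)) I → Classified (C (2 ℕ.+ m)) I
trivial⇒classified-C m I v₀ opp =
  let a , k , a+k , lower , upper = final-segment (onwards-from I reaches-end) v₀
  in case1C (2 ℕ.+ k) (ℕₚ.m≤m+n 2 k) (subst (2 ℕ.+ k ℕ.≤_) a+k (ℕₚ.m≤n+m (2 ℕ.+ k) a)) (ofType-C-tail I a k a+k lower upper)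
  where
  open ConsecutiveTail I
  open Chain (C (2 ℕ.+ m)) (finite-C m) I opp (suc m) (λ i q _ _ → consec⇒ i q) (λ i _ → chain-bonds i)
    (λ i j i< j< → cong (if_then 2 else 1) (trans (below-end i<) (sym (below-end j<))))

-- Type D: the two ends of the fork.

-- Interchanges p + 1 and p + 2, so that the path through p + 2 also gets consecutive positions,
-- with p + 1 as its end.
swap-forks : ℕ → ℕ → ℕ
swap-forks p i = if i ℕ.≤ᵇ p then i else if i ℕ.≡ᵇ suc p then 2 ℕ.+ p else suc p

swap-low : ∀ {p i} → i ℕ.≤ p → swap-forks p i ≡ i
swap-low {p} {i} i≤p rewrite ≤⇒≤ᵇ-true i≤p = refl

≰⇒≤ᵇ-false : ∀ {i p} → ¬ i ℕ.≤ p → (i ℕ.≤ᵇ p) ≡ false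
≰⇒≤ᵇ-false {i} {p} i≰p = ≢true⇒≡false (i ℕ.≤ᵇ p) (i≰p ∘ ≤ᵇ-true⇒≤ i p)

swap-1+p : ∀ p → swap-forks p (suc p) ≡ 2 ℕ.+ p
swap-1+p p rewrite ≰⇒≤ᵇ-false (ℕₚ.<⇒≱ (ℕₚ.n<1+n p)) | ≡ᵇ-refl p = refl

swap-2+p : ∀ p → swap-forks p (2 ℕ.+ p) ≡ suc p
swap-2+p p rewrite ≰⇒≤ᵇ-false (ℕₚ.<⇒≱ (ℕₚ.m≤n⇒m≤1+n (ℕₚ.n<1+n p)))
                 | ≢⇒≡ᵇ-false {2 ℕ.+ p} {suc p} ℕₚ.1+n≢n = refl

swap-injective : ∀ {p i j} → i ℕ.≤ 2 ℕ.+ p → j ℕ.≤ 2 ℕ.+ p → swap-forks p i ≡ swap-forks p j → i ≡ j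
swap-injective {p} {i} {j} i≤ j≤ e = trans (sym (involutive i≤)) (trans (cong (swap-forks p) e) (involutive j≤))
  where
  involutive : ∀ {i} → i ℕ.≤ 2 ℕ.+ p → swap-forks p (swap-forks p i) ≡ i
  involutive {i} i≤ with ℕₚ.m≤n⇒m<n∨m≡n i≤
  ... | inj₂ refl = trans (cong (swap-forks p) (swap-2+p p)) (swap-1+p p)
  ... | inj₁ i< with ℕₚ.m≤n⇒m<n∨m≡n (ℕ.s≤s⁻¹ i<)
  ...   | inj₂ refl = trans (cong (swap-forks p) (swap-1+p p)) (swap-2+p p)
  ...   | inj₁ i<′ = trans (cong (swap-forks p) (swap-low (ℕ.s≤s⁻¹ i<′))) (swap-low (ℕ.s≤s⁻¹ i<′))

module TypeD (p : ℕ) (I : Subset (3 ℕ.+ p)) (opp : OppositionTrivial (D (3 ℕ.+ p)) I) where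

  private
    t = D (3 ℕ.+ p)
    Big = I≥2 t I

  edge : ∀ i q → adjℕ t i q ≡ true → EdgeD p i q
  edge = edgeD⇒ p

  bonds : ∀ i → i ℕ.≤ p → adjℕ t i (suc i) ≡ true × adjℕ t (suc i) i ≡ true
  bonds i i≤p = ⇒edgeD (up i≤p) , ⇒edgeD (down i≤p)

  n≰ : ∀ {k} → ¬ suc k ℕ.+ p ℕ.≤ p
  n≰ {k} = ℕₚ.<⇒≱ (ℕ.s≤s (ℕₚ.m≤n+m p k))

  low-edge : ∀ {i q} → i ℕ.< p → EdgeD p i q → Consecutive i q
  low-edge i<p (up _)   = inj₁ refl
  low-edge i<p (down _) = inj₂ refl
  low-edge i<p fork↑    = contradiction i<p (ℕₚ.<-irrefl refl)
  low-edge i<p fork↓    = contradiction (ℕₚ.<⇒≤ i<p) (n≰ {1})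

  below-p : ∀ i i′ → i ℕ.< p → Consecutive i i′ → Mem I i → Mem I i′ → ∀ j → i ℕ.≤ j → j ℕ.≤ p → Mem I j
  below-p = reaches-end
    where
    open Chain t (finite-D p) I opp p (λ i q i<p _ adj → low-edge i<p (edge i q adj))
      (λ i si<p → bonds i (ℕₚ.≤-trans (ℕₚ.n≤1+n i) (ℕₚ.<⇒≤ si<p))) (λ _ _ _ _ → refl)

  big-edge : ∀ v → Big v → ∃ λ u → Mem I u × EdgeD p (toℕ v) u
  big-edge v (v∈I , u , u∈I , adj) = toℕ u , mem u∈I , edgeD-sym (edge (toℕ u) (toℕ v) adj)

  big : ∀ {i j} → (i∈ : Mem I i) → Mem I j → EdgeD p i j → Big (proj₁ i∈)
  big (v , v∈I , refl) (u , u∈I , refl) e = v∈I , u , u∈I , ⇒edgeD (edgeD-sym e)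

  big-onwards : ∀ v → Big v → toℕ v ℕ.< p → ∀ j → toℕ v ℕ.≤ j → j ℕ.≤ p → Mem I j
  big-onwards v bigv v<p with big-edge v bigv
  ... | u , u∈ , e = below-p (toℕ v) u v<p (low-edge v<p e) (mem (proj₁ bigv)) u∈

  -- Runs with two vertices below p must reach p, and every edge that is not below p has p as an
  -- endpoint.
  trivalent : ∃ Big → Mem I p × ∃ λ q → Mem I q × EdgeD p p q
  trivalent (v , bigv) = by-cases (ℕₚ.<-cmp (toℕ v) p)
    where
    u = proj₁ (big-edge v bigv)
    u∈ = proj₁ (proj₂ (big-edge v bigv))
    e = proj₂ (proj₂ (big-edge v bigv))
    high : ∀ {i j} → p ℕ.< i → EdgeD p i j → j ≡ p
    high p<i (up i≤p)   = contradiction i≤p (ℕₚ.<⇒≱ p<i)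
    high p<i (down i≤p) = ℕₚ.≤-antisym i≤p (ℕ.s≤s⁻¹ p<i)
    high p<i fork↑      = contradiction p<i (ℕₚ.<-irrefl refl)
    high p<i fork↓      = refl
    by-cases : Tri (toℕ v ℕ.< p) (toℕ v ≡ p) (p ℕ.< toℕ v) → Mem I p × ∃ λ q → Mem I q × EdgeD p p q
    by-cases (tri< v<p _ _) = low p refl v<p
      where
      low : ∀ p′ → p′ ≡ p → toℕ v ℕ.< p′ → Mem I p × ∃ λ q → Mem I q × EdgeD p p q
      low (suc q) refl (ℕ.s≤s v≤q) = big-onwards v bigv v<p p (ℕₚ.<⇒≤ v<p) ℕₚ.≤-refl ,
        q , big-onwards v bigv v<p q v≤q (ℕₚ.n≤1+n q) , down (ℕₚ.n≤1+n q)
    by-cases (tri≈ _ v≡p _) = subst (Mem I) v≡p (mem (proj₁ bigv)) , u , u∈ , subst (λ z → EdgeD p z u) v≡p e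
    by-cases (tri> _ _ p<v) = subst (Mem I) u≡p u∈ , toℕ v , mem (proj₁ bigv) , edgeD-sym (subst (EdgeD p (toℕ v)) u≡p e)
      where
      u≡p : u ≡ p
      u≡p = high p<v e

  -- Without the vertex 2 + p the diagram is a chain.
  edges₁ : ¬ Mem I (2 ℕ.+ p) → ∀ {i q} → i ℕ.≤ suc p → Mem I q → EdgeD p i q → Consecutive i q
  edges₁ ¬f i≤ q∈ (up _)   = inj₁ refl
  edges₁ ¬f i≤ q∈ (down _) = inj₂ refl
  edges₁ ¬f i≤ q∈ fork↑    = contradiction q∈ ¬f
  edges₁ ¬f i≤ q∈ fork↓    = contradiction (ℕ.s≤s⁻¹ i≤) (n≰ {0})

  -- Without p + 2 the diagram is a chain, and the run through p has to reach its end p + 1.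
  no-forks : Mem I p → (∃ λ q → Mem I q × EdgeD p p q) → ¬ Mem I (suc p) → Mem I (2 ℕ.+ p)
  no-forks p∈ (q , q∈ , e) ¬f₁ = decidable-stable (mem? I (2 ℕ.+ p)) λ ¬f₂ →
    let open Chain t (finite-D p) I opp (suc p)
          (λ i q i< q∈ adj → edges₁ ¬f₂ (ℕₚ.<⇒≤ i<) q∈ (edge i q adj))
          (λ i si< → bonds i (ℕₚ.<⇒≤ (ℕ.s≤s⁻¹ si<))) (λ _ _ _ _ → refl)
    in ¬f₁ (reaches-end p q (ℕₚ.n<1+n p) (edges₁ ¬f₂ (ℕₚ.n≤1+n p) q∈ e) p∈ q∈ (suc p) (ℕₚ.n≤1+n p) ℕₚ.≤-refl)

  -- If p + 2 is missing, it can serve as the position past the end of the chain, which the run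
  -- would have to reach.
  second-fork : Mem I p → Mem I (suc p) → Mem I (2 ℕ.+ p)
  second-fork p∈ f₁∈ = decidable-stable (mem? I (2 ℕ.+ p)) λ ¬f₂ →
    let open Chain t (finite-D p) I opp (2 ℕ.+ p)
          (λ i q i< q∈ adj → edges₁ ¬f₂ (ℕ.s≤s⁻¹ i<) q∈ (edge i q adj))
          (λ i si< → bonds i (ℕ.s≤s⁻¹ (ℕ.s≤s⁻¹ si<))) (λ _ _ _ _ → refl)
    in ¬f₂ (reaches-end p (suc p) (ℕₚ.m≤n⇒m≤1+n (ℕₚ.n<1+n p)) (inj₁ refl) p∈ f₁∈ (2 ℕ.+ p) (ℕₚ.m≤n+m p 2) ℕₚ.≤-refl)

  -- The mirror image of `second-fork`: along the swapped path the missing p + 1 stands past the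
  -- end.
  first-fork : Mem I p → Mem I (2 ℕ.+ p) → Mem I (suc p)
  first-fork p∈ f₂∈ = decidable-stable (mem? I (suc p)) λ ¬f₁ →
    let open Path t (finite-D p) I opp (2 ℕ.+ p) (swap-forks p) swap-injective
          (λ i q i< q∈ adj → edges₂ ¬f₁ i (ℕ.s≤s⁻¹ i<) q∈ (edge (swap-forks p i) q adj)) bonds₂ (λ _ _ _ _ → refl)
    in ¬f₁ (subst (Mem I) (swap-2+p p)
         (reaches-end p (suc p) (ℕₚ.m≤n⇒m≤1+n (ℕₚ.n<1+n p)) (inj₁ refl)
           (subst (Mem I) (sym (swap-low ℕₚ.≤-refl)) p∈) (subst (Mem I) (sym (swap-1+p p)) f₂∈)
           (2 ℕ.+ p) (ℕₚ.m≤n+m p 2) ℕₚ.≤-refl))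
    where
    low : ¬ Mem I (suc p) → ∀ {i q} → i ℕ.≤ p → Mem I q → EdgeD p i q → ∃ λ j → q ≡ swap-forks p j × Consecutive i j
    low ¬f₁ i≤p q∈ (up {i} _) = [
      (λ i<p → suc i , sym (swap-low i<p) , inj₁ refl) ,
      (λ { refl → contradiction q∈ ¬f₁ }) ]′ (ℕₚ.m≤n⇒m<n∨m≡n i≤p)
    low ¬f₁ i≤p q∈ (down {i} i≤) = i , sym (swap-low i≤) , inj₂ refl
    low ¬f₁ i≤p q∈ fork↑ = suc p , sym (swap-1+p p) , inj₁ refl
    low ¬f₁ i≤p q∈ fork↓ = contradiction i≤p (n≰ {1})
    high : ∀ {i q} → i ≡ 2 ℕ.+ p → EdgeD p i q → q ≡ p
    high e    (up i≤p)   = contradiction (subst (ℕ._≤ p) e i≤p) (n≰ {1})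
    high refl (down i≤p) = contradiction i≤p (n≰ {0})
    high e    fork↑      = contradiction e (ℕₚ.m≢1+n+m p {1})
    high e    fork↓      = refl
    edges₂ : ¬ Mem I (suc p) → ∀ i {q} → i ℕ.≤ suc p → Mem I q → EdgeD p (swap-forks p i) q →
             ∃ λ j → q ≡ swap-forks p j × Consecutive i j
    edges₂ ¬f₁ i {q} i≤ q∈ e = [
      (λ i<sp → low ¬f₁ (ℕ.s≤s⁻¹ i<sp) q∈ (subst (λ z → EdgeD p z q) (swap-low (ℕ.s≤s⁻¹ i<sp)) e)) ,
      (λ { refl → p , trans (high (swap-1+p p) e) (sym (swap-low ℕₚ.≤-refl)) , inj₂ refl }) ]′ (ℕₚ.m≤n⇒m<n∨m≡n i≤)
    bonds₂ : ∀ i → suc i ℕ.< 2 ℕ.+ p → adjℕ t (swap-forks p i) (swap-forks p (suc i)) ≡ true ×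
                                       adjℕ t (swap-forks p (suc i)) (swap-forks p i) ≡ true
    bonds₂ i si< = [
      (λ i<p → subst₂ (λ x y → adjℕ t x y ≡ true × adjℕ t y x ≡ true) (sym (swap-low (ℕₚ.<⇒≤ i<p))) (sym (swap-low i<p))
                 (bonds i (ℕₚ.<⇒≤ i<p))) ,
      (λ { refl → subst₂ (λ x y → adjℕ t x y ≡ true × adjℕ t y x ≡ true)
                    (sym (swap-low {p} {p} ℕₚ.≤-refl)) (sym (swap-1+p p))
                    (⇒edgeD {p} {p} {2 ℕ.+ p} fork↑ , ⇒edgeD {p} {2 ℕ.+ p} {p} fork↓) }) ]′
      (ℕₚ.m≤n⇒m<n∨m≡n (ℕ.s≤s⁻¹ (ℕ.s≤s⁻¹ si<)))

  final-segment-D : ∃ Big → ∃ λ a → ∃ λ k → a ℕ.+ (3 ℕ.+ k) ≡ 3 ℕ.+ p ×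
                    (∀ v → Big v → a ℕ.≤ toℕ v) × (∀ v → a ℕ.≤ toℕ v → Big v)
  final-segment-D bigs = a , k , a+k , lower , upper
    where
    p∈ = proj₁ (trivalent bigs)
    f₂∈ : Mem I (2 ℕ.+ p)
    f₂∈ = by-cases (mem? I (suc p))
      where
      by-cases : Dec (Mem I (suc p)) → Mem I (2 ℕ.+ p)
      by-cases (yes f₁∈) = second-fork p∈ f₁∈
      by-cases (no ¬f₁)  = no-forks p∈ (proj₂ (trivalent bigs)) ¬f₁
    f₁∈ = first-fork p∈ f₂∈
    from-p : ∀ j → p ℕ.≤ j → j ℕ.< 3 ℕ.+ p → Mem I j
    from-p j p≤j j< = [ (λ j<2 → [ (λ j<1 → subst (Mem I) (ℕₚ.≤-antisym p≤j (ℕ.s≤s⁻¹ j<1)) p∈) , (λ { refl → f₁∈ }) ]′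
        (ℕₚ.m≤n⇒m<n∨m≡n (ℕ.s≤s⁻¹ j<2))) , (λ { refl → f₂∈ }) ]′ (ℕₚ.m≤n⇒m<n∨m≡n (ℕ.s≤s⁻¹ j<))
    onwards : ∀ v → Big v → ∀ j → toℕ v ℕ.≤ j → j ℕ.< 3 ℕ.+ p → Mem I j
    onwards v bigv j v≤j j< = [ (λ p≤j → from-p j p≤j j<) ,
      (λ j≤p → [ (λ v<p → big-onwards v bigv v<p j v≤j j≤p) ,
                 (λ p≤v → from-p j (ℕₚ.≤-trans p≤v v≤j) j<) ]′ (ℕₚ.<-≤-connex (toℕ v) p)) ]′ (ℕₚ.≤-total p j)
    segment = tail I Big onwards (proj₁ p∈) (big p∈ f₁∈ (up ℕₚ.≤-refl))
    a = proj₁ segment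
    all = proj₁ (proj₂ (proj₂ segment))
    lower = proj₂ (proj₂ (proj₂ segment))
    a≤p : a ℕ.≤ p
    a≤p = subst (a ℕ.≤_) (proj₂ (proj₂ p∈)) (proj₁ (proj₂ segment))
    k = p ℕ.∸ a
    a+k : a ℕ.+ (3 ℕ.+ k) ≡ 3 ℕ.+ p
    a+k = trans (trans (ℕₚ.+-suc a (2 ℕ.+ k)) (cong suc (trans (ℕₚ.+-suc a (suc k)) (cong suc (ℕₚ.+-suc a k)))))
                (cong (3 ℕ.+_) (ℕₚ.m+[n∸m]≡n a≤p))
    upper : ∀ v → a ℕ.≤ toℕ v → Big v
    upper v a≤v = subst Big (toℕ-injective (proj₂ (proj₂ v∈))) ([ low , high ]′ (ℕₚ.≤-<-connex (toℕ v) p))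
      where
      v∈ : Mem I (toℕ v)
      v∈ = all (toℕ v) a≤v (toℕ<n v)
      low : toℕ v ℕ.≤ p → Big (proj₁ v∈)
      low v≤p = big v∈ (all (suc (toℕ v)) (ℕₚ.m≤n⇒m≤1+n a≤v) (ℕₚ.≤-trans (ℕ.s≤s (ℕ.s≤s v≤p)) (ℕₚ.n≤1+n (2 ℕ.+ p)))) (up v≤p)
      high : p ℕ.< toℕ v → Big (proj₁ v∈)
      high p<v = big v∈ p∈ ([ (λ v<2 → subst (λ z → EdgeD p z p) (ℕₚ.≤-antisym p<v (ℕ.s≤s⁻¹ v<2)) (down ℕₚ.≤-refl)) ,
                             (λ v≡2 → subst (λ z → EdgeD p z p) (sym v≡2) fork↓) ]′ (ℕₚ.m≤n⇒m<n∨m≡n (ℕ.s≤s⁻¹ (toℕ<n v))))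

half : ∀ k → (∃ λ q → k ≡ q ℕ.* 2) ⊎ (∃ λ q → k ≡ suc (q ℕ.* 2))
half zero    = inj₁ (0 , refl)
half (suc k) = [ (λ (q , e) → inj₂ (q , cong suc e)) , (λ (q , e) → inj₁ (suc q , cong suc e)) ]′ (half k)

-- The segment has type `D (3 + k)`, where k = 0 means A_3. Even k is obstructed and odd k gives
-- even size; in rank 4 an odd k forces a = 0, so the segment is the whole diagram.
trivial⇒classified-D : ∀ p I → ∃ (I≥2 (D (4 ℕ.+ p)) I) → OppositionTrivial (D (4 ℕ.+ p)) I → Classified (D (4 ℕ.+ p)) I
trivial⇒classified-D p I bigs opp = by-parity (half k)
  where
  open TypeD (suc p) I opp
  segment = final-segment-D bigs
  a = proj₁ segment
  k = proj₁ (proj₂ segment)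
  a+k = proj₁ (proj₂ (proj₂ segment))
  lower = proj₁ (proj₂ (proj₂ (proj₂ segment)))
  upper = proj₂ (proj₂ (proj₂ (proj₂ segment)))
  K : OfType (D (3 ℕ.+ k)) (D (4 ℕ.+ p)) (I≥2 (D (4 ℕ.+ p)) I)
  K = ofType-D-tail I a k a+k lower upper
  even : ∀ q → k ≡ suc (q ℕ.* 2) → ∀ p′ → p ≡ p′ → Classified (D (4 ℕ.+ p)) I
  even q k≡ zero refl = case2D λ v → upper v (subst (ℕ._≤ toℕ v) (sym a≡0) ℕ.z≤n)
    where
    a≡0 : a ≡ 0
    a≡0 = ℕₚ.+-cancelʳ-≡ (3 ℕ.+ k) a 0 (ℕₚ.≤-antisym
      (ℕₚ.≤-trans (ℕₚ.≤-reflexive a+k) (ℕ.s≤s (ℕ.s≤s (ℕ.s≤s (subst (1 ℕ.≤_) (sym k≡) (ℕ.s≤s ℕ.z≤n))))))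
      (ℕₚ.m≤n+m (3 ℕ.+ k) a))
  even q k≡ (suc p′) refl = case3 (ℕₚ.m≤m+n 5 p′) (2 ℕ.+ q) (ℕₚ.m≤m+n 2 q)
    (subst (ℕ._≤ 5 ℕ.+ p′) size (subst (3 ℕ.+ k ℕ.≤_) a+k (ℕₚ.m≤n+m (3 ℕ.+ k) a)))
    (subst (λ m → OfType (D m) (D (5 ℕ.+ p′)) (I≥2 (D (5 ℕ.+ p′)) I)) size K)
    where
    size : 3 ℕ.+ k ≡ 2 ℕ.* (2 ℕ.+ q)
    size = trans (cong (3 ℕ.+_) k≡) (ℕₚ.*-comm (2 ℕ.+ q) 2)
  by-parity : (∃ λ q → k ≡ q ℕ.* 2) ⊎ (∃ λ q → k ≡ suc (q ℕ.* 2)) → Classified (D (4 ℕ.+ p)) I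
  by-parity (inj₁ (q , k≡)) = contradiction opp
    (Push.obstruction (D (4 ℕ.+ p)) (finite-D (suc p)) I (D (3 ℕ.+ k))
      (Criterion.ofType⇒component (D (4 ℕ.+ p)) (finite-D (suc p)) I K)
      (subst (λ k → Obstructed (D (3 ℕ.+ k))) (sym k≡) (obstructed-D q)))
  by-parity (inj₂ (q , k≡)) = even q k≡ p refl

-- The two implications over all types.

rigid-D-even : ∀ m → 2 ℕ.≤ m → Rigid (D (2 ℕ.* m))
rigid-D-even (suc (suc q)) _ = subst (Rigid ∘ D) (ℕₚ.*-comm (2 ℕ.+ q) 2) (rigid-D q)
rigid-D-even 1 (ℕ.s≤s ())

rigid-B-≥2 : ∀ m → 2 ℕ.≤ m → Rigid (B m)
rigid-B-≥2 (suc (suc n)) _ = rigid-B n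
rigid-B-≥2 1 (ℕ.s≤s ())

rigid-C-≥2 : ∀ m → 2 ℕ.≤ m → Rigid (C m)
rigid-C-≥2 (suc (suc n)) _ = rigid-C n
rigid-C-≥2 1 (ℕ.s≤s ())

finite : ∀ t → ValidType t → FiniteType t
finite (A (suc n)) _ = finite-A n
finite (B (suc (suc n))) _ = finite-B n
finite (B 1) (ℕ.s≤s ())
finite (C (suc (suc n))) _ = finite-C n
finite (C 1) (ℕ.s≤s ())
finite (D (suc (suc (suc n)))) _ = finite-D n
finite (D 1) (ℕ.s≤s ())
finite (D 2) (ℕ.s≤s (ℕ.s≤s ()))
finite E₆ _ = finite-E₆
finite E₇ _ = finite-E₇
finite E₈ _ = finite-E₈
finite F₄ _ = finite-F₄
finite G₂ _ = finite-G₂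

whole : ∀ t I → (∀ v → I≥2 t I v) → OfType t t (I≥2 t I)
whole t I all = id , id , (λ v → (λ _ → v , refl) , λ _ → all v) , λ _ _ → refl

classified⇒trivial : ∀ t → FiniteType t → ∀ I → Classified t I → OppositionTrivial t I
classified⇒trivial t fin I = go
  where
  by : ∀ t′ → Rigid t′ → OfType t′ t (I≥2 t I) → OppositionTrivial t I
  by = λ t′ → Criterion.ofType⇒trivial t fin I {t′}
  go : Classified t I → OppositionTrivial t I
  go (case1B m 2≤m _ K) = by (B m) (rigid-B-≥2 m 2≤m) K
  go (case1C m 2≤m _ K) = by (C m) (rigid-C-≥2 m 2≤m) K
  go (case2D all) = by (D 4) (rigid-D 0) (whole (D 4) I all)
  go (case2G all) = by G₂ rigid-G₂ (whole G₂ I all)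
  go (case3 _ m 2≤m _ K) = by (D (2 ℕ.* m)) (rigid-D-even m 2≤m) K
  go (case4 (inj₁ K)) = by (B 2) (rigid-B 0) K
  go (case4 (inj₂ (inj₁ K))) = by (B 3) (rigid-B 1) K
  go (case4 (inj₂ (inj₂ (inj₁ K)))) = by (C 3) (rigid-C 1) K
  go (case4 (inj₂ (inj₂ (inj₂ K)))) = by F₄ rigid-F₄ K
  go (case5 K) = by (D 4) (rigid-D 0) K
  go (case6 (inj₁ K)) = by (D 4) (rigid-D 0) K
  go (case6 (inj₂ (inj₁ K))) = by (D 6) (rigid-D 1) K
  go (case6 (inj₂ (inj₂ K))) = by E₇ rigid-E₇ K
  go (case7 (inj₁ K)) = by (D 4) (rigid-D 0) K
  go (case7 (inj₂ (inj₁ K))) = by (D 6) (rigid-D 1) K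
  go (case7 (inj₂ (inj₂ (inj₁ K)))) = by E₇ rigid-E₇ K
  go (case7 (inj₂ (inj₂ (inj₂ K)))) = by E₈ rigid-E₈ K

trivial⇒classified : ∀ t → ValidType t → ∀ I → ∃ (I≥2 t I) → OppositionTrivial t I → Classified t I
trivial⇒classified (A (suc n)) _ I bigs opp = contradiction opp (no-trivial-A n I bigs)
trivial⇒classified (B (suc (suc m))) _ = trivial⇒classified-B m
trivial⇒classified (B 1) (ℕ.s≤s ())
trivial⇒classified (C (suc (suc m))) _ = trivial⇒classified-C m
trivial⇒classified (C 1) (ℕ.s≤s ())
trivial⇒classified (D (suc (suc (suc (suc p))))) _ = trivial⇒classified-D p
trivial⇒classified (D 1) (ℕ.s≤s ())
trivial⇒classified (D 2) (ℕ.s≤s (ℕ.s≤s ()))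
trivial⇒classified (D 3) (ℕ.s≤s (ℕ.s≤s (ℕ.s≤s ())))
trivial⇒classified E₆ _ = trivial⇒classified-E₆
trivial⇒classified E₇ _ = trivial⇒classified-E₇
trivial⇒classified E₈ _ = trivial⇒classified-E₈
trivial⇒classified F₄ _ = trivial⇒classified-F₄
trivial⇒classified G₂ _ = trivial⇒classified-G₂

theoremA3p1 : (t : CartanType) → ValidType t → (I : Subset (rank t)) →
    ∃ (λ v → I≥2 t I v) →
    (OppositionTrivial t I → Classified t I) × (Classified t I → OppositionTrivial t I)
theoremA3p1 t valid I bigs = trivial⇒classified t valid I bigs , classified⇒trivial t (finite t valid) I
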